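{- Let $n$ be a power of an odd prime or the product of at most three (not necessarily distinct) odd primes. Then every subset of $\mathbb{Z}_n$ is uniquely determined up to translation by its $3$-deck: if $E,F\subseteq\mathbb{Z}_n$ have the same $3$-deck, then $F=E+t$ for some $t\in\mathbb{Z}_n$.
   Context: For $f:\mathbb{Z}_n\to\mathbb{R}$, the $3$-deck is $N_{f,3}(x_1,x_2)=\sum_{x\in\mathbb{Z}_n} f(x)f(x+x_1)f(x+x_2)$ for $x_1,x_2\in\mathbb{Z}_n$; the $3$-deck of $E\subseteq\mathbb{Z}_n$ is that of its indicator function $\chi_E$. -}

module Defs where

open import Data.Nat using (ℕ; zero; suc; _+_; _*_; _%_; _≤_; _<_; _^_; NonZero)
open import Data.Nat.DivMod using (m%n<n)
open import Data.Nat.Primality using (Prime)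
open import Data.Nat.Divisibility using (_∣_)
open import Data.Fin using (Fin; toℕ; fromℕ<)
open import Data.Bool using (Bool; true; false)
open import Data.List using (List; length)
open import Data.Nat.ListAction using (product)
open import Data.List.Relation.Unary.All using (All)
open import Data.Product using (Σ; ∃; ∃-syntax; _×_)
open import Data.Sum using (_⊎_)
open import Relation.Nullary using (¬_)
open import Function using (_∘_)
open import Relation.Binary.PropositionalEquality using (_≡_)

_+ₙ_ : ∀ {n} .{{_ : NonZero n}} → Fin n → Fin n → Fin n
_+ₙ_ {n} a b = fromℕ< (m%n<n (toℕ a + toℕ b) n)

sumFin : ∀ {n} → (Fin n → ℕ) → ℕ
sumFin {zero} f = 0
sumFin {suc n} f = f Fin.zero + sumFin (f ∘ Fin.suc)

Subsetₙ : ℕ → Set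
Subsetₙ n = Fin n → Bool

χ : Bool → ℕ
χ true = 1
χ false = 0

deck3 : ∀ {n} .{{_ : NonZero n}} → Subsetₙ n → Fin n → Fin n → ℕ
deck3 E x₁ x₂ = sumFin λ x → χ (E x) * χ (E (x +ₙ x₁)) * χ (E (x +ₙ x₂))

-- translate E + t = { e + t | e ∈ E }, i.e. (E + t)(y) = E(y - t);
-- stated as: F = E + t  iff  ∀ x, F (x + t) = E x
IsTranslate : ∀ {n} .{{_ : NonZero n}} → Subsetₙ n → Subsetₙ n → Fin n → Set
IsTranslate F E t = ∀ x → F (x +ₙ t) ≡ E x

OddPrime : ℕ → Set
OddPrime p = Prime p × ¬ (2 ∣ p)

OddPrimePower : ℕ → Set
OddPrimePower n = ∃[ p ] ∃[ k ] (OddPrime p × 1 ≤ k × n ≡ p ^ k)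

ProductOfAtMost3OddPrimes : ℕ → Set
ProductOfAtMost3OddPrimes n =
  ∃[ ps ] (All OddPrime ps × length ps ≤ 3 × n ≡ product ps)

{-# OPTIONS --safe #-}
module Submission where

-- The Fourier coefficients of E and F are the values F(k) = f(ζᵏ), G(k) = g(ζᵏ) of their generating
-- polynomials, taken in the ring ℤ[ζ] of cyclotomic integers. Equal 3-decks mean F(a)F(b)F(c) = G(a)G(b)G(c)
-- whenever a + b + c ≡ 0 (mod n), so G/F is a partial homomorphism on the support of F, and that support is a
-- union of classes of frequencies of equal order.
--
-- Fix a frequency a of order d in the support and put W = G(a)/F(a). As n is odd, 2 is a unit mod n and
-- W² = σ₂W, so W is a root of unity of odd order. Frobenius at large primes then gives σ_k W = Wᵏ whenever all
-- prime factors of k are large; such k ≡ 1 (mod d) yield W^d = 1, that is W = ζ^(at) for some t. Every residue is a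
-- sum of two units, so G(ma) = ζ^(mat) F(ma) for all m: each order in the support has a phase t.
--
-- By the Chinese remainder theorem it remains to show that the phases of orders d and d′ agree modulo c = gcd(d, d′).
-- This is clear if the order c is in the support, which leaves only n = pqr, d = pq, d′ = pr. There the phases
-- are linked through the order n or q r if one of these is in the support. Otherwise every coset of the subgroup of
-- order q r carries a function u(y) + v(z), y ∈ ℤ/q, z ∈ ℤ/r, with the same sum on all cosets. Being 0/1-valued it
-- depends on y alone or on z alone; both occur, so r k = q l with 0 < k < q, which is impossible as q ≠ r.

-- The arithmetic rests on two facts: the ring of Fourier values has no zero divisors, and every
-- unit k modulo n acts on it by ζ ↦ ζᵏ. They usually come from the irreducibility of the cyclotomic
-- polynomial Φₙ; here they come from the group ring ℤ[x]/(xⁿ - 1) itself. The product of 1 -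
-- x^(n/p) over the primes p dividing n vanishes at an n-th root of unity exactly when that root is
-- not primitive, so its annihilator is the ideal of Φₙ, and equality modulo this annihilator is a
-- comparison of finitely many integers. One device serves both for zero divisors and for roots of
-- unity: Frobenius gives a congruence modulo a prime q, and once q exceeds a bound on the
-- coefficients the congruence is an equality. A prime in a given residue class would require
-- Dirichlet's theorem; a number without small prime factors is enough, because the equalities
-- compose along its factorisation. W need not lie in the ring, so statements about it are cleared
-- of denominators. Its order has to be odd because k = 1 + dm must avoid the prime 2, which forces
-- m to be even when d is odd, while m must be prime to that order.

open import Defs
open import Data.Nat using (ℕ; NonZero)
open import Data.Fin using (Fin)
open import Data.Product using (∃-syntax)
open import Data.Sum using (_⊎_)
open import Relation.Binary.PropositionalEquality using (_≡_)
open import Data.Product.Base using (_×_; _,_; proj₁; proj₂)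
open import Data.Sum.Base using (inj₁; inj₂; reduce)
open import Data.Empty using (⊥; ⊥-elim)
open import Relation.Nullary using (¬_; Dec; yes; no)

-- Congruences, the Chinese remainder theorem, and sieving by small primes.

module Arith where

  open import Data.Nat
  open import Data.Nat.Properties
  open import Data.Nat.Divisibility
  open import Data.Nat.DivMod using (m%n<n; m≡m%n+[m/n]*n; [m+kn]%n≡m%n; m<n⇒m%n≡m)
  open import Data.Nat.GCD using (gcd; gcd[m,n]∣m; gcd[m,n]∣n; gcd-greatest; c*gcd[m,n]≡gcd[cm,cn]; gcd-comm; module Bézout; gcd[m,n]≢0)
  open import Data.Nat.LCM using (lcm; m∣lcm[m,n]; n∣lcm[m,n]; lcm-least; gcd*lcm)
  open import Data.Nat.Coprimality using (Coprime; coprime⇒gcd≡1; gcd≡1⇒coprime)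
  open import Data.Nat.Primality
  open import Data.Nat.Primality.Factorisation using (factorise; factors; PrimeFactorisation; factorisationUnique)
  open import Data.Nat.ListAction using (product)
  open import Data.Nat.ListAction.Properties using (product-++; ∈⇒∣product)
  open import Data.Nat.Tactic.RingSolver using (solve-∀)
  open import Data.Fin.Base using (toℕ; fromℕ<)
  open import Data.Fin.Properties using (pigeonhole; toℕ-fromℕ<)
  open import Data.List.Base using (List; []; _∷_; _++_; length)
  open import Data.List.Properties using (length-++)
  open import Data.List.Membership.Propositional using (_∈_)
  open import Data.List.Relation.Unary.Any using (here; there)
  open import Data.List.Relation.Unary.All using (All; []; _∷_)
  open import Data.List.Relation.Unary.All.Properties using (++⁺)
  open import Data.List.Relation.Binary.Permutation.Propositional.Properties using (↭-length)
  import Relation.Nullary.Decidable as Dec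
  open import Relation.Binary.PropositionalEquality

  infix 4 _∼_[_]

  -- Congruence of naturals without subtraction or division: multiples of the modulus are added on
  -- both sides. Modulus 0 is allowed and means equality.
  record _∼_[_] (i j d : ℕ) : Set where
    constructor cong-by
    field
      kˡ kʳ : ℕ
      shifted : i + kˡ * d ≡ j + kʳ * d

  private
    variable
      d e i j k l m n p q : ℕ

  ∼-reflexive : i ≡ j → i ∼ j [ d ]
  ∼-reflexive refl = cong-by 0 0 refl

  ∼-refl : i ∼ i [ d ]
  ∼-refl = ∼-reflexive refl

  ∼-sym : i ∼ j [ d ] → j ∼ i [ d ]
  ∼-sym (cong-by x y eq) = cong-by y x (sym eq)

  ∼-trans : i ∼ j [ d ] → j ∼ k [ d ] → i ∼ k [ d ]
  ∼-trans {i} {j} {d} {k} (cong-by x y eq) (cong-by z w eq′) = cong-by (x + z) (y + w) (begin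
    i + (x + z) * d    ≡⟨ lemma i x z d ⟩
    i + x * d + z * d  ≡⟨ cong (_+ z * d) eq ⟩
    j + y * d + z * d  ≡⟨ lemma′ j y z d ⟩
    j + z * d + y * d  ≡⟨ cong (_+ y * d) eq′ ⟩
    k + w * d + y * d  ≡⟨ lemma″ k w y d ⟩
    k + (y + w) * d    ∎)
    where
    open ≡-Reasoning
    lemma : ∀ i x z d → i + (x + z) * d ≡ i + x * d + z * d
    lemma = solve-∀
    lemma′ : ∀ j y z d → j + y * d + z * d ≡ j + z * d + y * d
    lemma′ = solve-∀
    lemma″ : ∀ k w y d → k + w * d + y * d ≡ k + (y + w) * d
    lemma″ = solve-∀

  ∼-+ : i ∼ j [ d ] → k ∼ l [ d ] → i + k ∼ j + l [ d ]
  ∼-+ {i} {j} {d} {k} {l} (cong-by x y eq) (cong-by z w eq′) = cong-by (x + z) (y + w) (begin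
    i + k + (x + z) * d      ≡⟨ lemma i k x z d ⟩
    (i + x * d) + (k + z * d) ≡⟨ cong₂ _+_ eq eq′ ⟩
    (j + y * d) + (l + w * d) ≡⟨ lemma j l y w d ⟨
    j + l + (y + w) * d      ∎)
    where
    open ≡-Reasoning
    lemma : ∀ i k x z d → i + k + (x + z) * d ≡ (i + x * d) + (k + z * d)
    lemma = solve-∀

  ∼-*ˡ : ∀ c → i ∼ j [ d ] → c * i ∼ c * j [ d ]
  ∼-*ˡ {i} {j} {d} c (cong-by x y eq) = cong-by (c * x) (c * y) (begin
    c * i + c * x * d  ≡⟨ lemma c i x d ⟩
    c * (i + x * d)    ≡⟨ cong (c *_) eq ⟩
    c * (j + y * d)    ≡⟨ lemma c j y d ⟨
    c * j + c * y * d  ∎)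
    where
    open ≡-Reasoning
    lemma : ∀ c i x d → c * i + c * x * d ≡ c * (i + x * d)
    lemma = solve-∀

  ∼-*ʳ : ∀ c → i ∼ j [ d ] → i * c ∼ j * c [ d ]
  ∼-*ʳ {i} {j} {d} c eq = subst₂ (_∼_[ d ]) (*-comm c i) (*-comm c j) (∼-*ˡ c eq)

  ∼-+-cancelˡ : ∀ c → c + i ∼ c + j [ d ] → i ∼ j [ d ]
  ∼-+-cancelˡ {i} {j} {d} c (cong-by x y eq) =
    cong-by x y (+-cancelˡ-≡ c _ _ (trans (sym (+-assoc c i _)) (trans eq (+-assoc c j _))))

  ∼-+-cancelʳ : ∀ c → i + c ∼ j + c [ d ] → i ∼ j [ d ]
  ∼-+-cancelʳ {i} {j} {d} c eq = ∼-+-cancelˡ c (subst₂ (_∼_[ d ]) (+-comm i c) (+-comm j c) eq)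

  ∼-weaken : e ∣ d → i ∼ j [ d ] → i ∼ j [ e ]
  ∼-weaken {e = e} {i = i} {j = j} (divides-refl r) (cong-by x y eq) =
    cong-by (x * r) (y * r)
      (trans (cong (i +_) (*-assoc x r e)) (trans eq (cong (j +_) (sym (*-assoc y r e)))))

  ∣⇒∼0 : d ∣ i → i ∼ 0 [ d ]
  ∣⇒∼0 {i = i} (divides q refl) = cong-by 0 q (+-identityʳ i)

  ∼⇒∣ : i ∼ j [ d ] → d ∣ i → d ∣ j
  ∼⇒∣ {i} {j} {d} (cong-by x y eq) d∣i =
    ∣m+n∣m⇒∣n (subst (d ∣_) (trans eq (+-comm j (y * d))) (∣m∣n⇒∣m+n d∣i (n∣m*n x))) (n∣m*n y)

  ∼0⇒∣ : i ∼ 0 [ d ] → d ∣ i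
  ∼0⇒∣ {d = d} eq = ∼⇒∣ (∼-sym eq) (d ∣0)

  ∼+d : ∀ x → i + x * d ∼ i [ d ]
  ∼+d {i} x = cong-by 0 x (+-identityʳ _)

  ∼⇒∣dist : i ∼ j [ d ] → d ∣ ∣ i - j ∣
  ∼⇒∣dist {i} {j} {d} eq with ≤-total i j
  ... | inj₁ i≤j = subst (d ∣_) (sym (m≤n⇒∣m-n∣≡n∸m i≤j))
          (∼0⇒∣ (∼-+-cancelˡ i (subst₂ (_∼_[ d ]) (sym (m+[n∸m]≡n i≤j)) (sym (+-identityʳ i)) (∼-sym eq))))
  ... | inj₂ j≤i = subst (d ∣_) (sym (m≤n⇒∣n-m∣≡n∸m j≤i))
          (∼0⇒∣ (∼-+-cancelˡ j (subst₂ (_∼_[ d ]) (sym (m+[n∸m]≡n j≤i)) (sym (+-identityʳ j)) eq)))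

  ∣dist⇒∼ : d ∣ ∣ i - j ∣ → i ∼ j [ d ]
  ∣dist⇒∼ {d} {i} {j} h with ≤-total i j
  ... | inj₁ i≤j = subst₂ (_∼_[ d ]) (+-identityʳ i) (m+[n∸m]≡n i≤j)
          (∼-+ (∼-refl {i}) (∼-sym (∣⇒∼0 (subst (d ∣_) (m≤n⇒∣m-n∣≡n∸m i≤j) h))))
  ... | inj₂ j≤i = subst₂ (_∼_[ d ]) (m+[n∸m]≡n j≤i) (+-identityʳ j)
          (∼-+ (∼-refl {j}) (∣⇒∼0 (subst (d ∣_) (m≤n⇒∣n-m∣≡n∸m j≤i) h)))

  _∼?_[_] : ∀ i j d → Dec (i ∼ j [ d ])
  i ∼? j [ d ] = Dec.map′ ∣dist⇒∼ ∼⇒∣dist (d ∣? ∣ i - j ∣)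

  ∼-cancel-* : ∀ c .{{_ : NonZero c}} → c * i ∼ c * j [ c * d ] → i ∼ j [ d ]
  ∼-cancel-* {i} {j} {d} c (cong-by x y eq) = cong-by x y (*-cancelˡ-≡ _ _ c (begin
    c * (i + x * d)      ≡⟨ lemma c i x d ⟩
    c * i + x * (c * d)  ≡⟨ eq ⟩
    c * j + y * (c * d)  ≡⟨ lemma c j y d ⟨
    c * (j + y * d)      ∎))
    where
    open ≡-Reasoning
    lemma : ∀ c i x d → c * (i + x * d) ≡ c * i + x * (c * d)
    lemma = solve-∀

  ∼-scale : ∀ c → i ∼ j [ d ] → c * i ∼ c * j [ c * d ]
  ∼-scale {i} {j} {d} c (cong-by x y eq) = cong-by x y (begin
    c * i + x * (c * d)  ≡⟨ lemma c i x d ⟨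
    c * (i + x * d)      ≡⟨ cong (c *_) eq ⟩
    c * (j + y * d)      ≡⟨ lemma c j y d ⟩
    c * j + y * (c * d)  ∎)
    where
    open ≡-Reasoning
    lemma : ∀ c i x d → c * (i + x * d) ≡ c * i + x * (c * d)
    lemma = solve-∀

  bézout : ∀ j n .{{_ : NonZero n}} → ∃[ x ] j * x ∼ gcd j n [ n ]
  bézout j n@(suc n-1) with Bézout.identity (Data.Nat.GCD.gcd-GCD j n)
  ... | Bézout.+- x y eq = x , cong-by 0 y (trans (+-identityʳ _) (trans (*-comm j x) (sym eq)))
  ... | Bézout.-+ x y eq = x * n-1 , cong-by y (x * j) (begin
    j * (x * n-1) + y * n              ≡⟨ cong (j * (x * n-1) +_) (sym eq) ⟩
    j * (x * n-1) + (gcd j n + x * j)  ≡⟨ lemma j x n-1 (gcd j n) ⟩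
    gcd j n + x * j * n                ∎)
    where
    open ≡-Reasoning
    lemma : ∀ j x n-1 g → j * (x * n-1) + (g + x * j) ≡ g + x * j * suc n-1
    lemma = solve-∀

  coprime-inverse : ∀ k n .{{_ : NonZero n}} → Coprime k n → ∃[ k′ ] k * k′ ∼ 1 [ n ]
  coprime-inverse k n co with bézout k n
  ... | x , eq = x , subst (λ g → k * x ∼ g [ n ]) (coprime⇒gcd≡1 co) eq

  -- With `w = gcd u v` one has u v = w lcm(u, v), so it suffices that x w divides u v, which is the
  -- gcd of a a, a b, c a and c b. The first three are clear from x ∣ a and w ∣ a, b, c; for c b use
  -- b c = gcd(b, c) lcm(b, c).
  gcd-lcm-distrib : ∀ a b c .{{_ : NonZero a}} → gcd a (lcm b c) ∣ lcm (gcd a b) (gcd a c)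
  gcd-lcm-distrib a b c =
    *-cancelʳ-∣ w {{≢-nonZero w≢0}} (subst (x * w ∣_) (trans (sym (gcd*lcm u v)) (*-comm w _)) xw∣uv)
    where
    x = gcd a (lcm b c)
    u = gcd a b
    v = gcd a c
    w = gcd u v
    w≢0 : w ≢ 0
    w≢0 = gcd[m,n]≢0 u v (inj₁ (gcd[m,n]≢0 a b (inj₁ (≢-nonZero⁻¹ a))))
    x∣a = gcd[m,n]∣m a (lcm b c)
    w∣a = ∣-trans (gcd[m,n]∣m u v) (gcd[m,n]∣m a b)
    w∣b = ∣-trans (gcd[m,n]∣m u v) (gcd[m,n]∣n a b)
    w∣c = ∣-trans (gcd[m,n]∣n u v) (gcd[m,n]∣n a c)
    xw∣bc : x * w ∣ c * b
    xw∣bc = subst₂ _∣_ (*-comm w x) (trans (gcd*lcm b c) (*-comm b c))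
              (*-pres-∣ (gcd-greatest w∣b w∣c) (gcd[m,n]∣n a (lcm b c)))
    xw∣uv : x * w ∣ u * v
    xw∣uv = subst (x * w ∣_) (sym (c*gcd[m,n]≡gcd[cm,cn] u a c)) (gcd-greatest
      (subst (x * w ∣_) (trans (sym (c*gcd[m,n]≡gcd[cm,cn] a a b)) (*-comm a u))
        (gcd-greatest (*-pres-∣ x∣a w∣a) (*-pres-∣ x∣a w∣b)))
      (subst (x * w ∣_) (trans (sym (c*gcd[m,n]≡gcd[cm,cn] c a b)) (*-comm c u))
        (gcd-greatest (subst (x * w ∣_) (*-comm a c) (*-pres-∣ x∣a w∣c)) xw∣bc)))

  chinese-remainder₂ : ∀ d₁ d₂ .{{_ : NonZero d₂}} {t₁ t₂} → t₁ ∼ t₂ [ gcd d₁ d₂ ] →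
                       ∃[ t ] (t ∼ t₁ [ d₁ ] × t ∼ t₂ [ d₂ ])
  chinese-remainder₂ d₁ d₂@(suc e) {t₁} {t₂} (cong-by x y eq) with bézout d₁ d₂
  ... | u , d₁u∼g = t₁ + d₁ * u * z , first , second
    where
    g = gcd d₁ d₂
    -- Stands for x - y, since e = d₂ - 1 acts as -1 modulo d₂; the given congruence says t₂ - t₁ =
    -- (x - y) g.
    z = x + e * y
    first : t₁ + d₁ * u * z ∼ t₁ [ d₁ ]
    first = subst (_∼ t₁ [ d₁ ]) (cong (t₁ +_) (lemma u z d₁)) (∼+d (u * z))
      where
      lemma : ∀ u z d₁ → u * z * d₁ ≡ d₁ * u * z
      lemma = solve-∀
    lemma₁ : ∀ t₁ x y e g → t₁ + g * (x + e * y) ≡ (t₁ + x * g) + g * e * y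
    lemma₁ = solve-∀
    lemma₂ : ∀ t₂ y e g → (t₂ + y * g) + g * e * y ≡ t₂ + g * y * suc e
    lemma₂ = solve-∀
    second : t₁ + d₁ * u * z ∼ t₂ [ d₂ ]
    second = ∼-trans (∼-+ (∼-refl {t₁}) (∼-*ʳ z d₁u∼g)) (subst (_∼ t₂ [ d₂ ])
      (sym (trans (lemma₁ t₁ x y e g) (trans (cong (_+ g * e * y) eq) (lemma₂ t₂ y e g))))
      (∼+d (g * y)))

  moduli-lcm : List (ℕ × ℕ) → ℕ
  moduli-lcm []            = 1
  moduli-lcm ((d , _) ∷ l) = lcm d (moduli-lcm l)

  ∣moduli-lcm : ∀ {l} {x : ℕ × ℕ} → x ∈ l → proj₁ x ∣ moduli-lcm l
  ∣moduli-lcm {(d , _) ∷ l} (here refl) = m∣lcm[m,n] d (moduli-lcm l)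
  ∣moduli-lcm {(d , _) ∷ l} (there x∈l) = ∣-trans (∣moduli-lcm x∈l) (n∣lcm[m,n] d (moduli-lcm l))

  -- Distributivity turns compatibility with each modulus into compatibility with their lcm, so that
  -- a pairwise compatible system can be solved by adding one congruence at a time.
  ∼-gcd-lcm : ∀ {t t₀} d₀ .{{_ : NonZero d₀}} l →
              (∀ {x} → x ∈ l → t ∼ t₀ [ gcd d₀ (proj₁ x) ]) → t ∼ t₀ [ gcd d₀ (moduli-lcm l) ]
  ∼-gcd-lcm {t} {t₀} d₀ [] h = cong-by t₀ t
    (subst (λ g → t + t₀ * g ≡ t₀ + t * g) (sym (∣1⇒≡1 (gcd[m,n]∣n d₀ 1))) (lemma t t₀))
    where
    lemma : ∀ t t₀ → t + t₀ * 1 ≡ t₀ + t * 1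
    lemma = solve-∀
  ∼-gcd-lcm d₀ ((d , _) ∷ l) h = ∣dist⇒∼ (∣-trans (gcd-lcm-distrib d₀ d (moduli-lcm l))
    (lcm-least (∼⇒∣dist (h (here refl))) (∼⇒∣dist (∼-gcd-lcm d₀ l (λ x∈l → h (there x∈l))))))

  chinese-remainder : (l : List (ℕ × ℕ)) → (∀ {x} → x ∈ l → NonZero (proj₁ x)) →
    (∀ {x y} → x ∈ l → y ∈ l → proj₂ x ∼ proj₂ y [ gcd (proj₁ x) (proj₁ y) ]) →
    ∃[ t ] (∀ {x} → x ∈ l → t ∼ proj₂ x [ proj₁ x ])
  chinese-remainder [] nz compatible = 0 , λ ()
  chinese-remainder ((d₀ , t₀) ∷ l) nz compatible
    with chinese-remainder l (λ x∈l → nz (there x∈l)) (λ x∈l y∈l → compatible (there x∈l) (there y∈l))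
  ... | t , t∼ with chinese-remainder₂ (moduli-lcm l) d₀ {{nz (here refl)}} (subst (t ∼ t₀ [_]) (gcd-comm d₀ _) t∼t₀)
    where
    t∼t₀ : t ∼ t₀ [ gcd d₀ (moduli-lcm l) ]
    t∼t₀ = ∼-gcd-lcm d₀ {{nz (here refl)}} l (λ {x} x∈l →
      ∼-trans (∼-weaken (gcd[m,n]∣n d₀ (proj₁ x)) (t∼ x∈l)) (∼-sym (compatible (here refl) (there x∈l))))
  ...   | s , s∼t , s∼t₀ = s , solves
    where
    solves : ∀ {x} → x ∈ (d₀ , t₀) ∷ l → s ∼ proj₂ x [ proj₁ x ]
    solves (here refl) = s∼t₀
    solves (there x∈l) = ∼-trans (∼-weaken (∣moduli-lcm x∈l) s∼t) (t∼ x∈l)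

  ∃-prime-divisor : ∀ d → d ≢ 1 → ∃[ p ] (Prime p × p ∣ d)
  ∃-prime-divisor zero d≢1 = 2 , prime[2] , 2 ∣0
  ∃-prime-divisor d@(suc _) d≢1 with factorise d
  ... | record { factors = [] ; isFactorisation = eq } = ⊥-elim (d≢1 eq)
  ... | record { factors = p ∷ ps ; isFactorisation = eq ; factorsPrime = p-prime ∷ _ } =
    p , p-prime , subst (p ∣_) (sym eq) (m∣m*n (product ps))

  coprime-by-primes : .{{_ : NonZero n}} → (∀ p → Prime p → p ≤ n → ¬ (p ∣ k × p ∣ n)) → Coprime k n
  coprime-by-primes {n} h {d} (d∣k , d∣n) with d ≟ 1
  ... | yes d≡1 = d≡1
  ... | no d≢1 with ∃-prime-divisor d d≢1
  ...   | p , p-prime , p∣d = ⊥-elim (h p p-prime (∣⇒≤ (∣-trans p∣d d∣n)) (∣-trans p∣d d∣k , ∣-trans p∣d d∣n))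

  coprime⇒no-common-prime : Coprime k n → Prime p → p ∣ k → p ∣ n → ⊥
  coprime⇒no-common-prime co p-prime p∣k p∣n = ¬prime[1] (subst Prime (co (p∣k , p∣n)) p-prime)

  coprime-* : .{{_ : NonZero n}} → Coprime i n → Coprime j n → Coprime (i * j) n
  coprime-* {n} {i} {j} co co′ = coprime-by-primes λ p p-prime _ (p∣ij , p∣n) →
    case-⊎ (euclidsLemma i j p-prime p∣ij)
      (λ p∣i → coprime⇒no-common-prime co p-prime p∣i p∣n)
      (λ p∣j → coprime⇒no-common-prime co′ p-prime p∣j p∣n)
    where
    case-⊎ : {A B : Set} → A ⊎ B → (A → ⊥) → (B → ⊥) → ⊥
    case-⊎ (inj₁ a) f g = f a
    case-⊎ (inj₂ b) f g = g b

  prime≥2 : Prime p → 2 ≤ p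
  prime≥2 {0}           pp = ⊥-elim (¬prime[0] pp)
  prime≥2 {1}           pp = ⊥-elim (¬prime[1] pp)
  prime≥2 {suc (suc _)} pp = s≤s (s≤s z≤n)

  prime∣!⇒≤ : Prime p → ∀ B → p ∣ B ! → p ≤ B
  prime∣!⇒≤ p-prime zero p∣1 = ⊥-elim (¬prime[1] (subst Prime (∣1⇒≡1 p∣1) p-prime))
  prime∣!⇒≤ p-prime (suc B) p∣ with euclidsLemma (suc B) (B !) p-prime p∣
  ... | inj₁ p∣sB = ∣⇒≤ p∣sB
  ... | inj₂ p∣B! = m≤n⇒m≤1+n (prime∣!⇒≤ p-prime B p∣B!)

  ≤⇒∣! : ∀ q .{{_ : NonZero q}} B → q ≤ B → q ∣ B !
  ≤⇒∣! (suc q) B q≤B = ∣-trans (m∣m*n (q !)) (m≤n⇒m!∣n! q≤B)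

  -- A step by B ! changes nothing modulo the primes up to B, but moves freely modulo B + 1 if that
  -- is prime. So b can be corrected one prime at a time without spoiling earlier corrections.
  sieve : (Good : ℕ → ℕ → Set) →
          (∀ {q b s} → q ∣ s → Good q b → Good q (b + s)) →
          (∀ {q} b {s} → Prime q → ¬ q ∣ s → ∃[ j ] Good q (b + j * s)) →
          ∀ B → ∃[ b ] (∀ q → Prime q → q ≤ B → Good q b)
  sieve Good periodic choose zero =
    0 , λ { q q-prime z≤n → ⊥-elim (¬prime[0] q-prime) }
  sieve Good periodic choose (suc B) with sieve Good periodic choose B | prime? (suc B)
  ... | b , good | no ¬p = b , λ q q-prime q≤ → good q q-prime
          (≤-pred (≤∧≢⇒< q≤ λ { refl → ¬p q-prime }))
  ... | b , good | yes p with choose b {B !} p (λ p∣B! → 1+n≰n (prime∣!⇒≤ p B p∣B!))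
  ...   | j , good-p = b + j * B ! , good′
    where
    good′ : ∀ q → Prime q → q ≤ suc B → Good q (b + j * B !)
    good′ q q-prime q≤ with q ≟ suc B
    ... | yes refl = good-p
    ... | no q≢ = periodic (∣n⇒∣m*n j (≤⇒∣! q {{prime⇒nonZero q-prime}} B q≤B)) (good q q-prime q≤B)
      where q≤B = ≤-pred (≤∧≢⇒< q≤ q≢)

  ∣-linear-shift : ∀ {q} α β b {s} → q ∣ s → q ∣ α + β * (b + s) → q ∣ α + β * b
  ∣-linear-shift {q} α β b {s} q∣s h =
    ∣m+n∣m⇒∣n (subst (q ∣_) (lemma α β b s) h) (∣n⇒∣m*n β q∣s)
    where
    lemma : ∀ α β b s → α + β * (b + s) ≡ β * s + (α + β * b)
    lemma = solve-∀

  -- The two values differ by β s: a linear form that is not zero modulo q has at most one root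
  -- there.
  linear-roots-differ : ∀ {q} α β b {s} → Prime q → ¬ (q ∣ α × q ∣ β) → ¬ q ∣ s →
                        q ∣ α + β * b → q ∣ α + β * (b + s) → ⊥
  linear-roots-differ {q} α β b {s} q-prime ¬both q∤s h h′
    with euclidsLemma β s q-prime (∣m+n∣m⇒∣n (subst (q ∣_) (lemma α β b s) h′) h)
    where
    lemma : ∀ α β b s → α + β * (b + s) ≡ (α + β * b) + β * s
    lemma = solve-∀
  ... | inj₂ q∣s = q∤s q∣s
  ... | inj₁ q∣β = ¬both (∣m+n∣m⇒∣n (subst (q ∣_) (+-comm α _) h) (∣m⇒∣m*n b q∣β) , q∣β)

  sieve-linear : ∀ α β → Coprime α β → ∀ B → ∃[ b ] (∀ q → Prime q → q ≤ B → ¬ q ∣ α + β * b)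
  sieve-linear α β co = sieve (λ q b → ¬ q ∣ α + β * b)
    (λ {q} {b} q∣s good h → good (∣-linear-shift α β b q∣s h)) choose
    where
    choose : ∀ {q} b {s} → Prime q → ¬ q ∣ s → ∃[ j ] ¬ q ∣ α + β * (b + j * s)
    choose {q} b {s} q-prime q∤s with q ∣? α + β * b
    ... | no good = 0 , subst (λ x → ¬ q ∣ α + β * x) (sym (+-identityʳ b)) good
    ... | yes bad = 1 , subst (λ x → ¬ q ∣ α + β * (b + x)) (sym (*-identityˡ s))
      (linear-roots-differ α β b q-prime (λ (q∣α , q∣β) → coprime⇒no-common-prime co q-prime q∣α q∣β) q∤s bad)

  -- Two linear forms exclude at most two residues, so an odd prime always leaves room.
  sieve-linear₂ : (Q : ℕ → Set) → (∀ q → Dec (Q q)) → (∀ {q} → Prime q → Q q → ¬ q ∣ 2) →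
    ∀ α β γ δ → (∀ {q} → Prime q → Q q → ¬ (q ∣ α × q ∣ β)) → (∀ {q} → Prime q → Q q → ¬ (q ∣ γ × q ∣ δ)) →
    ∀ B → ∃[ b ] (∀ q → Prime q → q ≤ B → Q q → ¬ q ∣ α + β * b × ¬ q ∣ γ + δ * b)
  sieve-linear₂ Q Q? odd α β γ δ ¬αβ ¬γδ = sieve Good
    (λ {q} {b} q∣s good Qq →
      (λ h → proj₁ (good Qq) (∣-linear-shift α β b q∣s h)) ,
      (λ h → proj₂ (good Qq) (∣-linear-shift γ δ b q∣s h))) choose
    where
    Good : ℕ → ℕ → Set
    Good q b = Q q → ¬ q ∣ α + β * b × ¬ q ∣ γ + δ * b
    choose : ∀ {q} b {s} → Prime q → ¬ q ∣ s → ∃[ j ] Good q (b + j * s)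
    choose {q} b {s} q-prime q∤s with Q? q
    ... | no ¬Q = 0 , λ Qq → ⊥-elim (¬Q Qq)
    ... | yes Qq = select (bad? α β (b + 0 * s)) (bad? γ δ (b + 0 * s)) (bad? α β (b + 1 * s)) (bad? γ δ (b + 1 * s))
      where
      bad? : ∀ α β x → Dec (q ∣ α + β * x)
      bad? α β x = q ∣? α + β * x
      q∤2s : ¬ q ∣ s + s
      q∤2s h with euclidsLemma 2 s q-prime (subst (q ∣_) (cong (s +_) (sym (+-identityʳ s))) h)
      ... | inj₁ q∣2 = odd q-prime Qq q∣2
      ... | inj₂ q∣s = q∤s q∣s
      step₀₁ : ∀ b s → b + 0 * s + s ≡ b + 1 * s
      step₀₁ = solve-∀
      step₀₂ : ∀ b s → b + 0 * s + (s + s) ≡ b + 2 * s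
      step₀₂ = solve-∀
      step₁₂ : ∀ b s → b + 1 * s + s ≡ b + 2 * s
      step₁₂ = solve-∀
      differ : ∀ α β x y {s} → ¬ (q ∣ α × q ∣ β) → ¬ q ∣ s → x + s ≡ y → q ∣ α + β * x → ¬ q ∣ α + β * y
      differ α β x y ¬αβ q∤s refl h h′ = linear-roots-differ α β x q-prime ¬αβ q∤s h h′
      select : Dec (q ∣ α + β * (b + 0 * s)) → Dec (q ∣ γ + δ * (b + 0 * s)) →
               Dec (q ∣ α + β * (b + 1 * s)) → Dec (q ∣ γ + δ * (b + 1 * s)) → ∃[ j ] Good q (b + j * s)
      select (no a₀) (no c₀) _ _ = 0 , λ _ → a₀ , c₀
      select (yes a₀) _ _ (no c₁) = 1 , λ _ → differ α β _ _ (¬αβ q-prime Qq) q∤s (step₀₁ b s) a₀ , c₁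
      select (yes a₀) _ _ (yes c₁) = 2 , λ _ → differ α β _ _ (¬αβ q-prime Qq) q∤2s (step₀₂ b s) a₀ ,
                                               differ γ δ _ _ (¬γδ q-prime Qq) q∤s (step₁₂ b s) c₁
      select (no _) (yes c₀) (no a₁) _ = 1 , λ _ → a₁ , differ γ δ _ _ (¬γδ q-prime Qq) q∤s (step₀₁ b s) c₀
      select (no _) (yes c₀) (yes a₁) _ = 2 , λ _ → differ α β _ _ (¬αβ q-prime Qq) q∤s (step₁₂ b s) a₁ ,
                                                    differ γ δ _ _ (¬γδ q-prime Qq) q∤2s (step₀₂ b s) c₀

  -- Takes the place of Dirichlet's theorem. The elements k + n b of the residue class are the
  -- values of a linear form with coprime coefficients, so some b avoids all primes up to B.
  coprime-lift-rough : ∀ {k n} → Coprime k n → ∀ B →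
                       ∃[ k′ ] (k′ ∼ k [ n ] × (∀ q → Prime q → q ≤ B → ¬ q ∣ k′))
  coprime-lift-rough {k} {n} co B with sieve-linear k n co B
  ... | b , rough = k + n * b , subst (_∼ k [ n ]) (cong (k +_) (*-comm b n)) (∼+d b) , rough

  coprime-lift : ∀ {k d} n .{{_ : NonZero n}} → Coprime k d → ∃[ u ] (u ∼ k [ d ] × Coprime u n)
  coprime-lift n co with coprime-lift-rough co n
  ... | u , u∼k , rough = u , u∼k , coprime-by-primes (λ p p-prime p≤n (p∣u , _) → rough p p-prime p≤n p∣u)

  -- The quotient k / gcd k n is prime only to n / gcd k n. Replacing it by a unit modulo n in the
  -- same class modulo n / gcd k n leaves the product with the gcd unchanged modulo n.
  gcd-unit-multiple : ∀ k n .{{_ : NonZero n}} → ∃[ u ] (Coprime u n × k ∼ gcd k n * u [ n ])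
  gcd-unit-multiple k n
    with gcd[m,n]∣m k n | gcd[m,n]∣n k n
  ... | divides k′ k≡ | divides d n≡ =
    let instance
          g≢0 : NonZero (gcd k n)
          g≢0 = ≢-nonZero (gcd[m,n]≢0 k n (inj₂ (≢-nonZero⁻¹ n)))
        gk′≡k = trans (*-comm (gcd k n) k′) (sym k≡)
        gd≡n = trans (*-comm (gcd k n) d) (sym n≡)
        co : Coprime k′ d
        co = gcd≡1⇒coprime (*-cancelˡ-≡ _ _ (gcd k n)
          (trans (c*gcd[m,n]≡gcd[cm,cn] (gcd k n) k′ d) (trans (cong₂ gcd gk′≡k gd≡n) (sym (*-identityʳ _)))))
        u , u∼k′ , co-u = coprime-lift n co
    in u , co-u , ∼-sym (subst₂ (λ x y → gcd k n * u ∼ x [ y ]) gk′≡k gd≡n (∼-scale (gcd k n) u∼k′))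

  sum-of-units : ∀ n .{{_ : NonZero n}} → ¬ 2 ∣ n → ∀ m → ∃[ b ] ∃[ c ] (Coprime b n × Coprime c n × b + c ∼ m [ n ])
  sum-of-units n@(suc n-1) odd m
    -- The two forms are b and m + (n - 1) b, the latter being m - b modulo n. Only prime divisors
    -- of n have to be avoided, and these are odd.
    with sieve-linear₂ (_∣ n) (_∣? n) odd′ 0 1 m n-1
           (λ q-prime _ (_ , q∣1) → prime∤1 q-prime q∣1)
           (λ {q} q-prime q∣n (_ , q∣n-1) → prime∤1 q-prime (∣m+n∣m⇒∣n (subst (q ∣_) (+-comm 1 n-1) q∣n) q∣n-1)) n
    where
    prime∤1 : ∀ {q} → Prime q → ¬ q ∣ 1
    prime∤1 q-prime q∣1 = ¬prime[1] (subst Prime (∣1⇒≡1 q∣1) q-prime)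
    odd′ : ∀ {q} → Prime q → q ∣ n → ¬ q ∣ 2
    odd′ q-prime q∣n q∣2 with prime⇒irreducible prime[2] q∣2
    ... | inj₁ refl = ¬prime[1] q-prime
    ... | inj₂ refl = odd q∣n
  ... | b , good = b , m + n-1 * b
    , coprime-by-primes (λ p p-prime p≤n (p∣b , p∣n) →
        proj₁ (good p p-prime p≤n p∣n) (subst (p ∣_) (sym (*-identityˡ b)) p∣b))
    , coprime-by-primes (λ p p-prime p≤n (p∣c , p∣n) → proj₂ (good p p-prime p≤n p∣n) p∣c)
    , subst (_∼ m [ n ]) (lemma m b n-1) (∼+d b)
    where
    lemma : ∀ m b n-1 → m + b * suc n-1 ≡ b + (m + n-1 * b)
    lemma = solve-∀

  residue-∼ : ∀ a n .{{_ : NonZero n}} → a ∼ a % n [ n ]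
  residue-∼ a n = cong-by 0 (a / n) (trans (+-identityʳ a) (m≡m%n+[m/n]*n a n))

  unit-power-one : ∀ k n .{{_ : NonZero n}} → Coprime k n → ∃[ s ] k ^ suc s ∼ 1 [ n ]
  unit-power-one k n co
    with pigeonhole (n<1+n n) (λ i → fromℕ< (m%n<n (k ^ toℕ i) n))
  ... | i , j , i<j , eq = s , ∼-trans (∼-reflexive (sym (*-identityˡ _))) (∼-trans (∼-*ʳ _ (∼-sym yx∼1)) (∼-trans last yx∼1))
    where
    s = pred (toℕ j ∸ toℕ i)
    x = k ^ toℕ i
    eq′ : k ^ toℕ i % n ≡ k ^ toℕ j % n
    eq′ = trans (sym (toℕ-fromℕ< _)) (trans (cong toℕ eq) (toℕ-fromℕ< _))
    xi∼xj : x ∼ k ^ toℕ j [ n ]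
    xi∼xj = ∼-trans (residue-∼ _ n) (subst (_∼ k ^ toℕ j [ n ]) (sym eq′) (∼-sym (residue-∼ _ n)))
    co-pow : ∀ e → Coprime (k ^ e) n
    co-pow zero    (d∣1 , _) = ∣1⇒≡1 d∣1
    co-pow (suc e) = coprime-* co (co-pow e)
    inv = coprime-inverse x n (co-pow (toℕ i))
    y = proj₁ inv
    yx∼1 : x * y ∼ 1 [ n ]
    yx∼1 = proj₂ inv
    j≡ : suc s + toℕ i ≡ toℕ j
    j≡ = trans (cong (_+ toℕ i) (suc-pred (toℕ j ∸ toℕ i) {{≢-nonZero (m>n⇒m∸n≢0 i<j)}})) (m∸n+n≡m (<⇒≤ i<j))
    rearrange : ∀ x y z → x * y * z ≡ z * x * y
    rearrange = solve-∀
    last : x * y * k ^ suc s ∼ x * y [ n ]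
    last = subst (_∼ x * y [ n ]) (sym (trans (rearrange x y (k ^ suc s))
      (cong (_* y) (trans (sym (^-distribˡ-+-* k (suc s) (toℕ i))) (cong (k ^_) j≡)))))
      (∼-*ʳ y (∼-sym xi∼xj))

  -- The choice m = 2 b settles the prime 2: 1 + d m is odd, and M is odd by hypothesis. Each odd
  -- prime excludes at most one residue of b for the form 2 b and one for 1 + 2 d b. Sieving up to B
  -- + M covers the prime divisors of M as well.
  sieve-exponent : ∀ d M .{{_ : NonZero M}} → ¬ 2 ∣ M → ∀ B →
    ∃[ m ] (Coprime M m × (∀ q → Prime q → q ≤ B → ¬ q ∣ 1 + d * m))
  sieve-exponent d M odd B
    with sieve-linear₂ (λ q → ¬ q ∣ 2) (λ q → Dec.¬? (q ∣? 2)) (λ _ h → h) 0 2 1 (d * 2)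
           (λ _ q∤2 (_ , q∣2) → q∤2 q∣2)
           (λ q-prime _ (q∣1 , _) → ¬prime[1] (subst Prime (∣1⇒≡1 q∣1) q-prime)) (B + M)
  ... | b , good = 2 * b , (λ {x} → co {x}) , rough
    where
    co : Coprime M (2 * b)
    co {x} (x∣M , x∣2b) with x ≟ 1
    ... | yes x≡1 = x≡1
    ... | no x≢1 with ∃-prime-divisor x x≢1
    ...   | p , p-prime , p∣x = ⊥-elim (proj₁ (good p p-prime
              (≤-trans (∣⇒≤ (∣-trans p∣x x∣M)) (m≤n+m M B)) p∤2) (∣-trans p∣x x∣2b))
      where
      p∤2 : ¬ p ∣ 2
      p∤2 p∣2 with prime⇒irreducible prime[2] p∣2
      ... | inj₁ refl = ¬prime[1] p-prime
      ... | inj₂ refl = odd (∣-trans p∣x x∣M)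
    rough : ∀ q → Prime q → q ≤ B → ¬ q ∣ 1 + d * (2 * b)
    rough q q-prime q≤B h with q ∣? 2
    ... | no q∤2 = proj₂ (good q q-prime (≤-trans q≤B (m≤m+n B M)) q∤2)
          (subst (λ x → q ∣ 1 + x) (sym (*-assoc d 2 b)) h)
    ... | yes q∣2 = ¬prime[1] (subst Prime (∣1⇒≡1 (∣m+n∣m⇒∣n (subst (q ∣_) (+-comm 1 _) h)
          (∣n⇒∣m*n d (∣m⇒∣m*n b q∣2)))) q-prime)

  prime-if-one-factor : ∀ {x} (f : PrimeFactorisation x) → length (factors f) ≡ 1 → Prime x
  prime-if-one-factor record { factors = p ∷ [] ; isFactorisation = e ; factorsPrime = p-prime ∷ [] } _ =
    subst Prime (sym (trans e (*-identityʳ p))) p-prime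

  one-if-no-factor : ∀ {x} (f : PrimeFactorisation x) → length (factors f) ≡ 0 → x ≡ 1
  one-if-no-factor record { factors = [] ; isFactorisation = e } _ = e

  factor-count : ∀ {x} (f : PrimeFactorisation x) → x ≢ 1 → 1 ≤ length (factors f)
  factor-count f x≢1 = n≢0⇒n>0 (λ e → x≢1 (one-if-no-factor f e))

  factorisation-* : ∀ {x y} → PrimeFactorisation x → PrimeFactorisation y → PrimeFactorisation (x * y)
  factorisation-* f g = record
    { factors = factors f ++ factors g
    ; isFactorisation = trans (cong₂ _*_ (isFactorisation f) (isFactorisation g)) (sym (product-++ (factors f) (factors g)))
    ; factorsPrime = ++⁺ (factorsPrime f) (factorsPrime g)
    }
    where open PrimeFactorisation

  -- Prime factors are counted with multiplicity: c, q and r contribute at least one each, and by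
  -- unique factorisation there are at most three altogether.
  three-prime-factors : ∀ {ps} → All Prime ps → length ps ≤ 3 → ∀ c q r m →
    c * q * r * m ≡ product ps → c ≢ 1 → q ≢ 1 → r ≢ 1 → Prime c × Prime q × Prime r × m ≡ 1
  three-prime-factors {ps} ps-prime len c q r m eq c≢1 q≢1 r≢1 =
    count (factorise c) (factorise q) (factorise r) (factorise m)
    where
    ≢0 : NonZero (c * q * r * m)
    ≢0 = subst NonZero (sym eq) (productOfPrimes≢0 ps-prime)
    instance
      m≢0 : NonZero m
      m≢0 = m*n≢0⇒n≢0 (c * q * r) {{≢0}}
      cqr≢0 : NonZero (c * q * r)
      cqr≢0 = m*n≢0⇒m≢0 (c * q * r) {{≢0}}
      r≢0 : NonZero r
      r≢0 = m*n≢0⇒n≢0 (c * q) {{cqr≢0}}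
      cq≢0 : NonZero (c * q)
      cq≢0 = m*n≢0⇒m≢0 (c * q) {{cqr≢0}}
      q≢0 : NonZero q
      q≢0 = m*n≢0⇒n≢0 c {{cq≢0}}
      c≢0 : NonZero c
      c≢0 = m*n≢0⇒m≢0 c {{cq≢0}}
    total : ∀ (fc : PrimeFactorisation c) (fq : PrimeFactorisation q) (fr : PrimeFactorisation r) (fm : PrimeFactorisation m) →
            length (factors fc) + length (factors fq) + length (factors fr) + length (factors fm) ≤ 3
    total fc fq fr fm = subst (_≤ 3)
      (trans (↭-length (factorisationUnique given (factorisation-* (factorisation-* (factorisation-* fc fq) fr) fm))) lengths) len
      where
      given : PrimeFactorisation (c * q * r * m)
      given = record { factors = ps ; isFactorisation = eq ; factorsPrime = ps-prime }
      lengths : length (((factors fc ++ factors fq) ++ factors fr) ++ factors fm) ≡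
                length (factors fc) + length (factors fq) + length (factors fr) + length (factors fm)
      lengths = trans (length-++ ((factors fc ++ factors fq) ++ factors fr)) (cong (_+ length (factors fm))
        (trans (length-++ (factors fc ++ factors fq)) (cong (_+ length (factors fr)) (length-++ (factors fc)))))
    tight : ∀ {a b c d} → 1 ≤ a → 1 ≤ b → 1 ≤ c → a + b + c + d ≤ 3 → a ≡ 1 × b ≡ 1 × c ≡ 1 × d ≡ 0
    tight {suc a} {suc b} {suc c} {d} _ _ _ h
      with m+n≡0⇒m≡0 (a + b + c) (n≤0⇒n≡0 abcd≤0) | m+n≡0⇒n≡0 (a + b + c) (n≤0⇒n≡0 abcd≤0)
      where
      lemma : ∀ a b c d → suc a + suc b + suc c + d ≡ 3 + (a + b + c + d)
      lemma = solve-∀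
      abcd≤0 : a + b + c + d ≤ 0
      abcd≤0 = +-cancelˡ-≤ 3 _ _ (subst (_≤ 3) (lemma a b c d) h)
    ... | abc≡0 | refl with m+n≡0⇒m≡0 (a + b) abc≡0 | m+n≡0⇒n≡0 (a + b) abc≡0
    ...   | ab≡0 | refl with m+n≡0⇒m≡0 a ab≡0 | m+n≡0⇒n≡0 a ab≡0
    ...     | refl | refl = refl , refl , refl , refl
    count : PrimeFactorisation c → PrimeFactorisation q → PrimeFactorisation r → PrimeFactorisation m →
            Prime c × Prime q × Prime r × m ≡ 1
    count fc fq fr fm with tight (factor-count fc c≢1) (factor-count fq q≢1) (factor-count fr r≢1) (total fc fq fr fm)
    ... | e₁ , e₂ , e₃ , e₄ =
      prime-if-one-factor fc e₁ , prime-if-one-factor fq e₂ , prime-if-one-factor fr e₃ , one-if-no-factor fm e₄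

  -- All prime factors of a rough number are large, so a property known for the passage from k to q
  -- k with q a large prime reaches every rough number. This is how Frobenius statements pass from
  -- primes to composite multipliers.
  rough-induction : ∀ {ℓ} (P : ℕ → Set ℓ) B → 2 ≤ B → P 1 → (∀ {q k} → Prime q → B < q → P k → P (q * k)) →
                    ∀ k → (∀ q → Prime q → q ≤ B → ¬ q ∣ k) → P k
  rough-induction P B 2≤B base step zero rough = ⊥-elim (rough 2 prime[2] 2≤B (2 ∣0))
  rough-induction P B 2≤B base step k@(suc _) rough with factorise k
  ... | record { factors = ps ; isFactorisation = eq ; factorsPrime = ps-prime } =
    subst P (sym eq) (go ps ps-prime (λ p∈ps → subst (λ x → _ ∣ x) (sym eq) (∈⇒∣product p∈ps)))
    where
    go : ∀ ps → All Prime ps → (∀ {p} → p ∈ ps → p ∣ k) → P (product ps)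
    go [] [] _ = base
    go (p ∷ ps) (p-prime ∷ ps-prime) divide = step p-prime
      (≰⇒> λ p≤B → rough p p-prime p≤B (divide (here refl))) (go ps ps-prime (λ p∈ps → divide (there p∈ps)))

  ∼⇒%≡ : ∀ {a b} n .{{_ : NonZero n}} → a ∼ b [ n ] → a % n ≡ b % n
  ∼⇒%≡ {a} {b} n (cong-by x y eq) = trans (sym ([m+kn]%n≡m%n a x n)) (trans (cong (_% n) eq) ([m+kn]%n≡m%n b y n))

  ∼⇒≡ : ∀ {a b n} → a < n → b < n → a ∼ b [ n ] → a ≡ b
  ∼⇒≡ {n = n@(suc _)} a<n b<n a∼b = trans (sym (m<n⇒m%n≡m a<n)) (trans (∼⇒%≡ n a∼b) (m<n⇒m%n≡m b<n))

-- Commutative rings: quotients, geometric sums, and powers in prime characteristic.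

module RingTheory where

  open import Algebra.Bundles using (CommutativeRing)
  open import Data.Nat as ℕ using (ℕ; zero; suc; _∸_; _<_; s≤s; z≤n; _!)
  import Data.Nat.Properties as ℕ
  open import Data.Nat.Divisibility as ℕ using (_∣_; divides; m∣m*n)
  open import Data.Nat.DivMod using (m/n*n≡m)
  open import Data.Nat.Primality
  open import Data.Nat.Combinatorics using (_C_; nCn≡1; nCk≡n!/k![n-k]!; k![n∸k]!∣n!)
  open import Data.Fin.Base as Fin using (Fin; inject₁; fromℕ)
  open import Data.Fin.Properties using (toℕ-inject₁; toℕ<n; toℕ-fromℕ)
  import Algebra.Properties.Semiring.Exp as Exp
  import Algebra.Properties.Semiring.Mult as Mult
  open import Level using (Level; _⊔_)
  open import Relation.Binary.Structures using (IsEquivalence)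
  import Relation.Binary.PropositionalEquality as ≡
  open ≡ using (_≡_)
  open Arith using (prime∣!⇒≤)

  prime∣choose : ∀ {q k} → Prime q → 0 < k → k < q → q ∣ (q C k)
  prime∣choose {q} {k} q-prime 0<k k<q = case (euclidsLemma (q C k) (k ! ℕ.* (q ∸ k) !) q-prime q∣product)
    where
    instance
      k!≢0 = k ℕ.!≢0
      both≢0 = k ℕ.!* (q ∸ k) !≢0
    expand : (q C k) ℕ.* (k ! ℕ.* (q ∸ k) !) ≡ q !
    expand = ≡.trans (≡.cong (ℕ._* (k ! ℕ.* (q ∸ k) !)) (nCk≡n!/k![n-k]! (ℕ.<⇒≤ k<q)))
                     (m/n*n≡m (k![n∸k]!∣n! (ℕ.<⇒≤ k<q)))
    q∣q! : ∀ {q} → 0 < q → q ∣ q !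
    q∣q! {suc q} _ = m∣m*n (q !)
    q∣product : q ∣ (q C k) ℕ.* (k ! ℕ.* (q ∸ k) !)
    q∣product = ≡.subst (q ∣_) (≡.sym expand) (q∣q! (ℕ.<-trans 0<k k<q))
    case : q ∣ (q C k) ⊎ q ∣ k ! ℕ.* (q ∸ k) ! → q ∣ (q C k)
    case (inj₁ h) = h
    case (inj₂ h) with euclidsLemma (k !) ((q ∸ k) !) q-prime h
    ... | inj₁ h₁ = ⊥-elim (ℕ.<⇒≱ k<q (prime∣!⇒≤ q-prime k h₁))
    ... | inj₂ h₂ = ⊥-elim (ℕ.<⇒≱ (ℕ.∸-monoʳ-< 0<k (ℕ.<⇒≤ k<q)) (prime∣!⇒≤ q-prime (q ∸ k) h₂))

  module _ {c ℓ ℓ′ : Level} (R : CommutativeRing c ℓ) where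
    open CommutativeRing R

    -- A quotient keeps the carrier and the operations and only enlarges the equality. One and the
    -- same element can thus be viewed in the group ring, in ℤ[ζ] and modulo q without any map
    -- between them.
    coarsen : (_≈′_ : Carrier → Carrier → Set ℓ′) →
              (∀ {x y} → x ≈ y → x ≈′ y) → IsEquivalence _≈′_ →
              (∀ {x y u v} → x ≈′ y → u ≈′ v → (x + u) ≈′ (y + v)) →
              (∀ {x y u v} → x ≈′ y → u ≈′ v → (x * u) ≈′ (y * v)) →
              (∀ {x y} → x ≈′ y → (- x) ≈′ (- y)) → CommutativeRing c ℓ′
    coarsen _≈′_ ι equivalence +-cong′ *-cong′ -‿cong′ = record
      { Carrier = Carrier ; _≈_ = _≈′_ ; _+_ = _+_ ; _*_ = _*_ ; -_ = -_ ; 0# = 0# ; 1# = 1#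
      ; isCommutativeRing = record
        { isRing = record
          { +-isAbelianGroup = record
            { isGroup = record
              { isMonoid = record
                { isSemigroup = record
                  { isMagma = record { isEquivalence = equivalence ; ∙-cong = +-cong′ }
                  ; assoc = λ x y z → ι (+-assoc x y z)
                  }
                ; identity = (λ x → ι (+-identityˡ x)) , (λ x → ι (+-identityʳ x))
                }
              ; inverse = (λ x → ι (-‿inverseˡ x)) , (λ x → ι (-‿inverseʳ x))
              ; ⁻¹-cong = -‿cong′
              }
            ; comm = λ x y → ι (+-comm x y)
            }
          ; *-cong = *-cong′
          ; *-assoc = λ x y z → ι (*-assoc x y z)
          ; *-identity = (λ x → ι (*-identityˡ x)) , (λ x → ι (*-identityʳ x))
          ; distrib = (λ x y z → ι (distribˡ x y z)) , (λ x y z → ι (distribʳ x y z))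
          }
        ; *-comm = λ x y → ι (*-comm x y)
        }
      }

  module CommutativeRingLemmas {c ℓ : Level} (R : CommutativeRing c ℓ) where
    open CommutativeRing R
    open import Relation.Binary.Reasoning.Setoid setoid
    open import Algebra.Properties.Ring ring public
      using (-‿distribˡ-*; -‿distribʳ-*; x[y-z]≈xy-xz; -0#≈0#; -‿involutive; -‿+-comm; +-cancelˡ; +-cancelʳ; +-inverseʳ-unique)
    open import Algebra.Properties.Group +-group public
      using (x∙y⁻¹≈ε⇒x≈y; x≈y⇒x∙y⁻¹≈ε)
    open import Algebra.Properties.Semiring.Exp semiring public using (_^_; ^-congˡ; ^-congʳ; ^-homo-*; ^-assocʳ)
    open import Algebra.Properties.CommutativeSemiring.Exp commutativeSemiring public using (^-distrib-*)
    open import Algebra.Properties.Semiring.Mult semiring public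
      using (×-assoc-*; ×-comm-*; ×-congʳ; ×-homo-+; ×-assocˡ) renaming (_×_ to _·_)
    open import Algebra.Properties.Semiring.Sum semiring using (sum; sum-init-last; sum-cong-≋)
    open import Algebra.Properties.CommutativeSemiring.Binomial commutativeSemiring using (binomialTerm; theorem)
    open import Algebra.Solver.Ring.NaturalCoefficients.Default commutativeSemiring public
      using (solve; _:=_; _:+_; _:*_; con)

    1^ : ∀ n → 1# ^ n ≈ 1#
    1^ zero    = refl
    1^ (suc n) = trans (*-identityˡ _) (1^ n)

    Σ< : ℕ → (ℕ → Carrier) → Carrier
    Σ< zero    f = 0#
    Σ< (suc n) f = Σ< n f + f n

    Σ-cong : ∀ n {f g} → (∀ {i} → i < n → f i ≈ g i) → Σ< n f ≈ Σ< n g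
    Σ-cong zero    h = refl
    Σ-cong (suc n) h = +-cong (Σ-cong n (λ i<n → h (ℕ.m<n⇒m<1+n i<n))) (h (ℕ.n<1+n n))

    Σ-zero : ∀ n {f} → (∀ {i} → i < n → f i ≈ 0#) → Σ< n f ≈ 0#
    Σ-zero zero    h = refl
    Σ-zero (suc n) h = trans (+-cong (Σ-zero n (λ i<n → h (ℕ.m<n⇒m<1+n i<n))) (h (ℕ.n<1+n n))) (+-identityˡ 0#)

    Σ-*ˡ : ∀ n x f → x * Σ< n f ≈ Σ< n (λ i → x * f i)
    Σ-*ˡ zero    x f = zeroʳ x
    Σ-*ˡ (suc n) x f = trans (distribˡ x _ _) (+-congʳ (Σ-*ˡ n x f))

    Σ-*ʳ : ∀ n x f → Σ< n f * x ≈ Σ< n (λ i → f i * x)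
    Σ-*ʳ zero    x f = zeroˡ x
    Σ-*ʳ (suc n) x f = trans (distribʳ x _ _) (+-congʳ (Σ-*ʳ n x f))

    +-interchange : ∀ a b c d → (a + b) + (c + d) ≈ (a + c) + (b + d)
    +-interchange = solve 4 (λ a b c d → (a :+ b) :+ (c :+ d) := (a :+ c) :+ (b :+ d)) refl

    Σ-+ : ∀ n f g → Σ< n (λ i → f i + g i) ≈ Σ< n f + Σ< n g
    Σ-+ zero    f g = sym (+-identityˡ 0#)
    Σ-+ (suc n) f g = trans (+-congʳ (Σ-+ n f g)) (+-interchange _ _ _ _)

    Σ-swap : ∀ m n (f : ℕ → ℕ → Carrier) → Σ< m (λ i → Σ< n (f i)) ≈ Σ< n (λ j → Σ< m (λ i → f i j))
    Σ-swap zero    n f = sym (Σ-zero n (λ _ → refl))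
    Σ-swap (suc m) n f = trans (+-congʳ (Σ-swap m n f)) (sym (Σ-+ n _ _))

    Σ-suc : ∀ n f → f 0 + Σ< n (λ i → f (suc i)) ≈ Σ< (suc n) f
    Σ-suc zero    f = +-comm _ _
    Σ-suc (suc n) f = trans (sym (+-assoc _ _ _)) (+-congʳ (Σ-suc n f))

    Σ-const : ∀ n x → Σ< n (λ _ → x) ≈ n · x
    Σ-const zero    x = refl
    Σ-const (suc n) x = trans (+-comm _ _) (+-congˡ (Σ-const n x))

    Σ-single : ∀ n {m} f → m < n → (∀ {i} → i < n → ¬ i ≡ m → f i ≈ 0#) → Σ< n f ≈ f m
    Σ-single (suc n) {m} f m<sn h with n ℕ.≟ m
    ... | yes ≡.refl = trans (+-congʳ (Σ-zero n (λ i<n → h (ℕ.m<n⇒m<1+n i<n) (ℕ.<⇒≢ i<n)))) (+-identityˡ _)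
    ... | no n≢m = trans (+-cong
      (Σ-single n f (ℕ.≤∧≢⇒< (ℕ.≤-pred m<sn) (λ e → n≢m (≡.sym e))) (λ i<n → h (ℕ.m<n⇒m<1+n i<n)))
      (h (ℕ.n<1+n n) n≢m)) (+-identityʳ _)

    -- geo x y n = Σ_{j<n} x^(n-1-j) y^j
    geo : Carrier → Carrier → ℕ → Carrier
    geo x y zero    = 0#
    geo x y (suc n) = x * geo x y n + y ^ n

    -- (x - y) geo = x^n - y^n, free of subtraction
    geo-telescopes : ∀ x y n → x * geo x y n + y ^ n ≈ x ^ n + y * geo x y n
    geo-telescopes x y zero = begin
      x * 0# + 1#  ≈⟨ +-congʳ (zeroʳ x) ⟩
      0# + 1#      ≈⟨ +-comm 0# 1# ⟩
      1# + 0#      ≈⟨ +-congˡ (zeroʳ y) ⟨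
      1# + y * 0#  ∎
    geo-telescopes x y (suc n) = begin
      x * (x * geo x y n + y ^ n) + y * y ^ n          ≈⟨ +-congʳ (*-congˡ (geo-telescopes x y n)) ⟩
      x * (x ^ n + y * geo x y n) + y * y ^ n          ≈⟨ lemma x y (x ^ n) (geo x y n) (y ^ n) ⟩
      x * x ^ n + y * (x * geo x y n + y ^ n)          ∎
      where
      lemma : ∀ x y a g b → x * (a + y * g) + y * b ≈ x * a + y * (x * g + b)
      lemma = solve 5 (λ x y a g b → x :* (a :+ y :* g) :+ y :* b := x :* a :+ y :* (x :* g :+ b)) refl

    geo-diagonal : ∀ z n → geo z z (suc n) ≈ suc n · z ^ n
    geo-diagonal z zero    = trans (+-congʳ (zeroʳ z)) (+-comm 0# 1#)
    geo-diagonal z (suc n) = begin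
      z * geo z z (suc n) + z ^ suc n     ≈⟨ +-congʳ (*-congˡ (geo-diagonal z n)) ⟩
      z * (suc n · z ^ n) + z ^ suc n     ≈⟨ +-congʳ (×-comm-* (suc n) z (z ^ n)) ⟩
      suc n · z ^ suc n + z ^ suc n       ≈⟨ +-comm _ _ ⟩
      suc (suc n) · z ^ suc n             ∎

    geo-1 : ∀ y n → (1# - y) * geo 1# y n ≈ 1# - y ^ n
    geo-1 y n = +-cancelʳ (y * geo 1# y n + y ^ n) _ _ (begin
      (1# - y) * geo 1# y n + (y * geo 1# y n + y ^ n)    ≈⟨ lemma₁ y (- y) (geo 1# y n) (y ^ n) ⟩
      ((- y + y) * geo 1# y n) + (1# * geo 1# y n + y ^ n) ≈⟨ +-cong (trans (*-congʳ (-‿inverseˡ y)) (zeroˡ _)) (geo-telescopes 1# y n) ⟩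
      0# + (1# ^ n + y * geo 1# y n)                      ≈⟨ +-cong (sym (-‿inverseˡ (y ^ n))) (+-congʳ (1^ n)) ⟩
      (- y ^ n + y ^ n) + (1# + y * geo 1# y n)           ≈⟨ lemma₂ (- (y ^ n)) (y ^ n) (y * geo 1# y n) ⟩
      (1# - y ^ n) + (y * geo 1# y n + y ^ n)             ∎)
      where
      lemma₁ : ∀ y -y g b → (1# + -y) * g + (y * g + b) ≈ (-y + y) * g + (1# * g + b)
      lemma₁ = solve 4 (λ y -y g b → (con 1 :+ -y) :* g :+ (y :* g :+ b) := (-y :+ y) :* g :+ (con 1 :* g :+ b)) refl
      lemma₂ : ∀ a b g → (a + b) + (1# + g) ≈ (1# + a) + (g + b)
      lemma₂ = solve 3 (λ a b g → (a :+ b) :+ (con 1 :+ g) := (con 1 :+ a) :+ (g :+ b)) refl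

    geo-as-Σ : ∀ y n → geo 1# y n ≈ Σ< n (y ^_)
    geo-as-Σ y zero    = refl
    geo-as-Σ y (suc n) = +-congʳ (trans (*-identityˡ _) (geo-as-Σ y n))

    module Characteristic {q} (q-prime : Prime q) (q·1≈0 : q · 1# ≈ 0#) where

      q·x≈0 : ∀ x → q · x ≈ 0#
      q·x≈0 x = begin
        q · x         ≈⟨ ×-congʳ q (*-identityˡ x) ⟨
        q · (1# * x)  ≈⟨ ×-assoc-* q 1# x ⟨
        (q · 1#) * x  ≈⟨ *-congʳ q·1≈0 ⟩
        0# * x        ≈⟨ zeroˡ x ⟩
        0#            ∎

      multiple·x≈0 : ∀ {m} x → q ∣ m → m · x ≈ 0#
      multiple·x≈0 x (divides r ≡.refl) =
        trans (reflexive (≡.cong (_· x) (ℕ.*-comm r q))) (trans (sym (×-assocˡ x q r)) (q·x≈0 (r · x)))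

      freshman : ∀ x y → (x + y) ^ q ≈ x ^ q + y ^ q
      freshman x y = by-suc q ≡.refl
        where
        by-suc : ∀ q′ → q′ ≡ q → (x + y) ^ q′ ≈ x ^ q′ + y ^ q′
        by-suc zero e = ⊥-elim (¬prime[0] (≡.subst Prime (≡.sym e) q-prime))
        by-suc (suc r) ≡.refl = begin
          (x + y) ^ suc r                                    ≈⟨ theorem (suc r) x y ⟩
          t Fin.zero + sum (λ i → t (Fin.suc i))             ≈⟨ +-congˡ (sum-init-last (λ i → t (Fin.suc i))) ⟩
          t Fin.zero + (sum (λ i → t (Fin.suc (inject₁ i))) + t (Fin.suc (fromℕ r)))
                                                             ≈⟨ +-cong first (+-cong (vanish r _ middle) last) ⟩
          y ^ suc r + (0# + x ^ suc r)                       ≈⟨ +-congˡ (+-identityˡ _) ⟩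
          y ^ suc r + x ^ suc r                              ≈⟨ +-comm _ _ ⟩
          x ^ suc r + y ^ suc r                              ∎
          where
          t = binomialTerm x y (suc r)
          vanish : ∀ m (f : Fin m → Carrier) → (∀ i → f i ≈ 0#) → sum f ≈ 0#
          vanish zero    f h = refl
          vanish (suc m) f h = trans (+-cong (h Fin.zero) (vanish m _ (λ i → h (Fin.suc i)))) (+-identityˡ 0#)
          first : t Fin.zero ≈ y ^ suc r
          first = trans (+-identityʳ _) (*-identityˡ _)
          last : t (Fin.suc (fromℕ r)) ≈ x ^ suc r
          last rewrite toℕ-fromℕ r | nCn≡1 (suc r) | ℕ.n∸n≡0 r = trans (+-identityʳ _) (*-identityʳ _)
          middle : ∀ i → t (Fin.suc (inject₁ i)) ≈ 0#
          middle i = multiple·x≈0 _ (prime∣choose q-prime (s≤s z≤n)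
            (s≤s (≡.subst (_< r) (≡.sym (toℕ-inject₁ i)) (toℕ<n i))))

      0^q≈0 : 0# ^ q ≈ 0#
      0^q≈0 = by-suc q ≡.refl
        where
        by-suc : ∀ q′ → q′ ≡ q → 0# ^ q′ ≈ 0#
        by-suc zero e = ⊥-elim (¬prime[0] (≡.subst Prime (≡.sym e) q-prime))
        by-suc (suc r) e = zeroˡ _

      frobenius-neg : ∀ x → (- x) ^ q ≈ - (x ^ q)
      frobenius-neg x = +-inverseʳ-unique _ _ (begin
        x ^ q + (- x) ^ q  ≈⟨ freshman x (- x) ⟨
        (x + - x) ^ q      ≈⟨ ^-congˡ q (-‿inverseʳ x) ⟩
        0# ^ q             ≈⟨ 0^q≈0 ⟩
        0#                 ∎)

    module AnnihilatorQuotient (e : Carrier) where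

      infix 4 _≈ₑ_
      record _≈ₑ_ (x y : Carrier) : Set ℓ where
        constructor mk
        field
          scaled : e * x ≈ e * y
      open _≈ₑ_ public

      ≈⇒≈ₑ : ∀ {x y} → x ≈ y → x ≈ₑ y
      ≈⇒≈ₑ h = mk (*-congˡ h)

      quotientₑ : CommutativeRing c ℓ
      quotientₑ = coarsen R _≈ₑ_ ≈⇒≈ₑ
        (record { refl = mk refl ; sym = λ h → mk (sym (scaled h)) ; trans = λ h h′ → mk (trans (scaled h) (scaled h′)) })
        (λ h h′ → mk (trans (distribˡ e _ _) (trans (+-cong (scaled h) (scaled h′)) (sym (distribˡ e _ _)))))
        (λ {x} {y} {u} {v} h h′ → mk (begin
          e * (x * u)  ≈⟨ *-assoc e x u ⟨
          e * x * u    ≈⟨ *-congʳ (scaled h) ⟩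
          e * y * u    ≈⟨ xyz≈y*xz e y u ⟩
          y * (e * u)  ≈⟨ *-congˡ (scaled h′) ⟩
          y * (e * v)  ≈⟨ xyz≈y*xz e y v ⟨
          e * y * v    ≈⟨ *-assoc e y v ⟩
          e * (y * v)  ∎))
        (λ h → mk (trans (sym (-‿distribʳ-* e _)) (trans (-‿cong (scaled h)) (-‿distribʳ-* e _))))
        where
        xyz≈y*xz : ∀ x y z → x * y * z ≈ y * (x * z)
        xyz≈y*xz = solve 3 (λ x y z → x :* y :* z := y :* (x :* z)) refl

      private
        module Eₑ = Exp (CommutativeRing.semiring quotientₑ)

      -- Powers are defined by recursion over the bundle of their own ring, so for a variable
      -- exponent those of the quotient agree with those of R only by induction.
      ^ₑ≡^ : ∀ x n → x Eₑ.^ n ≡ x ^ n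
      ^ₑ≡^ x zero    = ≡.refl
      ^ₑ≡^ x (suc n) = ≡.cong (x *_) (^ₑ≡^ x n)

    module PrincipalQuotient (m : Carrier) where

      infix 4 _≈ₘ_
      -- The cofactor is kept as data: size estimates need the congruence in the form of an explicit
      -- multiple of m.
      record _≈ₘ_ (x y : Carrier) : Set (c ⊔ ℓ) where
        constructor mk
        field
          multiplier : Carrier
          differ : x ≈ y + m * multiplier
      open _≈ₘ_ public

      ≈⇒≈ₘ : ∀ {x y} → x ≈ y → x ≈ₘ y
      ≈⇒≈ₘ {x} {y} h = mk 0# (trans h (trans (sym (+-identityʳ y)) (+-congˡ (sym (zeroʳ m)))))

      m≈ₘ0 : m ≈ₘ 0#
      m≈ₘ0 = mk 1# (trans (sym (*-identityʳ m)) (sym (+-identityˡ _)))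

      private
        negate : ∀ {x y} d → x ≈ y + m * d → - x ≈ - y + m * (- d)
        negate {x} {y} d h = trans (-‿cong h) (trans (sym (-‿+-comm y (m * d))) (+-congˡ (-‿distribʳ-* m d)))

        back : ∀ {x y} d → x ≈ y + m * d → y ≈ x + m * (- d)
        back {x} {y} d h = begin
          y                              ≈⟨ +-identityʳ y ⟨
          y + 0#                         ≈⟨ +-congˡ (-‿inverseʳ (m * d)) ⟨
          y + (m * d + - (m * d))        ≈⟨ +-congˡ (+-congˡ (-‿distribʳ-* m d)) ⟩
          y + (m * d + m * (- d))        ≈⟨ +-assoc _ _ _ ⟨
          (y + m * d) + m * (- d)        ≈⟨ +-congʳ h ⟨
          x + m * (- d)                  ∎

        lemma-trans : ∀ z m d d′ → (z + m * d′) + m * d ≈ z + m * (d + d′)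
        lemma-trans = solve 4 (λ z m d d′ → (z :+ m :* d′) :+ m :* d := z :+ m :* (d :+ d′)) refl

        lemma-+ : ∀ y v m d d′ → (y + m * d) + (v + m * d′) ≈ (y + v) + m * (d + d′)
        lemma-+ = solve 5 (λ y v m d d′ → (y :+ m :* d) :+ (v :+ m :* d′) := (y :+ v) :+ m :* (d :+ d′)) refl

        lemma-* : ∀ y v m d d′ → (y + m * d) * (v + m * d′) ≈ y * v + m * (d * v + y * d′ + m * d * d′)
        lemma-* = solve 5 (λ y v m d d′ → (y :+ m :* d) :* (v :+ m :* d′) :=
                                          y :* v :+ m :* (d :* v :+ y :* d′ :+ m :* d :* d′)) refl

      quotientₘ : CommutativeRing c (c ⊔ ℓ)
      quotientₘ = coarsen R _≈ₘ_ ≈⇒≈ₘ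
        (record
          { refl  = ≈⇒≈ₘ refl
          ; sym   = λ (mk d h) → mk (- d) (back d h)
          ; trans = λ (mk d h) (mk d′ h′) → mk (d + d′) (trans h (trans (+-congʳ h′) (lemma-trans _ m d d′)))
          })
        (λ (mk d h) (mk d′ h′) → mk (d + d′) (trans (+-cong h h′) (lemma-+ _ _ m d d′)))
        (λ (mk d h) (mk d′ h′) → mk _ (trans (*-cong h h′) (lemma-* _ _ m d d′)))
        (λ (mk d h) → mk (- d) (negate d h))

      private
        module Qₘ = CommutativeRing quotientₘ

      ^-congₘ : ∀ {x y} → x ≈ₘ y → ∀ n → (x ^ n) ≈ₘ (y ^ n)
      ^-congₘ e zero    = Qₘ.refl
      ^-congₘ e (suc n) = Qₘ.*-cong e (^-congₘ e n)

      geo-congₘ : ∀ {x x′ y y′} → x ≈ₘ x′ → y ≈ₘ y′ → ∀ n → geo x y n ≈ₘ geo x′ y′ n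
      geo-congₘ e e′ zero    = Qₘ.refl
      geo-congₘ e e′ (suc n) = Qₘ.+-cong (Qₘ.*-cong e (geo-congₘ e e′ n)) (^-congₘ e′ n)

      private
        module Eₘ = Exp (CommutativeRing.semiring quotientₘ)
        module Mₘ = Mult (CommutativeRing.semiring quotientₘ)

      ^ₘ≡^ : ∀ x n → x Eₘ.^ n ≡ x ^ n
      ^ₘ≡^ x zero    = ≡.refl
      ^ₘ≡^ x (suc n) = ≡.cong (x *_) (^ₘ≡^ x n)

      ·ₘ≡· : ∀ n x → n Mₘ.× x ≡ n · x
      ·ₘ≡· zero    x = ≡.refl
      ·ₘ≡· (suc n) x = ≡.cong (x +_) (·ₘ≡· n x)

    module Domain (zero-product : ∀ {x y} → x * y ≈ 0# → x ≈ 0# ⊎ y ≈ 0#) where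

      x-y≈0⇒x≈y : ∀ {x y} → x - y ≈ 0# → x ≈ y
      x-y≈0⇒x≈y = x∙y⁻¹≈ε⇒x≈y _ _

      *-cancelˡ : ∀ {z x y} → ¬ z ≈ 0# → z * x ≈ z * y → x ≈ y
      *-cancelˡ {z} {x} {y} z≉0 h with zero-product (trans (x[y-z]≈xy-xz z x y) (x≈y⇒x∙y⁻¹≈ε h))
      ... | inj₁ z≈0 = ⊥-elim (z≉0 z≈0)
      ... | inj₂ x-y≈0 = x-y≈0⇒x≈y x-y≈0

      *-≉0 : ∀ {x y} → ¬ x ≈ 0# → ¬ y ≈ 0# → ¬ x * y ≈ 0#
      *-≉0 x≉0 y≉0 h with zero-product h
      ... | inj₁ x≈0 = x≉0 x≈0
      ... | inj₂ y≈0 = y≉0 y≈0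

      ^-≉0 : ∀ {x} → ¬ 1# ≈ 0# → ¬ x ≈ 0# → ∀ n → ¬ x ^ n ≈ 0#
      ^-≉0 1≉0 x≉0 zero    = 1≉0
      ^-≉0 1≉0 x≉0 (suc n) = *-≉0 x≉0 (^-≉0 1≉0 x≉0 n)

      -- One factor of xⁿ - yⁿ = (x - y) `geo x y n` vanishes. Excluding the second alternative is
      -- the task of Frobenius in one place and of a sum over all roots of unity in another.
      equal-powers : ∀ {x y} n → x ^ n ≈ y ^ n → x ≈ y ⊎ geo x y n ≈ 0#
      equal-powers {x} {y} n h with zero-product {x - y} {geo x y n} (begin
        (x - y) * geo x y n                  ≈⟨ distribʳ _ x (- y) ⟩
        x * geo x y n + - y * geo x y n      ≈⟨ +-congˡ (-‿distribˡ-* y _) ⟨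
        x * geo x y n - y * geo x y n        ≈⟨ x≈y⇒x∙y⁻¹≈ε (+-cancelʳ (y ^ n) _ _ (begin
          x * geo x y n + y ^ n  ≈⟨ geo-telescopes x y n ⟩
          x ^ n + y * geo x y n  ≈⟨ +-congʳ h ⟩
          y ^ n + y * geo x y n  ≈⟨ +-comm _ _ ⟩
          y * geo x y n + y ^ n  ∎)) ⟩
        0#                                   ∎)
      ... | inj₁ h′ = inj₁ (x-y≈0⇒x≈y h′)
      ... | inj₂ h′ = inj₂ h′

-- The group ring ℤ[x]/(xⁿ - 1): coefficients, Frobenius, and Galois invariance of annihilators.

module GroupRing where

  open import Algebra.Bundles using (CommutativeRing)
  open import Data.Nat as ℕ using (ℕ; zero; suc; NonZero; _≤_; _<_; _+_; _*_)
  import Data.Nat.Properties as ℕ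
  open import Data.Nat.DivMod using (_%_; m%n<n)
  open import Data.Nat.Primality using (Prime; ¬prime[0])
  open import Data.Nat.Coprimality using (Coprime)
  open import Data.Integer as ℤ using (ℤ; +_; -[1+_]; ∣_∣; 0ℤ; 1ℤ)
  import Data.Integer.Properties as ℤ
  open import Data.Integer.Tactic.RingSolver using (solve-∀)
  open import Data.List.Base using (List; []; _∷_; _++_; map)
  open import Level using (0ℓ)
  open import Relation.Binary.PropositionalEquality hiding (resp; setoid)
  open Arith
  open RingTheory

  module ℤR = CommutativeRingLemmas ℤ.+-*-commutativeRing
  open ℤR using (Σ<; Σ-cong; Σ-single)

  -- Elements of ℤ[x]/(xⁿ - 1) are formal sums of monomials c xⁱ, identified when they
  -- integrate every n-periodic function to the same value.
  Element : Set
  Element = List (ℤ × ℕ)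

  ∫ : Element → (ℕ → ℤ) → ℤ
  ∫ []            h = 0ℤ
  ∫ ((c , i) ∷ a) h = c ℤ.* h i ℤ.+ ∫ a h

  ∫-cong : ∀ a {h h′} → (∀ i → h i ≡ h′ i) → ∫ a h ≡ ∫ a h′
  ∫-cong []            e = refl
  ∫-cong ((c , i) ∷ a) e = cong₂ ℤ._+_ (cong (c ℤ.*_) (e i)) (∫-cong a e)

  ∫-++ : ∀ a b h → ∫ (a ++ b) h ≡ ∫ a h ℤ.+ ∫ b h
  ∫-++ []            b h = sym (ℤ.+-identityˡ _)
  ∫-++ ((c , i) ∷ a) b h = trans (cong (λ z → c ℤ.* h i ℤ.+ z) (∫-++ a b h)) (sym (ℤ.+-assoc (c ℤ.* h i) _ _))

  ∫-0 : ∀ a → ∫ a (λ _ → 0ℤ) ≡ 0ℤ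
  ∫-0 []            = refl
  ∫-0 ((c , i) ∷ a) = cong₂ ℤ._+_ (ℤ.*-zeroʳ c) (∫-0 a)

  ∫-+ : ∀ a h h′ → ∫ a (λ i → h i ℤ.+ h′ i) ≡ ∫ a h ℤ.+ ∫ a h′
  ∫-+ []            h h′ = refl
  ∫-+ ((c , i) ∷ a) h h′ = trans (cong (λ z → c ℤ.* (h i ℤ.+ h′ i) ℤ.+ z) (∫-+ a h h′)) (lemma c (h i) (h′ i) _ _)
    where
    lemma : ∀ c x y u v → c ℤ.* (x ℤ.+ y) ℤ.+ (u ℤ.+ v) ≡ (c ℤ.* x ℤ.+ u) ℤ.+ (c ℤ.* y ℤ.+ v)
    lemma = solve-∀

  ∫-* : ∀ a d h → ∫ a (λ i → d ℤ.* h i) ≡ d ℤ.* ∫ a h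
  ∫-* []            d h = sym (ℤ.*-zeroʳ d)
  ∫-* ((c , i) ∷ a) d h = trans (cong (λ z → c ℤ.* (d ℤ.* h i) ℤ.+ z) (∫-* a d h)) (lemma c d (h i) _)
    where
    lemma : ∀ c d x u → c ℤ.* (d ℤ.* x) ℤ.+ d ℤ.* u ≡ d ℤ.* (c ℤ.* x ℤ.+ u)
    lemma = solve-∀

  ∫-fubini : ∀ a b (H : ℕ → ℕ → ℤ) → ∫ a (λ i → ∫ b (H i)) ≡ ∫ b (λ j → ∫ a (λ i → H i j))
  ∫-fubini []            b H = sym (∫-0 b)
  ∫-fubini ((c , i) ∷ a) b H = begin
    c ℤ.* ∫ b (H i) ℤ.+ ∫ a (λ i → ∫ b (H i))                    ≡⟨ cong₂ ℤ._+_ (sym (∫-* b c (H i))) (∫-fubini a b H) ⟩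
    ∫ b (λ j → c ℤ.* H i j) ℤ.+ ∫ b (λ j → ∫ a (λ i → H i j))    ≡⟨ ∫-+ b _ _ ⟨
    ∫ b (λ j → c ℤ.* H i j ℤ.+ ∫ a (λ i → H i j))                ∎
    where open ≡-Reasoning

  ∫-Σ : ∀ a m (H : ℕ → ℕ → ℤ) → ∫ a (λ i → Σ< m (H i)) ≡ Σ< m (λ j → ∫ a (λ i → H i j))
  ∫-Σ a zero    H = ∫-0 a
  ∫-Σ a (suc m) H = trans (∫-+ a _ _) (cong₂ ℤ._+_ (∫-Σ a m H) refl)

  monomial-* : ℤ → ℕ → Element → Element
  monomial-* c i = map (λ (d , j) → c ℤ.* d , i + j)

  const : ℤ → Element
  const c = (c , 0) ∷ []

  X : ℕ → Element
  X i = (1ℤ , i) ∷ []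

  -- The ℓ¹ norm of the formal sum, not of its class. It is exactly multiplicative, unchanged by
  -- every `σ k`, and bounds every coefficient.
  norm : Element → ℕ
  norm []            = 0
  norm ((c , _) ∷ a) = ∣ c ∣ + norm a

  ∫-monomial-* : ∀ c i b h → ∫ (monomial-* c i b) h ≡ c ℤ.* ∫ b (λ j → h (i + j))
  ∫-monomial-* c i []            h = sym (ℤ.*-zeroʳ c)
  ∫-monomial-* c i ((d , j) ∷ b) h =
    trans (cong (λ z → (c ℤ.* d) ℤ.* h (i + j) ℤ.+ z) (∫-monomial-* c i b h)) (lemma c d _ _)
    where
    lemma : ∀ c d x u → (c ℤ.* d) ℤ.* x ℤ.+ c ℤ.* u ≡ c ℤ.* (d ℤ.* x ℤ.+ u)
    lemma = solve-∀

  norm-++ : ∀ a b → norm (a ++ b) ≡ norm a + norm b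
  norm-++ []            b = refl
  norm-++ ((c , _) ∷ a) b = trans (cong (λ z → ∣ c ∣ + z) (norm-++ a b)) (sym (ℕ.+-assoc ∣ c ∣ _ _))

  infixl 7 _⊛_
  infixr 6 _⊕_

  opaque
    _⊕_ : Element → Element → Element
    _⊕_ = _++_

    negate : Element → Element
    negate = map (λ (c , i) → ℤ.- c , i)

    _⊛_ : Element → Element → Element
    []            ⊛ b = []
    ((c , i) ∷ a) ⊛ b = monomial-* c i b ++ a ⊛ b

    -- The endomorphism x ↦ xᵏ. Read in ℤ[ζ], `σ k f` is the Fourier coefficient f(ζᵏ) for any k;
    -- when k is prime to n, `σ k` is also a Galois automorphism.
    σ : ℕ → Element → Element
    σ k = map (λ (c , i) → c , k * i)

    monomial-⊛ : ∀ c i d j → ((c , i) ∷ []) ⊛ ((d , j) ∷ []) ≡ (c ℤ.* d , i + j) ∷ []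
    monomial-⊛ c i d j = refl

    σ-[] : ∀ k → σ k [] ≡ []
    σ-[] k = refl

    σ-∷ : ∀ k c i a → σ k ((c , i) ∷ a) ≡ (c , k * i) ∷ σ k a
    σ-∷ k c i a = refl

    ∫-⊕ : ∀ a b h → ∫ (a ⊕ b) h ≡ ∫ a h ℤ.+ ∫ b h
    ∫-⊕ = ∫-++

    ∫-negate : ∀ a h → ∫ (negate a) h ≡ ℤ.- ∫ a h
    ∫-negate []            h = refl
    ∫-negate ((c , i) ∷ a) h = trans (cong (λ z → (ℤ.- c) ℤ.* h i ℤ.+ z) (∫-negate a h)) (lemma c (h i) _)
      where
      lemma : ∀ c x u → (ℤ.- c) ℤ.* x ℤ.+ (ℤ.- u) ≡ ℤ.- (c ℤ.* x ℤ.+ u)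
      lemma = solve-∀

    ∫-⊛ : ∀ a b h → ∫ (a ⊛ b) h ≡ ∫ a (λ i → ∫ b (λ j → h (i + j)))
    ∫-⊛ []            b h = refl
    ∫-⊛ ((c , i) ∷ a) b h =
      trans (∫-++ (monomial-* c i b) (a ⊛ b) h) (cong₂ ℤ._+_ (∫-monomial-* c i b h) (∫-⊛ a b h))

    ∫-σ : ∀ k a h → ∫ (σ k a) h ≡ ∫ a (λ i → h (k * i))
    ∫-σ k []            h = refl
    ∫-σ k ((c , i) ∷ a) h = cong (λ z → c ℤ.* h (k * i) ℤ.+ z) (∫-σ k a h)

    norm-σ : ∀ k a → norm (σ k a) ≡ norm a
    norm-σ k []            = refl
    norm-σ k ((c , _) ∷ a) = cong (λ z → ∣ c ∣ + z) (norm-σ k a)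

    norm-⊛ : ∀ a b → norm (a ⊛ b) ≡ norm a * norm b
    norm-⊛ []            b = refl
    norm-⊛ ((c , i) ∷ a) b = trans (norm-++ (monomial-* c i b) (a ⊛ b))
      (trans (cong₂ ℕ._+_ (norm-monomial b) (norm-⊛ a b)) (sym (ℕ.*-distribʳ-+ (norm b) ∣ c ∣ (norm a))))
      where
      norm-monomial : ∀ b → norm (monomial-* c i b) ≡ ∣ c ∣ * norm b
      norm-monomial []            = sym (ℕ.*-zeroʳ ∣ c ∣)
      norm-monomial ((d , _) ∷ b) =
        trans (cong₂ ℕ._+_ (ℤ.abs-* c d) (norm-monomial b)) (sym (ℕ.*-distribˡ-+ ∣ c ∣ ∣ d ∣ (norm b)))

  ∫-X : ∀ i h → ∫ (X i) h ≡ h i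
  ∫-X i h = trans (ℤ.+-identityʳ _) (ℤ.*-identityˡ _)

  ∫-const : ∀ c h → ∫ (const c) h ≡ c ℤ.* h 0
  ∫-const c h = ℤ.+-identityʳ _

  ∣∫∣≤norm : ∀ a {h} → (∀ i → ∣ h i ∣ ≤ 1) → ∣ ∫ a h ∣ ≤ norm a
  ∣∫∣≤norm [] bound = ℕ.z≤n
  ∣∫∣≤norm ((c , i) ∷ a) {h} bound = begin
    ∣ c ℤ.* h i ℤ.+ ∫ a h ∣         ≤⟨ ℤ.∣i+j∣≤∣i∣+∣j∣ (c ℤ.* h i) (∫ a h) ⟩
    ∣ c ℤ.* h i ∣ + ∣ ∫ a h ∣     ≡⟨ cong (_+ ∣ ∫ a h ∣) (ℤ.abs-* c (h i)) ⟩
    ∣ c ∣ * ∣ h i ∣ + ∣ ∫ a h ∣ ≤⟨ ℕ.+-mono-≤ (ℕ.*-monoʳ-≤ ∣ c ∣ (bound i)) (∣∫∣≤norm a bound) ⟩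
    ∣ c ∣ * 1 + norm a          ≡⟨ cong (_+ norm a) (ℕ.*-identityʳ ∣ c ∣) ⟩
    ∣ c ∣ + norm a                ∎
    where open ℕ.≤-Reasoning

  module _ (n : ℕ) .{{n≢0 : NonZero n}} where

    record Periodic (h : ℕ → ℤ) : Set where
      constructor periodic
      field
        resp : ∀ {i j} → i ∼ j [ n ] → h i ≡ h j
    open Periodic

    infix 4 _≋_
    record _≋_ (a b : Element) : Set where
      constructor mk
      field
        acts : ∀ {h} → Periodic h → ∫ a h ≡ ∫ b h
    open _≋_

    scale-periodic : ∀ {h} k → Periodic h → Periodic (λ j → h (k * j))
    scale-periodic k p = periodic λ j∼j′ → resp p (∼-*ˡ k j∼j′)

    ∫-periodic : ∀ b {h} → Periodic h → Periodic (λ i → ∫ b (λ j → h (i + j)))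
    ∫-periodic b p = periodic λ {i} {i′} i∼i′ → ∫-cong b (λ j → resp p (∼-+ i∼i′ (∼-refl {j})))

    by-∫ : ∀ {a b} → (∀ h → ∫ a h ≡ ∫ b h) → a ≋ b
    by-∫ e = mk λ {h} _ → e h

    ⊛-comm : ∀ a b → a ⊛ b ≋ b ⊛ a
    ⊛-comm a b = by-∫ λ h → begin
      ∫ (a ⊛ b) h                            ≡⟨ ∫-⊛ a b h ⟩
      ∫ a (λ i → ∫ b (λ j → h (i + j)))    ≡⟨ ∫-fubini a b _ ⟩
      ∫ b (λ j → ∫ a (λ i → h (i + j)))    ≡⟨ ∫-cong b (λ j → ∫-cong a (λ i → cong h (ℕ.+-comm i j))) ⟩
      ∫ b (λ j → ∫ a (λ i → h (j + i)))    ≡⟨ ∫-⊛ b a h ⟨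
      ∫ (b ⊛ a) h                            ∎
      where open ≡-Reasoning

    ⊛-assoc : ∀ a b c → (a ⊛ b) ⊛ c ≋ a ⊛ (b ⊛ c)
    ⊛-assoc a b c = by-∫ λ h → begin
      ∫ ((a ⊛ b) ⊛ c) h                                            ≡⟨ ∫-⊛ (a ⊛ b) c h ⟩
      ∫ (a ⊛ b) (λ i → ∫ c (λ k → h (i + k)))                    ≡⟨ ∫-⊛ a b _ ⟩
      ∫ a (λ i → ∫ b (λ j → ∫ c (λ k → h (i + j + k))))        ≡⟨ ∫-cong a (λ i → ∫-cong b (λ j → ∫-cong c (λ k → cong h (ℕ.+-assoc i j k)))) ⟩
      ∫ a (λ i → ∫ b (λ j → ∫ c (λ k → h (i + (j + k)))))      ≡⟨ ∫-cong a (λ i → ∫-⊛ b c (λ j → h (i + j))) ⟨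
      ∫ a (λ i → ∫ (b ⊛ c) (λ j → h (i + j)))                    ≡⟨ ∫-⊛ a (b ⊛ c) h ⟨
      ∫ (a ⊛ (b ⊛ c)) h                                            ∎
      where open ≡-Reasoning

    ⊛-identityˡ : ∀ a → X 0 ⊛ a ≋ a
    ⊛-identityˡ a = by-∫ λ h → trans (∫-⊛ (X 0) a h) (∫-X 0 (λ i → ∫ a (λ j → h (i + j))))

    ⊛-distribʳ : ∀ a b c → (b ⊕ c) ⊛ a ≋ b ⊛ a ⊕ c ⊛ a
    ⊛-distribʳ a b c = by-∫ λ h → begin
      ∫ ((b ⊕ c) ⊛ a) h          ≡⟨ ∫-⊛ (b ⊕ c) a h ⟩
      ∫ (b ⊕ c) (g h)            ≡⟨ ∫-⊕ b c (g h) ⟩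
      ∫ b (g h) ℤ.+ ∫ c (g h)     ≡⟨ cong₂ ℤ._+_ (∫-⊛ b a h) (∫-⊛ c a h) ⟨
      ∫ (b ⊛ a) h ℤ.+ ∫ (c ⊛ a) h ≡⟨ ∫-⊕ (b ⊛ a) (c ⊛ a) h ⟨
      ∫ (b ⊛ a ⊕ c ⊛ a) h        ∎
      where
      open ≡-Reasoning
      g : (ℕ → ℤ) → ℕ → ℤ
      g h i = ∫ a (λ j → h (i + j))

    private
      ≋-refl : ∀ {a} → a ≋ a
      ≋-refl = mk λ _ → refl

      ≋-sym : ∀ {a b} → a ≋ b → b ≋ a
      ≋-sym e = mk λ p → sym (acts e p)

      ≋-trans : ∀ {a b c} → a ≋ b → b ≋ c → a ≋ c
      ≋-trans e e′ = mk λ p → trans (acts e p) (acts e′ p)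

      ⊕-cong : ∀ {a b c d} → a ≋ b → c ≋ d → a ⊕ c ≋ b ⊕ d
      ⊕-cong {a} {b} {c} {d} e e′ = mk λ {h} p →
        trans (∫-⊕ a c h) (trans (cong₂ ℤ._+_ (acts e p) (acts e′ p)) (sym (∫-⊕ b d h)))

      ⊕-comm : ∀ a b → a ⊕ b ≋ b ⊕ a
      ⊕-comm a b = by-∫ λ h → trans (∫-⊕ a b h) (trans (ℤ.+-comm (∫ a h) (∫ b h)) (sym (∫-⊕ b a h)))

      ⊕-assoc : ∀ a b c → (a ⊕ b) ⊕ c ≋ a ⊕ (b ⊕ c)
      ⊕-assoc a b c = by-∫ λ h → trans (∫-⊕ (a ⊕ b) c h) (trans (cong (ℤ._+ ∫ c h) (∫-⊕ a b h))
        (trans (ℤ.+-assoc (∫ a h) (∫ b h) (∫ c h)) (sym (trans (∫-⊕ a (b ⊕ c) h) (cong (λ z → ∫ a h ℤ.+ z) (∫-⊕ b c h))))))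

      negate-inverseˡ : ∀ a → negate a ⊕ a ≋ []
      negate-inverseˡ a = by-∫ λ h → trans (∫-⊕ (negate a) a h)
        (trans (cong (ℤ._+ ∫ a h) (∫-negate a h)) (ℤ.+-inverseˡ (∫ a h)))

      ⊛-congʳ : ∀ {a b} c → a ≋ b → a ⊛ c ≋ b ⊛ c
      ⊛-congʳ {a} {b} c e = mk λ {h} p → trans (∫-⊛ a c h) (trans (acts e (∫-periodic c p)) (sym (∫-⊛ b c h)))

      ⊛-cong : ∀ {a b c d} → a ≋ b → c ≋ d → a ⊛ c ≋ b ⊛ d
      ⊛-cong {a} {b} {c} {d} e e′ =
        ≋-trans (⊛-congʳ c e) (≋-trans (⊛-comm b c) (≋-trans (⊛-congʳ b e′) (⊛-comm d b)))

    groupRing : CommutativeRing 0ℓ 0ℓ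
    groupRing = record
      { Carrier = Element ; _≈_ = _≋_ ; _+_ = _⊕_ ; _*_ = _⊛_ ; -_ = negate ; 0# = [] ; 1# = X 0
      ; isCommutativeRing = record
        { isRing = record
          { +-isAbelianGroup = record
            { isGroup = record
              { isMonoid = record
                { isSemigroup = record
                  { isMagma = record
                    { isEquivalence = record { refl = ≋-refl ; sym = ≋-sym ; trans = ≋-trans }
                    ; ∙-cong = ⊕-cong
                    }
                  ; assoc = ⊕-assoc
                  }
                ; identity = (λ a → by-∫ λ h → trans (∫-⊕ [] a h) (ℤ.+-identityˡ _)) , (λ a → by-∫ λ h → trans (∫-⊕ a [] h) (ℤ.+-identityʳ _))
                }
              ; inverse = negate-inverseˡ , λ a → ≋-trans (⊕-comm a (negate a)) (negate-inverseˡ a)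
              ; ⁻¹-cong = λ {a} {b} e → mk λ {h} p →
                  trans (∫-negate a h) (trans (cong ℤ.-_ (acts e p)) (sym (∫-negate b h)))
              }
            ; comm = ⊕-comm
            }
          ; *-cong = ⊛-cong
          ; *-assoc = ⊛-assoc
          ; *-identity = ⊛-identityˡ , λ a → ≋-trans (⊛-comm a (X 0)) (⊛-identityˡ a)
          ; distrib = (λ a b c → ≋-trans (⊛-comm a (b ⊕ c)) (≋-trans (⊛-distribʳ a b c) (⊕-cong (⊛-comm b a) (⊛-comm c a))))
                    , ⊛-distribʳ
          }
        ; *-comm = ⊛-comm
        }
      }

    module A where
      open CommutativeRing groupRing public
      open CommutativeRingLemmas groupRing public
      open import Relation.Binary.Reasoning.Setoid setoid public

    X-cong : ∀ {i j} → i ∼ j [ n ] → X i ≋ X j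
    X-cong {i} {j} i∼j = mk λ {h} p → trans (∫-X i h) (trans (resp p i∼j) (sym (∫-X j h)))

    X-+ : ∀ i j → X (i + j) ≋ X i ⊛ X j
    X-+ i j = A.reflexive (sym (monomial-⊛ 1ℤ i 1ℤ j))

    const-+ : ∀ c d → const (c ℤ.+ d) ≋ const c ⊕ const d
    const-+ c d = by-∫ λ h → trans (∫-const (c ℤ.+ d) h) (trans (ℤ.*-distribʳ-+ (h 0) c d)
      (sym (trans (∫-⊕ (const c) (const d) h) (cong₂ ℤ._+_ (∫-const c h) (∫-const d h)))))

    const-0 : const 0ℤ ≋ []
    const-0 = by-∫ λ h → refl

    const-negate : ∀ c → const (ℤ.- c) ≋ negate (const c)
    const-negate c = by-∫ λ h → trans (∫-const (ℤ.- c) h) (trans (sym (ℤ.neg-distribˡ-* c (h 0)))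
      (sym (trans (∫-negate (const c) h) (cong ℤ.-_ (∫-const c h)))))

    const-suc : ∀ k → const (+ suc k) ≋ X 0 ⊕ const (+ k)
    const-suc k = const-+ 1ℤ (+ k)

    const≋· : ∀ k → const (+ k) ≋ k A.· X 0
    const≋· zero    = const-0
    const≋· (suc k) = A.trans (const-suc k) (A.+-congˡ (const≋· k))

    cons-split : ∀ c i a → (c , i) ∷ a ≋ const c ⊛ X i ⊕ a
    cons-split c i a = by-∫ λ h → sym (trans (∫-⊕ (const c ⊛ X i) a h) (cong (ℤ._+ ∫ a h)
      (trans (cong (λ b → ∫ b h) (monomial-⊛ c 0 1ℤ i)) (trans (ℤ.+-identityʳ _) (cong (ℤ._* h i) (ℤ.*-identityʳ c))))))

    ∫-const-⊛ : ∀ c a h → ∫ (const c ⊛ a) h ≡ c ℤ.* ∫ a h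
    ∫-const-⊛ c a h = trans (∫-⊛ (const c) a h) (∫-const c (λ i → ∫ a (λ j → h (i + j))))

    σ-cong : ∀ k {a b} → a ≋ b → σ k a ≋ σ k b
    σ-cong k {a} {b} e = mk λ {h} p → trans (∫-σ k a h) (trans (acts e (scale-periodic k p)) (sym (∫-σ k b h)))

    σ-+ : ∀ k a b → σ k (a ⊕ b) ≋ σ k a ⊕ σ k b
    σ-+ k a b = by-∫ λ h → trans (∫-σ k (a ⊕ b) h) (trans (∫-⊕ a b _)
      (sym (trans (∫-⊕ (σ k a) (σ k b) h) (cong₂ ℤ._+_ (∫-σ k a h) (∫-σ k b h)))))

    σ-* : ∀ k a b → σ k (a ⊛ b) ≋ σ k a ⊛ σ k b
    σ-* k a b = by-∫ λ h → begin
      ∫ (σ k (a ⊛ b)) h                                       ≡⟨ ∫-σ k (a ⊛ b) h ⟩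
      ∫ (a ⊛ b) (λ i → h (k * i))                           ≡⟨ ∫-⊛ a b _ ⟩
      ∫ a (λ i → ∫ b (λ j → h (k * (i + j))))             ≡⟨ ∫-cong a (λ i → ∫-cong b (λ j → cong h (ℕ.*-distribˡ-+ k i j))) ⟩
      ∫ a (λ i → ∫ b (λ j → h (k * i + k * j)))         ≡⟨ ∫-cong a (λ i → ∫-σ k b (λ j → h (k * i + j))) ⟨
      ∫ a (λ i → ∫ (σ k b) (λ j → h (k * i + j)))         ≡⟨ ∫-σ k a _ ⟨
      ∫ (σ k a) (λ i → ∫ (σ k b) (λ j → h (i + j)))         ≡⟨ ∫-⊛ (σ k a) (σ k b) h ⟨
      ∫ (σ k a ⊛ σ k b) h                                     ∎
      where open ≡-Reasoning

    σ-negate : ∀ k a → σ k (negate a) ≋ negate (σ k a)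
    σ-negate k a = by-∫ λ h → trans (∫-σ k (negate a) h) (trans (∫-negate a _) (sym
      (trans (∫-negate (σ k a) h) (cong ℤ.-_ (∫-σ k a h)))))

    σ-∘ : ∀ k l a → σ k (σ l a) ≋ σ (k * l) a
    σ-∘ k l a = by-∫ λ h → trans (∫-σ k (σ l a) h) (trans (∫-σ l a _)
      (trans (∫-cong a (λ i → cong h (sym (ℕ.*-assoc k l i)))) (sym (∫-σ (k * l) a h))))

    σ-∼ : ∀ {k l} → k ∼ l [ n ] → ∀ a → σ k a ≋ σ l a
    σ-∼ {k} {l} k∼l a = mk λ {h} p → trans (∫-σ k a h)
      (trans (∫-cong a (λ i → resp p (∼-*ʳ i k∼l))) (sym (∫-σ l a h)))

    σ-1 : ∀ a → σ 1 a ≋ a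
    σ-1 a = by-∫ λ h → trans (∫-σ 1 a h) (∫-cong a (λ i → cong h (ℕ.*-identityˡ i)))

    σ-const : ∀ k c → σ k (const c) ≋ const c
    σ-const k c = by-∫ λ h → trans (∫-σ k (const c) h) (cong (λ i → c ℤ.* h i ℤ.+ 0ℤ) (ℕ.*-zeroʳ k))

    σ-X : ∀ k i → σ k (X i) ≋ X (k * i)
    σ-X k i = by-∫ λ h → ∫-σ k (X i) h

    X-^ : ∀ i m → X i A.^ m ≋ X (m * i)
    X-^ i zero    = A.refl
    X-^ i (suc m) = A.trans (A.*-congˡ {X i} (X-^ i m)) (A.sym (X-+ i (m * i)))

    δ : ℕ → ℕ → ℤ
    δ m i with i ∼? m [ n ]
    ... | yes _ = 1ℤ
    ... | no _  = 0ℤ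

    δ-yes : ∀ {m i} → i ∼ m [ n ] → δ m i ≡ 1ℤ
    δ-yes {m} {i} i∼m with i ∼? m [ n ]
    ... | yes _ = refl
    ... | no i≁m = ⊥-elim (i≁m i∼m)

    δ-no : ∀ {m i} → ¬ i ∼ m [ n ] → δ m i ≡ 0ℤ
    δ-no {m} {i} i≁m with i ∼? m [ n ]
    ... | yes i∼m = ⊥-elim (i≁m i∼m)
    ... | no _ = refl

    δ-iff : ∀ {m i m′ i′} → (i ∼ m [ n ] → i′ ∼ m′ [ n ]) → (i′ ∼ m′ [ n ] → i ∼ m [ n ]) → δ m i ≡ δ m′ i′
    δ-iff {m} {i} {m′} {i′} f g with i ∼? m [ n ]
    ... | yes i∼m = sym (δ-yes {m′} {i′} (f i∼m))
    ... | no i≁m  = sym (δ-no {m′} {i′} (λ e → i≁m (g e)))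

    δ-periodic : ∀ m → Periodic (δ m)
    δ-periodic m = periodic λ {i} {j} i∼j → δ-iff {m} {i} {m} {j} (∼-trans (∼-sym i∼j)) (∼-trans i∼j)

    ∣δ∣≤1 : ∀ m i → ∣ δ m i ∣ ≤ 1
    ∣δ∣≤1 m i with i ∼? m [ n ]
    ... | yes _ = ℕ.≤-refl
    ... | no _ = ℕ.z≤n

    coef : ℕ → Element → ℤ
    coef m a = ∫ a (δ m)

    coef-cong : ∀ m {a b} → a ≋ b → coef m a ≡ coef m b
    coef-cong m e = acts e (δ-periodic m)

    coef-∼ : ∀ {m m′} → m ∼ m′ [ n ] → ∀ a → coef m a ≡ coef m′ a
    coef-∼ {m} {m′} e a = ∫-cong a λ i → δ-iff {m} {i} {m′} {i} (λ i∼m → ∼-trans i∼m e) (λ i∼m′ → ∼-trans i∼m′ (∼-sym e))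

    coef-shift : ∀ m k a → coef (k + m) (X k ⊛ a) ≡ coef m a
    coef-shift m k a = trans (∫-⊛ (X k) a (δ (k + m))) (trans (∫-X k (λ i → ∫ a (λ j → δ (k + m) (i + j))))
      (∫-cong a (λ j → δ-iff {k + m} {k + j} {m} {j} (∼-+-cancelˡ k) (∼-+ (∼-refl {k})))))

    -- A periodic test function is a combination of the n functions `δ m`. Hence n integers
    -- determine an element, which makes equality decidable.
    sift : ∀ {h} → Periodic h → ∀ i → h i ≡ Σ< n (λ m → δ m i ℤ.* h m)
    sift {h} p i = sym (trans (Σ-single n _ (m%n<n i n) λ {m} m<n m≢ →
        trans (cong (ℤ._* h m) (δ-no {m} {i} (λ i∼m → m≢ (∼⇒≡ m<n (m%n<n i n) (∼-trans (∼-sym i∼m) (residue-∼ i n))))))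
              (ℤ.*-zeroˡ (h m)))
      (trans (cong₂ ℤ._*_ (δ-yes {i % n} {i} (residue-∼ i n)) (resp p (∼-sym (residue-∼ i n)))) (ℤ.*-identityˡ (h i))))

    ∫-coef : ∀ a {h} → Periodic h → ∫ a h ≡ Σ< n (λ m → coef m a ℤ.* h m)
    ∫-coef a {h} p = begin
      ∫ a h                                       ≡⟨ ∫-cong a (sift p) ⟩
      ∫ a (λ i → Σ< n (λ m → δ m i ℤ.* h m))      ≡⟨ ∫-Σ a n _ ⟩
      Σ< n (λ m → ∫ a (λ i → δ m i ℤ.* h m))      ≡⟨ Σ-cong n (λ {m} _ → trans (∫-cong a (λ i → ℤ.*-comm (δ m i) (h m)))
                                                       (trans (∫-* a (h m) (δ m)) (ℤ.*-comm (h m) (coef m a)))) ⟩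
      Σ< n (λ m → coef m a ℤ.* h m)               ∎
      where open ≡-Reasoning

    coefs⇒≋ : ∀ {a b} → (∀ m → coef m a ≡ coef m b) → a ≋ b
    coefs⇒≋ {a} {b} e = mk λ {h} p →
      trans (∫-coef a p) (trans (Σ-cong n (λ {m} _ → cong (ℤ._* h m) (e m))) (sym (∫-coef b p)))

    zero-or-coef : ∀ a → a ≋ [] ⊎ ∃[ m ] coef m a ≢ 0ℤ
    zero-or-coef a with search n
      where
      search : ∀ k → (∀ {m} → m < k → coef m a ≡ 0ℤ) ⊎ ∃[ m ] coef m a ≢ 0ℤ
      search zero = inj₁ λ ()
      search (suc k) with search k | coef k a ℤ.≟ 0ℤ
      ... | inj₂ found | _ = inj₂ found
      ... | inj₁ _ | no ≢0 = inj₂ (k , ≢0)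
      ... | inj₁ all | yes ≡0 = inj₁ λ {m} m<sk → extend m<sk (m ℕ.≟ k)
        where
        extend : ∀ {m} → m < suc k → Dec (m ≡ k) → coef m a ≡ 0ℤ
        extend m<sk (yes refl) = ≡0
        extend m<sk (no m≢k) = all (ℕ.≤∧≢⇒< (ℕ.≤-pred m<sk) m≢k)
    ... | inj₂ found = inj₂ found
    ... | inj₁ all = inj₁ (coefs⇒≋ λ m → trans (coef-∼ (residue-∼ m n) a) (all (m%n<n m n)))

    zero? : ∀ a → Dec (a ≋ [])
    zero? a with zero-or-coef a
    ... | inj₁ a≋0 = yes a≋0
    ... | inj₂ (m , ≢0) = no λ a≋0 → ≢0 (coef-cong m a≋0)

    -- Every coefficient is a multiple of q and, being bounded by the norm, smaller than q in
    -- absolute value. This is what turns a congruence modulo a large prime into an equality.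
    large-multiple : ∀ {a c} q → norm a < q → a ≋ const (+ q) ⊛ c → a ≋ []
    large-multiple {a} {c} q bound e = coefs⇒≋ λ m → ∣q*z∣<q (coef m c) (trans (coef-cong m e) (∫-const-⊛ (+ q) c (δ m)))
      (ℕ.≤-<-trans (∣∫∣≤norm a (∣δ∣≤1 m)) bound)
      where
      ∣q*z∣<q : ∀ {x} z → x ≡ + q ℤ.* z → ∣ x ∣ < q → x ≡ 0ℤ
      ∣q*z∣<q z refl lt = by-size ∣ z ∣ refl
        where
        by-size : ∀ k → ∣ z ∣ ≡ k → + q ℤ.* z ≡ 0ℤ
        by-size zero    ∣z∣≡ = trans (cong (+ q ℤ.*_) (ℤ.∣i∣≡0⇒i≡0 ∣z∣≡)) (ℤ.*-zeroʳ (+ q))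
        by-size (suc k) ∣z∣≡ = ⊥-elim (ℕ.<⇒≱ lt
          (subst (q ≤_) (sym (trans (ℤ.abs-* (+ q) z) (cong (q *_) ∣z∣≡))) (ℕ.m≤m*n q (suc k))))

    -- Modulo q, raising to the q-th power is additive, fixes integers by Fermat's little theorem,
    -- and sends a power of x to its image under `σ q`; induction over the formal sum does the rest.
    frobenius : ∀ {q} → Prime q → ∀ a → ∃[ c ] (a A.^ q ≋ σ q a ⊕ const (+ q) ⊛ c)
    frobenius {q} q-prime a = let mk c e = power a in c , A.trans (A.reflexive (sym (^ₘ≡^ a q))) e
      where
      open A.PrincipalQuotient (const (+ q)) using (quotientₘ; _≈ₘ_; mk; ≈⇒≈ₘ; m≈ₘ0; ^ₘ≡^; ·ₘ≡·)
      module Q where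
        open CommutativeRing quotientₘ public
        open CommutativeRingLemmas quotientₘ public
        open Characteristic q-prime (CommutativeRing.trans quotientₘ
          (≈⇒≈ₘ (A.trans (A.reflexive (·ₘ≡· q (X 0))) (A.sym (const≋· q)))) m≈ₘ0) public
      const-power : ∀ k → const (+ k) Q.^ q ≈ₘ const (+ k)
      const-power zero = Q.trans (Q.^-congˡ q (≈⇒≈ₘ const-0)) (Q.trans Q.0^q≈0 (≈⇒≈ₘ (A.sym const-0)))
      const-power (suc k) = Q.trans (Q.^-congˡ q (≈⇒≈ₘ (const-suc k))) (Q.trans (Q.freshman (X 0) (const (+ k)))
        (Q.trans (Q.+-cong (Q.1^ q) (const-power k)) (≈⇒≈ₘ (A.sym (const-suc k)))))
      const-power′ : ∀ c → const c Q.^ q ≈ₘ const c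
      const-power′ (+ k) = const-power k
      const-power′ -[1+ k ] = Q.trans (Q.^-congˡ q (≈⇒≈ₘ (const-negate (+ suc k))))
        (Q.trans (Q.frobenius-neg (const (+ suc k))) (Q.trans (Q.-‿cong (const-power (suc k))) (≈⇒≈ₘ (A.sym (const-negate (+ suc k))))))
      power : ∀ a → a Q.^ q ≈ₘ σ q a
      power [] = Q.trans Q.0^q≈0 (≈⇒≈ₘ (A.reflexive (sym (σ-[] q))))
      power ((c , i) ∷ a) = Q.trans (Q.^-congˡ q (≈⇒≈ₘ (cons-split c i a)))
        (Q.trans (Q.freshman (const c ⊛ X i) a)
        (Q.trans (Q.+-cong (Q.trans (Q.^-distrib-* (const c) (X i) q) (Q.*-cong (const-power′ c) (≈⇒≈ₘ (A.trans (A.reflexive (^ₘ≡^ (X i) q)) (X-^ i q))))) (power a))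
        (≈⇒≈ₘ (A.trans (A.sym (cons-split c (q * i) (σ q a))) (A.reflexive (sym (σ-∷ q c i a)))))))

    -- Complex conjugation x ↦ x⁻¹, with n - 1 in the role of -1.
    star : Element → Element
    star = σ (ℕ.pred n)

    private
      pred-inverse : ∀ i → i + ℕ.pred n * i ∼ 0 [ n ]
      pred-inverse i = ∣⇒∼0 (subst (λ m → n Data.Nat.Divisibility.∣ m * i) (sym (ℕ.suc-pred n)) (Data.Nat.Divisibility.m∣m*n i))
        where import Data.Nat.Divisibility

      sum-of-squares : ∀ m (f : ℕ → ℤ) → Σ< m (λ i → f i ℤ.* f i) ≡ 0ℤ → ∀ {i} → i < m → f i ≡ 0ℤ
      sum-of-squares m f e = vanish m (abs-sum m e)
        where
        squares : ℕ → ℕ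
        squares zero = 0
        squares (suc m) = squares m + ∣ f m ∣ * ∣ f m ∣
        square : ∀ x → x ℤ.* x ≡ + (∣ x ∣ * ∣ x ∣)
        square (+ x) = sym (ℤ.pos-* x x)
        square -[1+ x ] = refl
        abs-Σ : ∀ m → Σ< m (λ i → f i ℤ.* f i) ≡ + squares m
        abs-Σ zero = refl
        abs-Σ (suc m) = cong₂ ℤ._+_ (abs-Σ m) (square (f m))
        abs-sum : ∀ m → Σ< m (λ i → f i ℤ.* f i) ≡ 0ℤ → squares m ≡ 0
        abs-sum m e = ℤ.+-injective (trans (sym (abs-Σ m)) e)
        vanish : ∀ m → squares m ≡ 0 → ∀ {i} → i < m → f i ≡ 0ℤ
        vanish (suc m) e {i} i<sm with i ℕ.≟ m
        ... | yes refl = ℤ.∣i∣≡0⇒i≡0 (reduce (ℕ.m*n≡0⇒m≡0∨n≡0 ∣ f m ∣ (ℕ.m+n≡0⇒n≡0 (squares m) e)))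
        ... | no i≢m = vanish m (ℕ.m+n≡0⇒m≡0 (squares m) e) (ℕ.≤∧≢⇒< (ℕ.≤-pred i<sm) i≢m)

    star-involutive : ∀ a → star (star a) ≋ a
    star-involutive a = A.trans (σ-∘ (ℕ.pred n) (ℕ.pred n) a) (A.trans (σ-∼ square∼1 a) (σ-1 a))
      where
      p = ℕ.pred n
      square∼1 : p * p ∼ 1 [ n ]
      square∼1 = ∼-+-cancelˡ p (∼-trans (pred-inverse p) (∼-sym (subst (_∼ 0 [ n ])
        (trans (cong (λ x → 1 + x) (ℕ.*-identityʳ p)) (ℕ.+-comm 1 p)) (pred-inverse 1))))

    -- The coefficient of x⁰ in a a* is the sum of the squares of the coefficients of a.
    star-definite : ∀ a → a ⊛ star a ≋ [] → a ≋ []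
    star-definite a e = coefs⇒≋ λ m → trans (coef-∼ (residue-∼ m n) a)
      (sum-of-squares n (λ m → coef m a) squares (m%n<n m n))
      where
      open ≡-Reasoning
      diagonal : ∀ i j → δ 0 (i + ℕ.pred n * j) ≡ δ i j
      diagonal i j = δ-iff {0} {i + ℕ.pred n * j} {i} {j}
        (λ h → ∼-+-cancelʳ (ℕ.pred n * j) (∼-trans (pred-inverse j) (∼-sym h)))
        (λ h → ∼-trans (∼-+ (∼-sym h) (∼-refl {ℕ.pred n * j})) (pred-inverse j))
      squares : Σ< n (λ m → coef m a ℤ.* coef m a) ≡ 0ℤ
      squares = begin
        Σ< n (λ m → coef m a ℤ.* coef m a)                     ≡⟨ ∫-coef a {λ i → coef i a} (periodic λ i∼j → coef-∼ i∼j a) ⟨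
        ∫ a (λ i → ∫ a (δ i))                                  ≡⟨ ∫-cong a (λ i → ∫-cong a (diagonal i)) ⟨
        ∫ a (λ i → ∫ a (λ j → δ 0 (i + ℕ.pred n * j)))     ≡⟨ ∫-cong a (λ i → ∫-σ (ℕ.pred n) a (λ j → δ 0 (i + j))) ⟨
        ∫ a (λ i → ∫ (star a) (λ j → δ 0 (i + j)))           ≡⟨ ∫-⊛ a (star a) (δ 0) ⟨
        coef 0 (a ⊛ star a)                                    ≡⟨ coef-cong 0 e ⟩
        0ℤ                                                     ∎

    -- Definiteness is used twice: y = a a* satisfies y y* = (a a)(a* a*) = 0, so y = 0, and
    -- therefore a = 0.
    reduced : ∀ a → a ⊛ a ≋ [] → a ≋ []
    reduced a aa≋0 = star-definite a (star-definite y (begin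
      y ⊛ star y                         ≈⟨ A.*-congˡ (σ-* (ℕ.pred n) a (star a)) ⟩
      y ⊛ (star a ⊛ star (star a))       ≈⟨ A.*-congˡ (A.*-congˡ (star-involutive a)) ⟩
      (a ⊛ star a) ⊛ (star a ⊛ a)        ≈⟨ lemma a (star a) ⟩
      (a ⊛ a) ⊛ (star a ⊛ star a)        ≈⟨ A.trans (A.*-congʳ aa≋0) (A.zeroˡ _) ⟩
      []                                 ∎))
      where
      open A using (begin_; step-≈-⟩; step-≈-⟨; _∎)
      y = a ⊛ star a
      lemma : ∀ a b → (a ⊛ b) ⊛ (b ⊛ a) ≋ (a ⊛ a) ⊛ (b ⊛ b)
      lemma = A.solve 2 (λ a b → (a A.:* b) A.:* (b A.:* a) A.:= (a A.:* a) A.:* (b A.:* b)) A.refl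

    private
      annihilator-frobenius : ∀ {q} a b → Prime q → norm a * norm b < q → a ⊛ b ≋ [] → σ q a ⊛ b ≋ []
      annihilator-frobenius {q} a b q-prime bound ab≋0 =
        large-multiple {σ q a ⊛ b} {negate (c ⊛ b)} q
          (subst (_< q) (sym (trans (norm-⊛ (σ q a) b) (cong (_* norm b) (norm-σ q a)))) bound)
          (A.trans (A.+-inverseʳ-unique (const (+ q) ⊛ (c ⊛ b)) (σ q a ⊛ b) cancel) (A.-‿distribʳ-* (const (+ q)) (c ⊛ b)))
        where
        open A using (begin_; step-≈-⟩; step-≈-⟨; _∎)
        c = proj₁ (frobenius q-prime a)
        lemma : ∀ k c b s → k ⊛ (c ⊛ b) ⊕ s ⊛ b ≋ (s ⊕ k ⊛ c) ⊛ b
        lemma = A.solve 4 (λ k c b s → k A.:* (c A.:* b) A.:+ s A.:* b A.:= (s A.:+ k A.:* c) A.:* b) A.refl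
        swap : ∀ a p b → (a ⊛ p) ⊛ b ≋ p ⊛ (a ⊛ b)
        swap = A.solve 3 (λ a p b → (a A.:* p) A.:* b A.:= p A.:* (a A.:* b)) A.refl
        power : ∀ q′ → q′ ≡ q → a A.^ q′ ⊛ b ≋ []
        power zero eq = ⊥-elim (¬prime[0] (subst Prime (sym eq) q-prime))
        power (suc r) _ = A.trans (swap a (a A.^ r) b) (A.trans (A.*-congˡ {a A.^ r} ab≋0) (A.zeroʳ (a A.^ r)))
        cancel : const (+ q) ⊛ (c ⊛ b) ⊕ σ q a ⊛ b ≋ []
        cancel = begin
          const (+ q) ⊛ (c ⊛ b) ⊕ σ q a ⊛ b    ≈⟨ lemma (const (+ q)) c b (σ q a) ⟩
          (σ q a ⊕ const (+ q) ⊛ c) ⊛ b        ≈⟨ A.*-congʳ (proj₂ (frobenius q-prime a)) ⟨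
          a A.^ q ⊛ b                           ≈⟨ power q refl ⟩
          []                                    ∎

    -- Galois invariance: for a prime q exceeding all coefficients, a^q ≡ σ_q a (mod q) transfers
    -- a b = 0 to σ_q a b = 0, and every class of units contains products of such primes.
    annihilator-σ : ∀ {k} a b → Coprime k n → a ⊛ b ≋ [] → σ k a ⊛ b ≋ []
    annihilator-σ {k} a b co ab≋0 = A.trans (A.*-congʳ (A.sym (σ-∼ (proj₁ (proj₂ lifted)) a)))
      (rough-induction (λ k → σ k a ⊛ b ≋ []) B (ℕ.m≤m+n 2 _) (A.trans (A.*-congʳ (σ-1 a)) ab≋0) step
        (proj₁ lifted) (proj₂ (proj₂ lifted)))
      where
      -- The norm of `σ k a` does not depend on k, so a single bound serves every step of the
      -- induction.
      B = 2 + norm a * norm b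
      lifted = coprime-lift-rough co B
      step : ∀ {q k} → Prime q → B < q → σ k a ⊛ b ≋ [] → σ (q * k) a ⊛ b ≋ []
      step {q} {k} q-prime B<q ih = A.trans (A.*-congʳ (A.sym (σ-∘ q k a)))
        (annihilator-frobenius (σ k a) b q-prime
          (subst (λ x → x * norm b < q) (sym (norm-σ k a)) (ℕ.≤-<-trans (ℕ.m≤n+m _ 2) B<q)) ih)

-- The ring ℤ[ζ]: Galois action, Fourier inversion, absence of zero divisors.

module Cyclotomic where

  open import Algebra.Bundles using (CommutativeRing)
  open import Data.Nat as ℕ using (ℕ; zero; suc; NonZero; _≤_; _<_; _!; _+_; _*_)
  import Data.Nat.Properties as ℕ
  open import Data.Nat.Divisibility
  open import Data.Nat.GCD using (gcd; gcd[m,n]∣m; gcd[m,n]∣n)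
  open import Data.Nat.Coprimality using (Coprime; coprime?; gcd≡1⇒coprime)
  open import Data.Nat.Primality using (Prime; prime?; ¬prime[0])
  import Data.Nat.Tactic.RingSolver as ℕ-Solver
  import Data.Integer.Tactic.RingSolver as ℤ-Solver
  open import Data.Integer as ℤ using (ℤ; +_; 0ℤ; 1ℤ)
  import Data.Integer.Properties as ℤ
  open import Data.List.Base using ([]; _∷_)
  import Relation.Nullary.Decidable as Dec
  open import Relation.Binary.PropositionalEquality hiding (resp; setoid)
  open Arith
  open RingTheory
  open GroupRing hiding (module A; _≋_)

  module _ (n : ℕ) .{{n≢0 : NonZero n}} where

    private module A = GroupRing.A n
    open A using (_-_; begin_; step-≈-⟩; step-≈-⟨; _∎)
    infix 4 _≋_
    _≋_ : Element → Element → Set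
    _≋_ = GroupRing._≋_ n

    1-X : ℕ → Element
    1-X i = X 0 - X i

    1-X-multiple : ∀ {i j} m → j ∼ m * i [ n ] → ∃[ g ] (1-X j ≋ 1-X i ⊛ g)
    1-X-multiple {i} {j} m j∼mi = A.geo A.1# (X i) m , (begin
      X 0 - X j                              ≈⟨ A.+-congˡ (A.-‿cong (A.trans (X-cong n j∼mi) (A.sym (X-^ n i m)))) ⟩
      X 0 - X i A.^ m                        ≈⟨ A.geo-1 (X i) m ⟨
      1-X i ⊛ A.geo A.1# (X i) m             ∎)

    1-X-zero : ∀ {i} → n ∣ i → 1-X i ≋ []
    1-X-zero {i} n∣i = A.trans (A.+-congˡ (A.-‿cong (X-cong n (∣⇒∼0 n∣i)))) (A.-‿inverseʳ (X 0))

    σ-1-X : ∀ k i → σ k (1-X i) ≋ 1-X (k * i)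
    σ-1-X k i = A.trans (σ-+ n k (X 0) (negate (X i))) (A.+-cong (σ-const n k 1ℤ)
      (A.trans (σ-negate n k (X i)) (A.-‿cong (σ-X n k i))))

    -- The product of 1 - x^(n/p) over the primes p ∣ n up to B.
    E[_] : ℕ → Element
    E[ zero ] = X 0
    E[ suc B ] with prime? (suc B) | suc B ∣? n
    ... | yes _ | yes (divides d _) = 1-X d ⊛ E[ B ]
    ... | _     | _                 = E[ B ]

    E-step : ∀ B → E[ suc B ] ≡ E[ B ] ⊎ ∃[ d ] (Prime (suc B) × n ≡ d * suc B × E[ suc B ] ≡ 1-X d ⊛ E[ B ])
    E-step B with prime? (suc B) | suc B ∣? n
    ... | yes p-prime | yes (divides d n≡dp) = inj₂ (d , p-prime , n≡dp , refl)
    ... | yes _       | no _                 = inj₁ refl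
    ... | no _        | _                    = inj₁ refl

    E-step-prime : ∀ {B d} → Prime (suc B) → n ≡ d * suc B → E[ suc B ] ≡ 1-X d ⊛ E[ B ]
    E-step-prime {B} {d} p-prime n≡dp with prime? (suc B) | suc B ∣? n
    ... | yes _ | yes (divides d′ n≡d′p) = cong (λ d → 1-X d ⊛ E[ B ]) (ℕ.*-cancelʳ-≡ d′ d (suc B) (trans (sym n≡d′p) n≡dp))
    ... | yes _ | no ∤ = ⊥-elim (∤ (divides d n≡dp))
    ... | no ¬p | _ = ⊥-elim (¬p p-prime)

    E-factor : ∀ {p d} B → Prime p → n ≡ d * p → p ≤ B → ∃[ g ] (E[ B ] ≋ 1-X d ⊛ g)
    E-factor zero p-prime n≡dp ℕ.z≤n = ⊥-elim (¬prime[0] p-prime)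
    E-factor {p} {d} (suc B) p-prime n≡dp p≤ = decide (p ℕ.≟ suc B)
      where
      swap : ∀ x y z → x ⊛ (y ⊛ z) ≋ y ⊛ (x ⊛ z)
      swap = A.solve 3 (λ x y z → x A.:* (y A.:* z) A.:= y A.:* (x A.:* z)) A.refl
      keep : ∃[ g ] (E[ B ] ≋ 1-X d ⊛ g) →
             E[ suc B ] ≡ E[ B ] ⊎ ∃[ d′ ] (Prime (suc B) × n ≡ d′ * suc B × E[ suc B ] ≡ 1-X d′ ⊛ E[ B ]) →
             ∃[ g ] (E[ suc B ] ≋ 1-X d ⊛ g)
      keep (g , e) (inj₁ same) = g , A.trans (A.reflexive same) e
      keep (g , e) (inj₂ (d′ , _ , _ , new)) =
        1-X d′ ⊛ g , A.trans (A.reflexive new) (A.trans (A.*-congˡ e) (swap (1-X d′) (1-X d) g))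
      decide : Dec (p ≡ suc B) → ∃[ g ] (E[ suc B ] ≋ 1-X d ⊛ g)
      decide (yes refl) = E[ B ] , A.reflexive (E-step-prime p-prime n≡dp)
      decide (no p≢) = keep (E-factor {p} {d} B p-prime n≡dp (ℕ.≤-pred (ℕ.≤∧≢⇒< p≤ p≢))) (E-step B)

    coef-1-X : ∀ m d a → coef n m (1-X d ⊛ a) ≡ coef n m a ℤ.+ (ℤ.- coef n (m + ℕ.pred n * d) a)
    coef-1-X m d a = trans (coef-cong n m (begin
        1-X d ⊛ a                      ≈⟨ A.distribʳ a (X 0) (negate (X d)) ⟩
        X 0 ⊛ a ⊕ negate (X d) ⊛ a    ≈⟨ A.+-cong (A.*-identityˡ a) (A.sym (A.-‿distribˡ-* (X d) a)) ⟩
        a ⊕ negate (X d ⊛ a)          ∎))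
      (trans (∫-⊕ a (negate (X d ⊛ a)) (δ n m))
        (cong (λ x → coef n m a ℤ.+ x) (trans (∫-negate (X d ⊛ a) (δ n m))
          (cong ℤ.-_ (trans (coef-∼ n back (X d ⊛ a)) (coef-shift n (m + ℕ.pred n * d) d a))))))
      where
      back : m ∼ d + (m + ℕ.pred n * d) [ n ]
      back = ∼-sym (subst (_∼ m [ n ]) eq (∼+d d))
        where
        eq : m + d * n ≡ d + (m + ℕ.pred n * d)
        eq = trans (cong (λ x → m + d * x) (sym (ℕ.suc-pred n))) (rearrange m d (ℕ.pred n))
          where
          open import Data.Nat.Tactic.RingSolver using (solve-∀)
          rearrange : ∀ m d r → m + d * suc r ≡ d + (m + r * d)
          rearrange = solve-∀

    -- Every exponent occurring in `E[ B ]` is, modulo n, a sum of numbers n/p with primes p ≤ B,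
    -- and B ! clears all these denominators.
    E-support : ∀ B m → coef n m E[ B ] ≢ 0ℤ → n ∣ B ! * m
    E-support zero m ≢0 = decide (m ∼? 0 [ n ])
      where
      decide : Dec (m ∼ 0 [ n ]) → n ∣ 1 * m
      decide (yes m∼0) = subst (n ∣_) (sym (ℕ.*-identityˡ m)) (∼0⇒∣ m∼0)
      decide (no m≁0) = ⊥-elim (≢0 (trans (∫-X 0 (δ n m)) (δ-no n {m} {0} (λ e → m≁0 (∼-sym e)))))
    E-support (suc B) m ≢0 = step (E-step B)
      where
      rearrange : ∀ p f m r d → p * (f * (m + r * d)) ≡ f * r * (d * p) + p * f * m
      rearrange = ℕ-Solver.solve-∀
      old : coef n m E[ B ] ≢ 0ℤ → n ∣ suc B ! * m
      old ≢0 = subst (n ∣_) (sym (ℕ.*-assoc (suc B) (B !) m)) (∣n⇒∣m*n (suc B) (E-support B m ≢0))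
      step : E[ suc B ] ≡ E[ B ] ⊎ ∃[ d ] (Prime (suc B) × n ≡ d * suc B × E[ suc B ] ≡ 1-X d ⊛ E[ B ]) →
             n ∣ suc B ! * m
      step (inj₁ same) = old λ ≡0 → ≢0 (trans (cong (coef n m) same) ≡0)
      step (inj₂ (d , _ , n≡dp , new)) = decide (coef n m E[ B ] ℤ.≟ 0ℤ)
        where
        decide : Dec (coef n m E[ B ] ≡ 0ℤ) → n ∣ suc B ! * m
        decide (no ≢0′) = old ≢0′
        decide (yes ≡0) = ∣m+n∣m⇒∣n (subst (n ∣_) (rearrange (suc B) (B !) m (ℕ.pred n) d)
              (∣n⇒∣m*n (suc B) (E-support B (m + ℕ.pred n * d) λ ≡0′ →
                ≢0 (trans (cong (coef n m) new) (trans (coef-1-X m d E[ B ]) (cong₂ (λ x y → x ℤ.+ (ℤ.- y)) ≡0 ≡0′))))))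
              (∣n⇒∣m*n (B ! * ℕ.pred n) (subst (_∣ d * suc B) (sym n≡dp) ∣-refl))

    -- Shows that ℤ[ζ] is not the zero ring. The new factor 1 - x^d with d = n/p subtracts the
    -- coefficient at -d; by `E-support`, if that were nonzero then p = B + 1 would divide B !.
    E-coef₀ : ∀ B → coef n 0 E[ B ] ≡ 1ℤ
    E-coef₀ zero = trans (∫-X 0 (δ n 0)) (δ-yes n {0} {0} ∼-refl)
    E-coef₀ (suc B) = step (E-step B)
      where
      rearrange : ∀ f r d → f * d * suc r ≡ f * (r * d) + f * d
      rearrange = ℕ-Solver.solve-∀
      step : E[ suc B ] ≡ E[ B ] ⊎ ∃[ d ] (Prime (suc B) × n ≡ d * suc B × E[ suc B ] ≡ 1-X d ⊛ E[ B ]) →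
             coef n 0 E[ suc B ] ≡ 1ℤ
      step (inj₁ same) = trans (cong (coef n 0) same) (E-coef₀ B)
      step (inj₂ (d , p-prime , n≡dp , new)) = trans (cong (coef n 0) new) (decide (coef n (ℕ.pred n * d) E[ B ] ℤ.≟ 0ℤ))
        where
        instance
          d≢0 : NonZero d
          d≢0 = ℕ.m*n≢0⇒m≢0 d {{subst NonZero n≡dp (ℕ.≢-nonZero (ℕ.≢-nonZero⁻¹ n))}}
        decide : Dec (coef n (ℕ.pred n * d) E[ B ] ≡ 0ℤ) → coef n 0 (1-X d ⊛ E[ B ]) ≡ 1ℤ
        decide (yes ≡0) = trans (coef-1-X 0 d E[ B ]) (cong₂ (λ x y → x ℤ.+ (ℤ.- y)) (E-coef₀ B) ≡0)
        decide (no ≢0) = ⊥-elim (ℕ.1+n≰n (prime∣!⇒≤ p-prime B p∣B!))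
          where
          n∣B!d : n ∣ B ! * d
          n∣B!d = ∣m+n∣m⇒∣n (subst (n ∣_)
            (trans (cong (λ x → B ! * d * x) (sym (ℕ.suc-pred n))) (rearrange (B !) (ℕ.pred n) d))
            (n∣m*n (B ! * d))) (E-support B (ℕ.pred n * d) ≢0)
          p∣B! : suc B ∣ B !
          p∣B! = *-cancelˡ-∣ d (subst₂ _∣_ n≡dp (ℕ.*-comm (B !) d) n∣B!d)

    E : Element
    E = E[ n ]

    -- ℤ[x]/(xⁿ - 1) modulo the annihilator of E is the ring of integers ℤ[ζ] of the n-th cyclotomic field.
    open A.AnnihilatorQuotient E public using (_≈ₑ_; mk; scaled; ≈⇒≈ₑ) renaming (quotientₑ to cyclotomicRing)

    module Z where
      open CommutativeRing cyclotomicRing public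
      open CommutativeRingLemmas cyclotomicRing public
      open import Relation.Binary.Reasoning.Setoid setoid public

    ≈ₑ0 : ∀ {a} → E ⊛ a ≋ [] → a ≈ₑ []
    ≈ₑ0 e = mk (A.trans e (A.sym (A.zeroʳ E)))

    ≈ₑ0⁻¹ : ∀ {a} → a ≈ₑ [] → E ⊛ a ≋ []
    ≈ₑ0⁻¹ e = A.trans (scaled e) (A.zeroʳ E)

    _≈ₑ?_ : ∀ a b → Dec (a ≈ₑ b)
    a ≈ₑ? b = Dec.map′ (λ e → Z.x∙y⁻¹≈ε⇒x≈y a b (≈ₑ0 e)) (λ e → ≈ₑ0⁻¹ (Z.x≈y⇒x∙y⁻¹≈ε e)) (zero? n (E ⊛ (a - b)))

    -- As k is a unit, x^d is a power of x^(kd), so 1 - x^(kd) divides 1 - x^d. The consequence is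
    -- that `σ k` respects the annihilator of `E` and acts on ℤ[ζ].
    σE-divides : ∀ {k} → Coprime k n → ∀ B → ∃[ g ] (E[ B ] ≋ g ⊛ σ k E[ B ])
    σE-divides {k} co zero = X 0 , A.sym (A.trans (A.*-identityˡ _) (σ-const n k 1ℤ))
    σE-divides {k} co (suc B) = step (σE-divides {k} co B) (E-step B)
      where
      k′ = proj₁ (coprime-inverse k n co)
      rearrange : ∀ k k′ d → k * k′ * d ≡ k′ * (k * d)
      rearrange = ℕ-Solver.solve-∀
      lemma : ∀ x h g s → (x ⊛ h) ⊛ (g ⊛ s) ≋ (h ⊛ g) ⊛ (x ⊛ s)
      lemma = A.solve 4 (λ x h g s → (x A.:* h) A.:* (g A.:* s) A.:= (h A.:* g) A.:* (x A.:* s)) A.refl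
      step : ∃[ g ] (E[ B ] ≋ g ⊛ σ k E[ B ]) →
             E[ suc B ] ≡ E[ B ] ⊎ ∃[ d ] (Prime (suc B) × n ≡ d * suc B × E[ suc B ] ≡ 1-X d ⊛ E[ B ]) →
             ∃[ g ] (E[ suc B ] ≋ g ⊛ σ k E[ suc B ])
      step (g , e) (inj₁ same) = g , subst (λ x → x ≋ g ⊛ σ k x) (sym same) e
      step (g , e) (inj₂ (d , _ , _ , new)) = h ⊛ g , subst (λ x → x ≋ h ⊛ g ⊛ σ k x) (sym new) (begin
        1-X d ⊛ E[ B ]                             ≈⟨ A.*-cong (proj₂ multiple) e ⟩
        (1-X (k * d) ⊛ h) ⊛ (g ⊛ σ k E[ B ])     ≈⟨ lemma (1-X (k * d)) h g (σ k E[ B ]) ⟩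
        (h ⊛ g) ⊛ (1-X (k * d) ⊛ σ k E[ B ])     ≈⟨ A.*-congˡ (A.*-congʳ (σ-1-X k d)) ⟨
        (h ⊛ g) ⊛ (σ k (1-X d) ⊛ σ k E[ B ])       ≈⟨ A.*-congˡ (σ-* n k (1-X d) E[ B ]) ⟨
        (h ⊛ g) ⊛ σ k (1-X d ⊛ E[ B ])             ∎)
        where
        d∼ : d ∼ k′ * (k * d) [ n ]
        d∼ = ∼-trans (∼-reflexive (sym (ℕ.*-identityˡ d)))
          (∼-trans (∼-*ʳ d (∼-sym (proj₂ (coprime-inverse k n co)))) (∼-reflexive (rearrange k k′ d)))
        multiple = 1-X-multiple {k * d} {d} k′ d∼
        h = proj₁ multiple

    σ-≈ₑ : ∀ {k a b} → Coprime k n → a ≈ₑ b → σ k a ≈ₑ σ k b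
    σ-≈ₑ {k} {a} {b} co e = mk (begin
      E ⊛ σ k a            ≈⟨ A.*-congʳ eg ⟩
      g ⊛ σ k E ⊛ σ k a    ≈⟨ A.*-assoc g _ _ ⟩
      g ⊛ (σ k E ⊛ σ k a)  ≈⟨ A.*-congˡ (σ-* n k E a) ⟨
      g ⊛ σ k (E ⊛ a)      ≈⟨ A.*-congˡ (σ-cong n k (scaled e)) ⟩
      g ⊛ σ k (E ⊛ b)      ≈⟨ A.*-congˡ (σ-* n k E b) ⟩
      g ⊛ (σ k E ⊛ σ k b)  ≈⟨ A.*-assoc g _ _ ⟨
      g ⊛ σ k E ⊛ σ k b    ≈⟨ A.*-congʳ eg ⟨
      E ⊛ σ k b            ∎)
      where
      g = proj₁ (σE-divides {k} co n)
      eg = proj₂ (σE-divides {k} co n)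

    -- If a prime p divides both j and n, then `σ j` sends the factor 1 - x^(n/p) to 1 - x^(jn/p) =
    -- 0.
    σE-vanishes : ∀ {j} → ¬ Coprime j n → σ j E ≋ []
    σE-vanishes {j} ¬co = vanish (∃-prime-divisor (gcd j n) (λ g≡1 → ¬co (gcd≡1⇒coprime g≡1)))
      where
      rearrange : ∀ i p d → i * (d * p) ≡ i * p * d
      rearrange = ℕ-Solver.solve-∀
      by-factor : ∀ {d} → n ∣ j * d → ∃[ g ] (E ≋ 1-X d ⊛ g) → σ j E ≋ []
      by-factor {d} n∣jd (g , e) = begin
        σ j E                          ≈⟨ σ-cong n j e ⟩
        σ j (1-X d ⊛ g)                ≈⟨ σ-* n j (1-X d) g ⟩
        σ j (1-X d) ⊛ σ j g            ≈⟨ A.*-congʳ (σ-1-X j d) ⟩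
        1-X (j * d) ⊛ σ j g          ≈⟨ A.*-congʳ (1-X-zero n∣jd) ⟩
        [] ⊛ σ j g                     ≈⟨ A.zeroˡ (σ j g) ⟩
        []                             ∎
      vanish : ∃[ p ] (Prime p × p ∣ gcd j n) → σ j E ≋ []
      vanish (p , p-prime , p∣g) = by-divisors (∣-trans p∣g (gcd[m,n]∣m j n)) (∣-trans p∣g (gcd[m,n]∣n j n))
        where
        by-divisors : p ∣ j → p ∣ n → σ j E ≋ []
        by-divisors (divides i j≡ip) p∣n@(divides d n≡dp) = by-factor {d}
          (divides i (trans (cong (_* d) j≡ip) (trans (sym (rearrange i p d)) (cong (i *_) (sym n≡dp)))))
          (E-factor {p} {d} n p-prime n≡dp (∣⇒≤ p∣n))

    -- Some prime p divides n / gcd j n; then 1 - xʲ divides 1 - x^(n/p), which divides `E`. So the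
    -- square of E a is a multiple of E (1 - xʲ) a = 0, and the group ring has no nilpotents.
    1-X-regular : ∀ {j a} → ¬ n ∣ j → 1-X j ⊛ a ≈ₑ [] → a ≈ₑ []
    1-X-regular {j} {a} n∤j e = by-gcd (gcd[m,n]∣n j n)
      where
      lemma : ∀ ug a y h g → (ug ⊛ a) ⊛ (y ⊛ h ⊛ g ⊛ a) ≋ (ug ⊛ (y ⊛ a)) ⊛ (h ⊛ g ⊛ a)
      lemma = A.solve 5 (λ ug a y h g → (ug A.:* a) A.:* (y A.:* h A.:* g A.:* a) A.:=
                                        (ug A.:* (y A.:* a)) A.:* (h A.:* g A.:* a)) A.refl
      by-factors : ∀ {c} → ∃[ g ] (E ≋ 1-X c ⊛ g) → ∃[ h ] (1-X c ≋ 1-X j ⊛ h) → a ≈ₑ []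
      by-factors {c} (g , eg) (h , eh) = ≈ₑ0 (A.trans (A.*-congʳ eg) (reduced n ((1-X c ⊛ g) ⊛ a) (begin
        (1-X c ⊛ g ⊛ a) ⊛ (1-X c ⊛ g ⊛ a)            ≈⟨ A.*-congˡ (A.*-congʳ (A.*-congʳ eh)) ⟩
        (1-X c ⊛ g ⊛ a) ⊛ (1-X j ⊛ h ⊛ g ⊛ a)        ≈⟨ lemma (1-X c ⊛ g) a (1-X j) h g ⟩
        ((1-X c ⊛ g) ⊛ (1-X j ⊛ a)) ⊛ (h ⊛ g ⊛ a)    ≈⟨ A.*-congʳ (A.trans (A.*-congʳ (A.sym eg)) (≈ₑ0⁻¹ e)) ⟩
        [] ⊛ (h ⊛ g ⊛ a)                             ≈⟨ A.zeroˡ (h ⊛ g ⊛ a) ⟩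
        []                                           ∎)))
      rearrange : ∀ d′ p g → d′ * p * g ≡ d′ * g * p
      rearrange = ℕ-Solver.solve-∀
      rearrange′ : ∀ d′ j x → d′ * (j * x) ≡ d′ * x * j
      rearrange′ = ℕ-Solver.solve-∀
      by-prime : ∀ {d} → n ≡ d * gcd j n → ∃[ p ] (Prime p × p ∣ d) → a ≈ₑ []
      by-prime n≡dg (p , p-prime , divides d′ d≡d′p) = by-factors {d′ * gcd j n}
        (E-factor {p} n p-prime n≡cp (∣⇒≤ (divides (d′ * gcd j n) n≡cp)))
        (1-X-multiple (d′ * x) (∼-trans (∼-*ˡ d′ (∼-sym (proj₂ (bézout j n)))) (∼-reflexive (rearrange′ d′ j x))))
        where
        x = proj₁ (bézout j n)
        n≡cp : n ≡ d′ * gcd j n * p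
        n≡cp = trans n≡dg (trans (cong (_* gcd j n) d≡d′p) (rearrange d′ p (gcd j n)))
      by-gcd : gcd j n ∣ n → a ≈ₑ []
      by-gcd (divides d n≡dg) = by-prime n≡dg (∃-prime-divisor d (λ d≡1 → n∤j
        (subst (_∣ j) (sym (trans n≡dg (trans (cong (_* gcd j n) d≡1) (ℕ.*-identityˡ _)))) (gcd[m,n]∣m j n))))

    const-regular : ∀ {c a} → c ≢ 0ℤ → const c ⊛ a ≈ₑ [] → a ≈ₑ []
    const-regular {c} {a} c≢0 e = ≈ₑ0 (coefs⇒≋ n λ m →
      cancel (trans (sym (∫-const-⊛ n c (E ⊛ a) (δ n m))) (coef-cong n m (A.trans (swap (const c) E a) (≈ₑ0⁻¹ e)))))
      where
      swap : ∀ c e a → c ⊛ (e ⊛ a) ≋ e ⊛ (c ⊛ a)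
      swap = A.solve 3 (λ c e a → c A.:* (e A.:* a) A.:= e A.:* (c A.:* a)) A.refl
      cancel : ∀ {z} → c ℤ.* z ≡ 0ℤ → z ≡ 0ℤ
      cancel {z} cz≡0 with ℤ.i*j≡0⇒i≡0∨j≡0 c cz≡0
      ... | inj₁ c≡0 = ⊥-elim (c≢0 c≡0)
      ... | inj₂ z≡0 = z≡0

    1≉0 : ¬ X 0 ≈ₑ []
    1≉0 e with () ← trans (sym (E-coef₀ n)) (coef-cong n 0 (A.trans (A.sym (A.*-identityʳ E)) (≈ₑ0⁻¹ e)))

    const≈0 : ∀ {c} → const c ≈ₑ [] → c ≡ 0ℤ
    const≈0 {c} e with c ℤ.≟ 0ℤ
    ... | yes c≡0 = c≡0
    ... | no c≢0 = ⊥-elim (1≉0 (const-regular c≢0 (Z.trans (Z.*-identityʳ (const c)) e)))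

    X-^ₑ : ∀ i m → X i Z.^ m ≈ₑ X (m * i)
    X-^ₑ i zero    = Z.refl
    X-^ₑ i (suc m) = Z.trans (Z.*-congˡ {X i} (X-^ₑ i m)) (≈⇒≈ₑ (A.sym (X-+ n i (m * i))))

    X-congₑ : ∀ {i j} → i ∼ j [ n ] → X i ≈ₑ X j
    X-congₑ i∼j = ≈⇒≈ₑ (X-cong n i∼j)

    Σ-roots : ∀ {i} d → ¬ n ∣ i → n ∣ d * i → Z.Σ< d (λ j → X (j * i)) ≈ₑ []
    Σ-roots {i} d n∤i n∣di = 1-X-regular n∤i (Z.begin
      1-X i ⊛ Z.Σ< d (λ j → X (j * i))     Z.≈⟨ Z.*-congˡ {1-X i} (Z.Σ-cong d (λ {j} _ → X-^ₑ i j)) ⟨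
      1-X i ⊛ Z.Σ< d (X i Z.^_)              Z.≈⟨ Z.*-congˡ {1-X i} (Z.geo-as-Σ (X i) d) ⟨
      1-X i ⊛ Z.geo Z.1# (X i) d             Z.≈⟨ Z.geo-1 (X i) d ⟩
      X 0 - X i Z.^ d                        Z.≈⟨ Z.+-congˡ {X 0} (Z.-‿cong (X-^ₑ i d)) ⟩
      1-X (d * i)                          Z.≈⟨ ≈⇒≈ₑ (1-X-zero n∣di) ⟩
      []                                     Z.∎)

    const-* : ∀ c d → const c ⊛ const d ≋ const (c ℤ.* d)
    const-* c d = A.reflexive (monomial-⊛ c 0 d 0)

    const-·ₑ : ∀ k c → k Z.· const c ≈ₑ const (+ k ℤ.* c)
    const-·ₑ zero    c = ≈⇒≈ₑ (A.sym (const-0 n))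
    const-·ₑ (suc k) c = Z.trans (Z.+-congˡ {const c} (const-·ₑ k c))
      (≈⇒≈ₑ (A.trans (A.sym (const-+ n c (+ k ℤ.* c))) (A.reflexive (cong const (sym (ℤ.suc-* (+ k) c))))))

    -- Orthogonality of characters. The sum runs over all j modulo n, units or not, so exactly the
    -- exponents divisible by n survive.
    trace : ∀ a → Z.Σ< n (λ j → σ j a) ≈ₑ const (+ n ℤ.* coef n 0 a)
    trace [] = Z.trans (Z.Σ-zero n (λ {j} _ → Z.reflexive (σ-[] j))) (≈⇒≈ₑ (A.trans (A.sym (const-0 n)) (A.reflexive (cong const (sym (ℤ.*-zeroʳ (+ n)))))))
    trace ((c , i) ∷ a) = Z.begin
      Z.Σ< n (λ j → σ j ((c , i) ∷ a))
        Z.≈⟨ Z.Σ-cong n (λ {j} _ → ≈⇒≈ₑ (A.trans (A.reflexive (σ-∷ j c i a)) (cons-split n c (j * i) (σ j a)))) ⟩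
      Z.Σ< n (λ j → const c ⊛ X (j * i) ⊕ σ j a)
        Z.≈⟨ Z.Σ-+ n (λ j → const c ⊛ X (j * i)) (λ j → σ j a) ⟩
      Z.Σ< n (λ j → const c ⊛ X (j * i)) ⊕ Z.Σ< n (λ j → σ j a)
        Z.≈⟨ Z.+-cong (Z.trans (Z.sym (Z.Σ-*ˡ n (const c) (λ j → X (j * i)))) (Z.*-congˡ {const c} roots)) (trace a) ⟩
      const c ⊛ const (+ n ℤ.* δ n 0 i) ⊕ const (+ n ℤ.* coef n 0 a)
        Z.≈⟨ ≈⇒≈ₑ (A.trans (A.+-congʳ (const-* c (+ n ℤ.* δ n 0 i))) (A.sym (const-+ n _ _))) ⟩
      const (c ℤ.* (+ n ℤ.* δ n 0 i) ℤ.+ + n ℤ.* coef n 0 a)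
        Z.≈⟨ Z.reflexive (cong const (rearrange c (+ n) (δ n 0 i) (coef n 0 a))) ⟩
      const (+ n ℤ.* (c ℤ.* δ n 0 i ℤ.+ coef n 0 a)) Z.∎
      where
      rearrange : ∀ c n d x → c ℤ.* (n ℤ.* d) ℤ.+ n ℤ.* x ≡ n ℤ.* (c ℤ.* d ℤ.+ x)
      rearrange = ℤ-Solver.solve-∀
      decide : Dec (i ∼ 0 [ n ]) → Z.Σ< n (λ j → X (j * i)) ≈ₑ const (+ n ℤ.* δ n 0 i)
      decide (yes i∼0) = Z.begin
        Z.Σ< n (λ j → X (j * i))      Z.≈⟨ Z.Σ-cong n (λ {j} _ → X-congₑ {j * i} {0} (∣⇒∼0 (∣n⇒∣m*n j (∼0⇒∣ i∼0)))) ⟩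
        Z.Σ< n (λ _ → X 0)              Z.≈⟨ Z.Σ-const n (X 0) ⟩
        n Z.· X 0                       Z.≈⟨ const-·ₑ n 1ℤ ⟩
        const (+ n ℤ.* 1ℤ)              Z.≈⟨ Z.reflexive (cong (λ z → const (+ n ℤ.* z)) (sym (δ-yes n {0} {i} i∼0))) ⟩
        const (+ n ℤ.* δ n 0 i)         Z.∎
      decide (no i≁0) = Z.begin
        Z.Σ< n (λ j → X (j * i))      Z.≈⟨ Σ-roots n (λ n∣i → i≁0 (∣⇒∼0 n∣i)) (m∣m*n i) ⟩
        []                              Z.≈⟨ ≈⇒≈ₑ (A.sym (const-0 n)) ⟩
        const 0ℤ                        Z.≈⟨ Z.reflexive (cong const (sym (ℤ.*-zeroʳ (+ n)))) ⟩
        const (+ n ℤ.* 0ℤ)              Z.≈⟨ Z.reflexive (cong (λ z → const (+ n ℤ.* z)) (sym (δ-no n {0} {i} i≁0))) ⟩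
        const (+ n ℤ.* δ n 0 i)         Z.∎
      roots = decide (i ∼? 0 [ n ])

    -- Multiplication by x^(-m), through which `trace` reads off an arbitrary coefficient.
    rotate : ℕ → Element → Element
    rotate m a = X (ℕ.pred n * m) ⊛ a

    coef-rotate : ∀ m a → coef n 0 (rotate m a) ≡ coef n m a
    coef-rotate m a = trans (coef-∼ n (∼-sym back) (rotate m a)) (coef-shift n m (ℕ.pred n * m) a)
      where
      back : ℕ.pred n * m + m ∼ 0 [ n ]
      back = ∣⇒∼0 (subst (n ∣_) (trans (cong (_* m) (sym (ℕ.suc-pred n))) (ℕ.+-comm m _)) (m∣m*n m))

    n*c≢0 : ∀ {c} → c ≢ 0ℤ → + n ℤ.* c ≢ 0ℤ
    n*c≢0 c≢0 e with ℤ.i*j≡0⇒i≡0∨j≡0 (+ n) e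
    ... | inj₁ n≡0 = ⊥-elim (ℕ.≢-nonZero⁻¹ n (ℤ.+-injective n≡0))
    ... | inj₂ c≡0 = c≢0 c≡0

    -- Fourier inversion writes n times each coefficient as a combination of the `σ j y`, and a
    -- nonzero integer stays nonzero in ℤ[ζ]. This leads from identities in ℤ[ζ] back to the group
    -- ring.
    fourier-injective : ∀ {y} → (∀ k → σ k y ≈ₑ []) → y ≋ []
    fourier-injective {y} h = decide (zero-or-coef n y)
      where
      vanish : ∀ m j → σ j (rotate m y) ≈ₑ []
      vanish m j = Z.begin
        σ j (rotate m y)                                Z.≈⟨ ≈⇒≈ₑ (σ-* n j (X (ℕ.pred n * m)) y) ⟩
        σ j (X (ℕ.pred n * m)) ⊛ σ j y                Z.≈⟨ Z.*-congˡ {σ j (X (ℕ.pred n * m))} (h j) ⟩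
        σ j (X (ℕ.pred n * m)) ⊛ []                   Z.≈⟨ Z.zeroʳ _ ⟩
        []                                              Z.∎
      n*coef≈0 : ∀ m → const (+ n ℤ.* coef n m y) ≈ₑ []
      n*coef≈0 m = Z.begin
        const (+ n ℤ.* coef n m y)                      Z.≈⟨ Z.reflexive (cong (λ c → const (+ n ℤ.* c)) (sym (coef-rotate m y))) ⟩
        const (+ n ℤ.* coef n 0 (rotate m y))           Z.≈⟨ trace (rotate m y) ⟨
        Z.Σ< n (λ j → σ j (rotate m y))                 Z.≈⟨ Z.Σ-zero n (λ {j} _ → vanish m j) ⟩
        []                                              Z.∎
      decide : y ≋ [] ⊎ ∃[ m ] coef n m y ≢ 0ℤ → y ≋ []
      decide (inj₁ y≋0) = y≋0
      decide (inj₂ (m , ≢0)) = ⊥-elim (n*c≢0 ≢0 (const≈0 (n*coef≈0 m)))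

    -- If coefficient m of v = E w is nonzero, then n v_m = Σ_j ζ^(-jm) σ_j(v) and every σ_j(v) annihilates z:
    -- for j prime to n by Galois invariance, otherwise because σ_j(E) = 0.
    zero-product : ∀ {w z} → w ⊛ z ≈ₑ [] → w ≈ₑ [] ⊎ z ≈ₑ []
    zero-product {w} {z} wz≈0 = decide (zero-or-coef n v)
      where
      v = E ⊛ w
      σv-annihilates : ∀ j → Dec (Coprime j n) → σ j v ⊛ z ≋ []
      σv-annihilates j (yes co) = annihilator-σ n v z co (A.trans (A.*-assoc E w z) (≈ₑ0⁻¹ wz≈0))
      σv-annihilates j (no ¬co) = begin
        σ j v ⊛ z              ≈⟨ A.*-congʳ (σ-* n j E w) ⟩
        (σ j E ⊛ σ j w) ⊛ z    ≈⟨ A.*-congʳ (A.*-congʳ (σE-vanishes ¬co)) ⟩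
        ([] ⊛ σ j w) ⊛ z       ≈⟨ A.*-congʳ (A.zeroˡ (σ j w)) ⟩
        [] ⊛ z                 ≈⟨ A.zeroˡ z ⟩
        []                     ∎
      conjugate : ∀ m j → σ j (rotate m v) ⊛ z ≋ []
      conjugate m j = begin
        σ j (rotate m v) ⊛ z                            ≈⟨ A.*-congʳ (σ-* n j (X (ℕ.pred n * m)) v) ⟩
        σ j (X (ℕ.pred n * m)) ⊛ σ j v ⊛ z            ≈⟨ A.*-assoc (σ j (X (ℕ.pred n * m))) (σ j v) z ⟩
        σ j (X (ℕ.pred n * m)) ⊛ (σ j v ⊛ z)          ≈⟨ A.*-congˡ (σv-annihilates j (coprime? j n)) ⟩
        σ j (X (ℕ.pred n * m)) ⊛ []                   ≈⟨ A.zeroʳ _ ⟩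
        []                                              ∎
      n*coef-annihilates : ∀ m → const (+ n ℤ.* coef n m v) ⊛ z ≈ₑ []
      n*coef-annihilates m = Z.begin
        const (+ n ℤ.* coef n m v) ⊛ z                  Z.≈⟨ Z.*-congʳ {z} (Z.reflexive (cong (λ c → const (+ n ℤ.* c)) (sym (coef-rotate m v)))) ⟩
        const (+ n ℤ.* coef n 0 (rotate m v)) ⊛ z       Z.≈⟨ Z.*-congʳ {z} (trace (rotate m v)) ⟨
        Z.Σ< n (λ j → σ j (rotate m v)) ⊛ z             Z.≈⟨ Z.Σ-*ʳ n z (λ j → σ j (rotate m v)) ⟩
        Z.Σ< n (λ j → σ j (rotate m v) ⊛ z)             Z.≈⟨ Z.Σ-zero n (λ {j} _ → ≈⇒≈ₑ (conjugate m j)) ⟩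
        []                                              Z.∎
      decide : v ≋ [] ⊎ ∃[ m ] coef n m v ≢ 0ℤ → w ≈ₑ [] ⊎ z ≈ₑ []
      decide (inj₁ v≋0) = inj₁ (≈ₑ0 v≋0)
      decide (inj₂ (m , ≢0)) = inj₂ (const-regular (n*c≢0 ≢0) (n*coef-annihilates m))

    module ZD = Z.Domain zero-product

    -- Equality in ℤ[ζ] becomes equality in the group ring only after multiplication by `E`, hence
    -- the bound on E a instead of a.
    large-multipleₑ : ∀ {a c} q → norm (E ⊛ a) < q → a ≈ₑ const (+ q) ⊛ c → a ≈ₑ []
    large-multipleₑ {a} {c} q bound e = ≈ₑ0 (large-multiple n {E ⊛ a} {E ⊛ c} q bound
      (A.trans (scaled e) (swap E (const (+ q)) c)))
      where
      swap : ∀ e k c → e ⊛ (k ⊛ c) ≋ k ⊛ (e ⊛ c)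
      swap = A.solve 3 (λ e k c → e A.:* (k A.:* c) A.:= k A.:* (e A.:* c)) A.refl

    -- Otherwise 1 - ζ^(j-i) would be both zero and regular; `k` represents -i.
    X-injective : ∀ {i j} → X i ≈ₑ X j → i ∼ j [ n ]
    X-injective {i} {j} e = decide (n ∣? j + k)
      where
      k = ℕ.pred n * i
      n∣i+k : n ∣ i + k
      n∣i+k = subst (n ∣_) (cong (_* i) (sym (ℕ.suc-pred n))) (m∣m*n i)
      shifted-equal : X (i + k) ≈ₑ X (j + k)
      shifted-equal = Z.begin
        X (i + k)      Z.≈⟨ ≈⇒≈ₑ (X-+ n i k) ⟩
        X i ⊛ X k        Z.≈⟨ Z.*-congʳ {X k} e ⟩
        X j ⊛ X k        Z.≈⟨ ≈⇒≈ₑ (X-+ n j k) ⟨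
        X (j + k)      Z.∎
      decide : Dec (n ∣ j + k) → i ∼ j [ n ]
      decide (yes n∣j+k) = ∼-+-cancelʳ k (∼-trans (∣⇒∼0 n∣i+k) (∼-sym (∣⇒∼0 n∣j+k)))
      decide (no n∤j+k) = ⊥-elim (1≉0 (1-X-regular n∤j+k (Z.begin
        1-X (j + k) ⊛ X 0      Z.≈⟨ Z.*-identityʳ (1-X (j + k)) ⟩
        X 0 - X (j + k)        Z.≈⟨ Z.+-congˡ {X 0} (Z.-‿cong shifted-equal) ⟨
        1-X (i + k)            Z.≈⟨ ≈⇒≈ₑ (1-X-zero n∣i+k) ⟩
        []                       Z.∎)))

    coprime-pred : Coprime (ℕ.pred n) n
    coprime-pred {d} (d∣n-1 , d∣n) = ∣1⇒≡1 (∣m+n∣m⇒∣n (subst (d ∣_) (trans (sym (ℕ.suc-pred n)) (ℕ.+-comm 1 (ℕ.pred n))) d∣n) d∣n-1)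

    inverse-coprime : ∀ {k k′} → k * k′ ∼ 1 [ n ] → Coprime k′ n
    inverse-coprime {k} kk′∼1 (d∣k′ , d∣n) = ∣1⇒≡1 (∼⇒∣ (∼-weaken d∣n kk′∼1) (∣n⇒∣m*n k d∣k′))

    σ-∘ₑ : ∀ k l a → σ k (σ l a) ≈ₑ σ (k * l) a
    σ-∘ₑ k l a = ≈⇒≈ₑ (σ-∘ n k l a)

    σ-∼ₑ : ∀ {k l} → k ∼ l [ n ] → ∀ a → σ k a ≈ₑ σ l a
    σ-∼ₑ e a = ≈⇒≈ₑ (σ-∼ n e a)

    σ-*ₑ : ∀ k a b → σ k (a ⊛ b) ≈ₑ σ k a ⊛ σ k b
    σ-*ₑ k a b = ≈⇒≈ₑ (σ-* n k a b)

    σ-1ₑ : ∀ a → σ 1 a ≈ₑ a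
    σ-1ₑ a = ≈⇒≈ₑ (σ-1 n a)

    σ-^ₑ : ∀ k a m → σ k (a Z.^ m) ≈ₑ σ k a Z.^ m
    σ-^ₑ k a zero    = ≈⇒≈ₑ (σ-const n k 1ℤ)
    σ-^ₑ k a (suc m) = Z.trans (σ-*ₑ k a (a Z.^ m)) (Z.*-congˡ {σ k a} (σ-^ₑ k a m))

    σ-inverse : ∀ {k k′} → k * k′ ∼ 1 [ n ] → ∀ a → σ k′ (σ k a) ≈ₑ a
    σ-inverse {k} {k′} kk′∼1 a = Z.trans (σ-∘ₑ k′ k a)
      (Z.trans (σ-∼ₑ (subst (_∼ 1 [ n ]) (ℕ.*-comm k k′) kk′∼1) a) (σ-1ₑ a))

    σ-≉0 : ∀ {k a} → Coprime k n → ¬ a ≈ₑ [] → ¬ σ k a ≈ₑ []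
    σ-≉0 {k} {a} co a≉0 e = a≉0 (Z.begin
      a                Z.≈⟨ σ-inverse kk′∼1 a ⟨
      σ k′ (σ k a)     Z.≈⟨ σ-≈ₑ (inverse-coprime {k} kk′∼1) e ⟩
      σ k′ []          Z.≈⟨ Z.reflexive (σ-[] k′) ⟩
      []               Z.∎)
      where
      k′ = proj₁ (coprime-inverse k n co)
      kk′∼1 = proj₂ (coprime-inverse k n co)

    ·≈const : ∀ k a → k Z.· a ≈ₑ const (+ k) ⊛ a
    ·≈const k a = Z.trans (Z.×-congʳ k (Z.sym (Z.*-identityˡ a))) (Z.trans (Z.sym (Z.×-assoc-* k (X 0) a))
      (Z.*-congʳ {a} (Z.trans (const-·ₑ k 1ℤ) (Z.reflexive (cong const (ℤ.*-identityʳ (+ k)))))))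

    ·-≉0 : ∀ k {a} → ¬ a ≈ₑ [] → ¬ suc k Z.· a ≈ₑ []
    ·-≉0 k {a} a≉0 e = a≉0 (const-regular {+ suc k} (λ ()) (Z.trans (Z.sym (·≈const (suc k) a)) e))

    ^-≉0 : ∀ {a} → ¬ a ≈ₑ [] → ∀ m → ¬ a Z.^ m ≈ₑ []
    ^-≉0 = ZD.^-≉0 1≉0

    frobeniusₑ : ∀ {q} → Prime q → ∀ a → ∃[ c ] (a Z.^ q ≈ₑ σ q a ⊕ const (+ q) ⊛ c)
    frobeniusₑ {q} q-prime a = proj₁ (frobenius n q-prime a) ,
      Z.trans (Z.reflexive (A.AnnihilatorQuotient.^ₑ≡^ E a q)) (≈⇒≈ₑ (proj₂ (frobenius n q-prime a)))

-- Quotients of Fourier coefficients that are roots of unity.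

module Phases where

  open import Algebra.Bundles using (CommutativeRing)
  open import Data.Nat as ℕ using (ℕ; zero; suc; NonZero; _≤_; _<_; _+_; _*_; _^_)
  import Data.Nat.Properties as ℕ
  open import Data.Nat.Divisibility
  open import Data.Nat.GCD using (gcd; gcd[m,n]∣m; gcd[m,n]∣n; gcd-GCD; module Bézout)
  open import Data.Nat.Coprimality using (Coprime; coprime-divisor; prime⇒coprime)
  open import Data.Nat.Primality using (Prime; prime[2]; prime⇒irreducible)
  import Data.Nat.Tactic.RingSolver as ℕ-Solver
  open import Data.Integer using (+_)
  open import Data.List.Base using ([])
  open import Relation.Binary.PropositionalEquality hiding (resp; setoid)
  open Arith
  open RingTheory
  open GroupRing
  open Cyclotomic hiding (module Z; module ZD; _≋_)

  odd⇒2-coprime : ∀ {n} → ¬ 2 ∣ n → Coprime 2 n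
  odd⇒2-coprime odd {d} (d∣2 , d∣n) with prime⇒irreducible prime[2] d∣2
  ... | inj₁ d≡1 = d≡1
  ... | inj₂ refl = ⊥-elim (odd d∣n)

  module Ratio (n : ℕ) .{{n≢0 : NonZero n}} (n-odd : ¬ 2 ∣ n) where

    private
      module Z = Cyclotomic.Z n
      module ZD = Cyclotomic.ZD n
    infix 4 _≈_
    _≈_ : Element → Element → Set
    a ≈ b = _≈ₑ_ n a b

    -- w/v behaves under σ_k like a root of unity: σ_k (w/v) = (w/v)^k.
    Rel : Element → Element → ℕ → Set
    Rel v w k = v Z.^ k ⊛ σ k w ≈ w Z.^ k ⊛ σ k v

    module _ {v w : Element} (v≉0 : ¬ v ≈ []) (w≉0 : ¬ w ≈ []) where

      rel-1 : Rel v w 1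
      rel-1 = Z.begin
        v Z.^ 1 ⊛ σ 1 w  Z.≈⟨ Z.*-cong (Z.*-identityʳ v) (σ-1ₑ n w) ⟩
        v ⊛ w            Z.≈⟨ Z.*-comm v w ⟩
        w ⊛ v            Z.≈⟨ Z.*-cong (Z.*-identityʳ w) (σ-1ₑ n v) ⟨
        w Z.^ 1 ⊛ σ 1 v  Z.∎

      -- For W = w/v this is σ_(lk) W = σ_l (Wᵏ) = (σ_l W)ᵏ = W^(lk). The denominator `Q` can be
      -- cancelled because `σ l` is invertible and w is nonzero.
      rel-* : ∀ {k l} → Coprime l n → Rel v w k → Rel v w l → Rel v w (l * k)
      rel-* {k} {l} co rel-k rel-l = ZD.*-cancelˡ Q≉0 (Z.begin
        Q ⊛ (v Z.^ (l * k) ⊛ σ (l * k) w)        Z.≈⟨ Z.*-congˡ {Q} (Z.*-cong (Z.^-assocʳ v l k) (σ-∘ₑ n l k w)) ⟨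
        Q ⊛ ((v Z.^ l) Z.^ k ⊛ S)                    Z.≈⟨ lemma₁ Q ((v Z.^ l) Z.^ k) S ⟩
        ((v Z.^ l) Z.^ k ⊛ Q) ⊛ S                    Z.≈⟨ Z.*-congʳ {S} powered ⟩
        ((w Z.^ l) Z.^ k ⊛ P) ⊛ S                    Z.≈⟨ Z.*-assoc ((w Z.^ l) Z.^ k) P S ⟩
        (w Z.^ l) Z.^ k ⊛ (P ⊛ S)                    Z.≈⟨ Z.*-congˡ {(w Z.^ l) Z.^ k} conjugated ⟩
        (w Z.^ l) Z.^ k ⊛ (Q ⊛ T)                    Z.≈⟨ lemma₂ ((w Z.^ l) Z.^ k) Q T ⟩
        Q ⊛ ((w Z.^ l) Z.^ k ⊛ T)                    Z.≈⟨ Z.*-congˡ {Q} (Z.*-cong (Z.^-assocʳ w l k) (σ-∘ₑ n l k v)) ⟩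
        Q ⊛ (w Z.^ (l * k) ⊛ σ (l * k) v)        Z.∎)
        where
        P = σ l v Z.^ k
        Q = σ l w Z.^ k
        S = σ l (σ k w)
        T = σ l (σ k v)
        Q≉0 : ¬ Q ≈ []
        Q≉0 = ^-≉0 n (σ-≉0 n co w≉0) k
        lemma₁ : ∀ q a s → q ⊛ (a ⊛ s) ≈ (a ⊛ q) ⊛ s
        lemma₁ = Z.solve 3 (λ q a s → q Z.:* (a Z.:* s) Z.:= (a Z.:* q) Z.:* s) Z.refl
        lemma₂ : ∀ a q t → a ⊛ (q ⊛ t) ≈ q ⊛ (a ⊛ t)
        lemma₂ = Z.solve 3 (λ a q t → a Z.:* (q Z.:* t) Z.:= q Z.:* (a Z.:* t)) Z.refl
        conjugated : P ⊛ S ≈ Q ⊛ T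
        conjugated = Z.begin
          P ⊛ S                          Z.≈⟨ Z.*-congʳ {S} (σ-^ₑ n l v k) ⟨
          σ l (v Z.^ k) ⊛ σ l (σ k w)    Z.≈⟨ σ-*ₑ n l (v Z.^ k) (σ k w) ⟨
          σ l (v Z.^ k ⊛ σ k w)          Z.≈⟨ σ-≈ₑ n co rel-k ⟩
          σ l (w Z.^ k ⊛ σ k v)          Z.≈⟨ σ-*ₑ n l (w Z.^ k) (σ k v) ⟩
          σ l (w Z.^ k) ⊛ σ l (σ k v)    Z.≈⟨ Z.*-congʳ {T} (σ-^ₑ n l w k) ⟩
          Q ⊛ T                          Z.∎
        powered : (v Z.^ l) Z.^ k ⊛ Q ≈ (w Z.^ l) Z.^ k ⊛ P
        powered = Z.begin
          (v Z.^ l) Z.^ k ⊛ Q            Z.≈⟨ Z.^-distrib-* (v Z.^ l) (σ l w) k ⟨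
          (v Z.^ l ⊛ σ l w) Z.^ k        Z.≈⟨ Z.^-congˡ k rel-l ⟩
          (w Z.^ l ⊛ σ l v) Z.^ k        Z.≈⟨ Z.^-distrib-* (w Z.^ l) (σ l v) k ⟩
          (w Z.^ l) Z.^ k ⊛ P            Z.∎

      rel-^ : ∀ {l} → Coprime l n → Rel v w l → ∀ s → Rel v w (l ^ s)
      rel-^ co rel-l zero    = rel-1
      rel-^ co rel-l (suc s) = rel-* co (rel-^ co rel-l s) rel-l

      -- A quotient W fixed by the automorphism satisfies W = W^(e+1), and W is nonzero.
      fixed⇒equal-powers : ∀ {e} → Rel v w (suc e) → σ (suc e) v ≈ v → σ (suc e) w ≈ w → v Z.^ e ≈ w Z.^ e
      fixed⇒equal-powers {e} rel σv≈v σw≈w = ZD.*-cancelˡ (ZD.*-≉0 v≉0 w≉0) (Z.begin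
        (v ⊛ w) ⊛ v Z.^ e        Z.≈⟨ lemma₁ v w (v Z.^ e) ⟩
        v Z.^ suc e ⊛ w          Z.≈⟨ Z.*-congˡ {v Z.^ suc e} σw≈w ⟨
        v Z.^ suc e ⊛ σ (suc e) w Z.≈⟨ rel ⟩
        w Z.^ suc e ⊛ σ (suc e) v Z.≈⟨ Z.*-congˡ {w Z.^ suc e} σv≈v ⟩
        w Z.^ suc e ⊛ v          Z.≈⟨ lemma₂ v w (w Z.^ e) ⟩
        (v ⊛ w) ⊛ w Z.^ e        Z.∎)
        where
        lemma₁ : ∀ v w a → (v ⊛ w) ⊛ a ≈ (v ⊛ a) ⊛ w
        lemma₁ = Z.solve 3 (λ v w a → (v Z.:* w) Z.:* a Z.:= (v Z.:* a) Z.:* w) Z.refl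
        lemma₂ : ∀ v w a → (w ⊛ a) ⊛ v ≈ (v ⊛ w) ⊛ a
        lemma₂ = Z.solve 3 (λ v w a → (w Z.:* a) Z.:* v Z.:= (v Z.:* w) Z.:* a) Z.refl

      equal-powers-* : ∀ {e} c → v Z.^ e ≈ w Z.^ e → v Z.^ (e * c) ≈ w Z.^ (e * c)
      equal-powers-* {e} c h = Z.trans (Z.sym (Z.^-assocʳ v e c)) (Z.trans (Z.^-congˡ c h) (Z.^-assocʳ w e c))

      equal-powers-∣ : ∀ {e e′} → e ∣ e′ → v Z.^ e ≈ w Z.^ e → v Z.^ e′ ≈ w Z.^ e′
      equal-powers-∣ {e} (divides c refl) h =
        subst (λ x → v Z.^ x ≈ w Z.^ x) (ℕ.*-comm e c) (equal-powers-* {e} c h)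

      equal-powers-∸ : ∀ {g x y} → g + x ≡ y → v Z.^ x ≈ w Z.^ x → v Z.^ y ≈ w Z.^ y → v Z.^ g ≈ w Z.^ g
      equal-powers-∸ {g} {x} refl hx hy = ZD.*-cancelˡ (^-≉0 n v≉0 x) (Z.begin
        v Z.^ x ⊛ v Z.^ g       Z.≈⟨ Z.*-comm _ (v Z.^ g) ⟩
        v Z.^ g ⊛ v Z.^ x       Z.≈⟨ Z.^-homo-* v g x ⟨
        v Z.^ (g + x)         Z.≈⟨ hy ⟩
        w Z.^ (g + x)         Z.≈⟨ Z.^-homo-* w g x ⟩
        w Z.^ g ⊛ w Z.^ x       Z.≈⟨ Z.*-congˡ {w Z.^ g} hx ⟨
        w Z.^ g ⊛ v Z.^ x       Z.≈⟨ Z.*-comm _ (v Z.^ x) ⟩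
        v Z.^ x ⊛ w Z.^ g       Z.∎)

      equal-powers-gcd : ∀ x y → v Z.^ x ≈ w Z.^ x → v Z.^ y ≈ w Z.^ y → v Z.^ gcd x y ≈ w Z.^ gcd x y
      equal-powers-gcd x y hx hy = by-identity (Bézout.identity (gcd-GCD x y))
        where
        by-identity : Bézout.Identity (gcd x y) x y → v Z.^ gcd x y ≈ w Z.^ gcd x y
        by-identity (Bézout.+- a b eq) =
          equal-powers-∸ {gcd x y} {b * y} eq (equal-powers-∣ {y} (n∣m*n b) hy) (equal-powers-∣ {x} (n∣m*n a) hx)
        by-identity (Bézout.-+ a b eq) =
          equal-powers-∸ {gcd x y} {a * x} eq (equal-powers-∣ {x} (n∣m*n a) hx) (equal-powers-∣ {y} (n∣m*n b) hy)

      private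
        2-coprime : Coprime 2 n
        2-coprime = odd⇒2-coprime n-odd

      -- Some positive power K of 2 is 1 modulo n, so `σ K` is the identity and W = W^K. Hence
      -- W^(K-1) = 1, with K - 1 odd.
      odd-order : Rel v w 2 → ∃[ m ] (¬ 2 ∣ suc m × v Z.^ suc m ≈ w Z.^ suc m)
      odd-order rel-2 = by-form (2 ^ suc s) refl
        where
        s = proj₁ (unit-power-one 2 n 2-coprime)
        2^∼1 = proj₂ (unit-power-one 2 n 2-coprime)
        by-form : ∀ K → 2 ^ suc s ≡ K → ∃[ m ] (¬ 2 ∣ suc m × v Z.^ suc m ≈ w Z.^ suc m)
        by-form 0 eq = ⊥-elim (ℕ.1+n≢0 {1} (ℕ.m^n≡0⇒m≡0 2 (suc s) eq))
        by-form 1 eq = ⊥-elim (ℕ.1+n≢0 {0} (ℕ.suc-injective (∣1⇒≡1 (subst (2 ∣_) eq (m∣m*n (2 ^ s))))))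
        by-form (suc (suc m)) eq = m
          , (λ 2∣ → ℕ.1+n≢0 {0} (ℕ.suc-injective (∣1⇒≡1 (∣m+n∣m⇒∣n
               (subst (2 ∣_) (trans eq (ℕ.+-comm 1 (suc m))) (m∣m*n (2 ^ s))) 2∣))))
          , fixed⇒equal-powers (subst (Rel v w) eq (rel-^ 2-coprime rel-2 (suc s))) (fixed v) (fixed w)
          where
          fixed : ∀ a → σ (suc (suc m)) a ≈ a
          fixed a = Z.trans (σ-∼ₑ n (subst (_∼ 1 [ n ]) eq 2^∼1) a) (σ-1ₑ n a)

      -- Frobenius makes v^q σ_q w and w^q σ_q v congruent mod q; their M-th powers agree, so they
      -- are equal unless q divides M (v w)^(M-1).
      rel-prime : ∀ {m} → v Z.^ suc m ≈ w Z.^ suc m → ∀ {q} → Prime q → Coprime q n →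
                  norm (E n ⊛ (suc m Z.· (v ⊛ w) Z.^ m)) < q → Rel v w q
      rel-prime {m} same {q} q-prime co bound = decide (ZD.equal-powers M same-powers)
        where
        M = suc m
        same-powers : (v Z.^ q ⊛ σ q w) Z.^ M ≈ (w Z.^ q ⊛ σ q v) Z.^ M
        same-powers = Z.begin
          (v Z.^ q ⊛ σ q w) Z.^ M              Z.≈⟨ Z.^-distrib-* (v Z.^ q) (σ q w) M ⟩
          (v Z.^ q) Z.^ M ⊛ σ q w Z.^ M        Z.≈⟨ Z.*-cong powers conjugates ⟩
          (w Z.^ q) Z.^ M ⊛ σ q v Z.^ M        Z.≈⟨ Z.^-distrib-* (w Z.^ q) (σ q v) M ⟨
          (w Z.^ q ⊛ σ q v) Z.^ M              Z.∎
          where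
          powers : (v Z.^ q) Z.^ M ≈ (w Z.^ q) Z.^ M
          powers = Z.trans (Z.^-assocʳ v q M) (Z.trans (equal-powers-∣ {M} (n∣m*n q) same) (Z.sym (Z.^-assocʳ w q M)))
          conjugates : σ q w Z.^ M ≈ σ q v Z.^ M
          conjugates = Z.trans (Z.sym (σ-^ₑ n q w M)) (Z.trans (σ-≈ₑ n co (Z.sym same)) (σ-^ₑ n q v M))
        open Z.PrincipalQuotient (const (+ q)) using (_≈ₘ_; mk; quotientₘ; ≈⇒≈ₘ; geo-congₘ)
        module Q = CommutativeRing quotientₘ
        z = σ q (v ⊛ w)
        V = suc m Z.· (v ⊛ w) Z.^ m
        congruent : ∀ a b → z ≈ σ q a ⊛ σ q b → (a Z.^ q ⊛ σ q b) ≈ₘ z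
        congruent a b z≈ = Q.trans
          (Q.*-cong {a Z.^ q} {σ q a} {σ q b} {σ q b} (mk (proj₁ (frobeniusₑ n q-prime a)) (proj₂ (frobeniusₑ n q-prime a))) Q.refl)
          (≈⇒≈ₘ (Z.sym z≈))
        z≈vw : z ≈ σ q v ⊛ σ q w
        z≈vw = σ-*ₑ n q v w
        -- Modulo q both arguments become `z`, and the geometric sum becomes its diagonal value M
        -- z^(M-1).
        geo≈ : Z.geo (v Z.^ q ⊛ σ q w) (w Z.^ q ⊛ σ q v) (suc m) ≈ₘ Z.geo z z (suc m)
        geo≈ = geo-congₘ (congruent v w z≈vw) (congruent w v (Z.trans z≈vw (Z.*-comm (σ q v) (σ q w)))) (suc m)
        c = negate (_≈ₘ_.multiplier geo≈)
        conj : Z.geo (v Z.^ q ⊛ σ q w) (w Z.^ q ⊛ σ q v) (suc m) ≈ [] → suc m Z.· z Z.^ m ≈ const (+ q) ⊛ c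
        conj geo≈0 = Z.begin
          suc m Z.· z Z.^ m                            Z.≈⟨ Z.geo-diagonal z m ⟨
          Z.geo z z (suc m)                            Z.≈⟨ Z.+-inverseʳ-unique (const (+ q) ⊛ d) (Z.geo z z (suc m)) (Z.begin
            const (+ q) ⊛ d ⊕ Z.geo z z (suc m)           Z.≈⟨ Z.+-comm (const (+ q) ⊛ d) _ ⟩
            Z.geo z z (suc m) ⊕ const (+ q) ⊛ d           Z.≈⟨ _≈ₘ_.differ geo≈ ⟨
            Z.geo (v Z.^ q ⊛ σ q w) (w Z.^ q ⊛ σ q v) (suc m)  Z.≈⟨ geo≈0 ⟩
            []                                            Z.∎) ⟩
          negate (const (+ q) ⊛ d)                     Z.≈⟨ Z.-‿distribʳ-* (const (+ q)) d ⟩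
          const (+ q) ⊛ c                              Z.∎
          where d = _≈ₘ_.multiplier geo≈
        q′ = proj₁ (coprime-inverse q n co)
        qq′∼1 = proj₂ (coprime-inverse q n co)
        conj-V : σ q V ≈ suc m Z.· z Z.^ m
        conj-V = Z.begin
          σ q V                                        Z.≈⟨ σ-≈ₑ n co (·≈const n (suc m) ((v ⊛ w) Z.^ m)) ⟩
          σ q (const (+ suc m) ⊛ (v ⊛ w) Z.^ m)        Z.≈⟨ σ-*ₑ n q (const (+ suc m)) ((v ⊛ w) Z.^ m) ⟩
          σ q (const (+ suc m)) ⊛ σ q ((v ⊛ w) Z.^ m)  Z.≈⟨ Z.*-cong (≈⇒≈ₑ n (σ-const n q (+ suc m))) (σ-^ₑ n q (v ⊛ w) m) ⟩
          const (+ suc m) ⊛ z Z.^ m                    Z.≈⟨ ·≈const n (suc m) (z Z.^ m) ⟨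
          suc m Z.· z Z.^ m                            Z.∎
        -- The inverse automorphism moves the divisibility by q from `σ q V` to `V` itself, the
        -- element in the norm bound.
        divisible : Z.geo (v Z.^ q ⊛ σ q w) (w Z.^ q ⊛ σ q v) (suc m) ≈ [] → V ≈ const (+ q) ⊛ σ q′ c
        divisible geo≈0 = Z.begin
          V                                            Z.≈⟨ σ-inverse n qq′∼1 V ⟨
          σ q′ (σ q V)                                 Z.≈⟨ σ-≈ₑ n (inverse-coprime n {q} qq′∼1) (Z.trans conj-V (conj geo≈0)) ⟩
          σ q′ (const (+ q) ⊛ c)                       Z.≈⟨ σ-*ₑ n q′ (const (+ q)) c ⟩
          σ q′ (const (+ q)) ⊛ σ q′ c                  Z.≈⟨ Z.*-congʳ {σ q′ c} (≈⇒≈ₑ n (σ-const n q′ (+ q))) ⟩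
          const (+ q) ⊛ σ q′ c                         Z.∎
        decide : v Z.^ q ⊛ σ q w ≈ w Z.^ q ⊛ σ q v ⊎ Z.geo (v Z.^ q ⊛ σ q w) (w Z.^ q ⊛ σ q v) M ≈ [] → Rel v w q
        decide (inj₁ equal) = equal
        decide (inj₂ geo≈0) =
          ⊥-elim (·-≉0 n m (^-≉0 n (ZD.*-≉0 v≉0 w≉0) m) (large-multipleₑ n q bound (divisible geo≈0)))

      -- For rough k = 1 + d x the automorphism `σ k` fixes v and w, which gives W^(dx) = 1. To
      -- remove x it is chosen prime to an exponent M with W^M = 1: then gcd(M, d x) divides d.
      equal-d-th-powers : ∀ d → (∀ {k} → k ∼ 1 [ d ] → σ k v ≈ v) → (∀ {k} → k ∼ 1 [ d ] → σ k w ≈ w) →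
                          Rel v w 2 → v Z.^ d ≈ w Z.^ d
      equal-d-th-powers d fix-v fix-w rel-2 =
        equal-powers-∣ {gcd (suc m) (d * x)} (coprime-divisor (λ {c} (c∣g , c∣x) → co (∣-trans c∣g (gcd[m,n]∣m (suc m) (d * x)) , c∣x))
            (subst (gcd (suc m) (d * x) ∣_) (ℕ.*-comm d x) (gcd[m,n]∣n (suc m) (d * x))))
          (equal-powers-gcd (suc m) (d * x) same (fixed⇒equal-powers {d * x} rel-k (fix-v k∼1) (fix-w k∼1)))
        where
        order = odd-order rel-2
        m = proj₁ order
        same = proj₂ (proj₂ order)
        V = suc m Z.· (v ⊛ w) Z.^ m
        -- Primes above B are prime to n and exceed the norm bound in `rel-prime`; the 2 is what
        -- `rough-induction` asks for.
        B = 2 + n + norm (E n ⊛ V)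
        exponent = sieve-exponent d (suc m) (proj₁ (proj₂ order)) B
        x = proj₁ exponent
        co : Coprime (suc m) x
        co = proj₁ (proj₂ exponent)
        rough = proj₂ (proj₂ exponent)
        n≤B : n ≤ B
        n≤B = ℕ.≤-trans (ℕ.m≤n+m n 2) (ℕ.m≤m+n (2 + n) (norm (E n ⊛ V)))
        step : ∀ {q k} → Prime q → B < q → Rel v w k → Rel v w (q * k)
        step q-prime B<q rel = rel-* co-q rel
          (rel-prime {m} same q-prime co-q (ℕ.≤-<-trans (ℕ.m≤n+m (norm (E n ⊛ V)) (2 + n)) B<q))
          where co-q = prime⇒coprime q-prime (ℕ.≤-<-trans n≤B B<q)
        rel-k : Rel v w (1 + d * x)
        rel-k = rough-induction (Rel v w) B (ℕ.m≤m+n 2 (n + norm (E n ⊛ V))) rel-1 step (1 + d * x) rough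
        k∼1 : 1 + d * x ∼ 1 [ d ]
        k∼1 = subst (_∼ 1 [ d ]) (cong (λ z → 1 + z) (ℕ.*-comm x d)) (∼+d x)

      -- If w differs from every ζ^(at) v then each geo w (ζ^(at) v) d vanishes, but their sum over t is d w^(d-1).
      root-of-unity : ∀ a d → n ≡ a * d → v Z.^ d ≈ w Z.^ d → ∃[ t ] (w ≈ X (a * t) ⊛ v)
      root-of-unity a zero n≡ad same = ⊥-elim (ℕ.≢-nonZero⁻¹ n (trans n≡ad (ℕ.*-zeroʳ a)))
      root-of-unity a d@(suc d-1) n≡ad same = decide (search d)
        where
        root : ℕ → Element
        root t = X (a * t) ⊛ v
        root^d : ∀ t → w Z.^ d ≈ root t Z.^ d
        root^d t = Z.begin
          w Z.^ d                            Z.≈⟨ same ⟨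
          v Z.^ d                            Z.≈⟨ Z.*-identityˡ (v Z.^ d) ⟨
          X 0 ⊛ v Z.^ d                      Z.≈⟨ Z.*-congʳ {v Z.^ d} (X-congₑ n {d * (a * t)} {0} (∣⇒∼0 n∣)) ⟨
          X (d * (a * t)) ⊛ v Z.^ d      Z.≈⟨ Z.*-congʳ {v Z.^ d} (X-^ₑ n (a * t) d) ⟨
          X (a * t) Z.^ d ⊛ v Z.^ d        Z.≈⟨ Z.^-distrib-* (X (a * t)) v d ⟨
          root t Z.^ d                       Z.∎
          where
          n∣ : n ∣ d * (a * t)
          n∣ = divides t (trans (rearrange d a t) (cong (t *_) (sym n≡ad)))
            where
            rearrange : ∀ d a t → d * (a * t) ≡ t * (a * d)
            rearrange = ℕ-Solver.solve-∀
        search : ∀ m → ∃[ t ] (w ≈ root t) ⊎ (∀ {t} → t < m → Z.geo w (root t) d ≈ [])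
        search zero = inj₂ λ ()
        search (suc m) = extend (search m) (ZD.equal-powers d (root^d m))
          where
          below-suc : (∀ {t} → t < m → Z.geo w (root t) d ≈ []) → Z.geo w (root m) d ≈ [] →
                      ∀ {t} → t < suc m → Dec (t ≡ m) → Z.geo w (root t) d ≈ []
          below-suc below here t<sm (yes refl) = here
          below-suc below here t<sm (no t≢m) = below (ℕ.≤∧≢⇒< (ℕ.≤-pred t<sm) t≢m)
          extend : ∃[ t ] (w ≈ root t) ⊎ (∀ {t} → t < m → Z.geo w (root t) d ≈ []) →
                   w ≈ root m ⊎ Z.geo w (root m) d ≈ [] →
                   ∃[ t ] (w ≈ root t) ⊎ (∀ {t} → t < suc m → Z.geo w (root t) d ≈ [])
          extend (inj₁ found) _ = inj₁ found
          extend (inj₂ _) (inj₁ w≈) = inj₁ (m , w≈)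
          extend (inj₂ below) (inj₂ here) = inj₂ λ {t} t<sm → below-suc below here t<sm (t ℕ.≟ m)
        -- Only the leading power of w survives the summation over t: for 0 < j < d the sum of
        -- ζ^(atj) over t < d is zero.
        total : ∀ j → suc j ≤ d → Z.Σ< d (λ t → Z.geo w (X (a * t) ⊛ v) (suc j)) ≈ d Z.· w Z.^ j
        total zero _ = Z.trans (Z.Σ-cong d (λ {t} _ → Z.trans (Z.+-congʳ {X 0} (Z.zeroʳ w)) (Z.+-identityˡ (X 0))))
          (Z.Σ-const d (X 0))
        total (suc j) j<d = Z.begin
          Z.Σ< d (λ t → w ⊛ geo t ⊕ (X (a * t) ⊛ v) Z.^ suc j)
            Z.≈⟨ Z.Σ-+ d (λ t → w ⊛ geo t) (λ t → (X (a * t) ⊛ v) Z.^ suc j) ⟩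
          Z.Σ< d (λ t → w ⊛ geo t) ⊕ Z.Σ< d (λ t → (X (a * t) ⊛ v) Z.^ suc j)
            Z.≈⟨ Z.+-cong (Z.sym (Z.Σ-*ˡ d w geo)) (Z.Σ-cong d (λ {t} _ → power t)) ⟩
          w ⊛ Z.Σ< d geo ⊕ Z.Σ< d (λ t → X (t * (a * suc j)) ⊛ v Z.^ suc j)
            Z.≈⟨ Z.+-cong (Z.*-congˡ {w} (total j (ℕ.<⇒≤ j<d))) (Z.sym (Z.Σ-*ʳ d (v Z.^ suc j) (λ t → X (t * (a * suc j))))) ⟩
          w ⊛ (d Z.· w Z.^ j) ⊕ Z.Σ< d (λ t → X (t * (a * suc j))) ⊛ v Z.^ suc j
            Z.≈⟨ Z.+-cong (Z.×-comm-* d w (w Z.^ j)) (Z.*-congʳ {v Z.^ suc j} (Σ-roots n d n∤ n∣)) ⟩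
          d Z.· w Z.^ suc j ⊕ [] ⊛ v Z.^ suc j
            Z.≈⟨ Z.trans (Z.+-congˡ {d Z.· w Z.^ suc j} (Z.zeroˡ (v Z.^ suc j))) (Z.+-identityʳ _) ⟩
          d Z.· w Z.^ suc j Z.∎
          where
          geo : ℕ → Element
          geo t = Z.geo w (X (a * t) ⊛ v) (suc j)
          rearrange : ∀ a t j → suc j * (a * t) ≡ t * (a * suc j)
          rearrange = ℕ-Solver.solve-∀
          power : ∀ t → (X (a * t) ⊛ v) Z.^ suc j ≈ X (t * (a * suc j)) ⊛ v Z.^ suc j
          power t = Z.trans (Z.^-distrib-* (X (a * t)) v (suc j)) (Z.*-congʳ {v Z.^ suc j}
            (Z.trans (X-^ₑ n (a * t) (suc j)) (Z.reflexive (cong X (rearrange a t j)))))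
          instance
            a≢0 : NonZero a
            a≢0 = ℕ.m*n≢0⇒m≢0 a {{subst NonZero n≡ad (ℕ.≢-nonZero (ℕ.≢-nonZero⁻¹ n))}}
          n∤ : ¬ n ∣ a * suc j
          n∤ h = ℕ.<⇒≱ j<d (∣⇒≤ (*-cancelˡ-∣ a (subst (_∣ a * suc j) n≡ad h)))
          rearrange′ : ∀ d a j → d * (a * suc j) ≡ suc j * (a * d)
          rearrange′ = ℕ-Solver.solve-∀
          n∣ : n ∣ d * (a * suc j)
          n∣ = divides (suc j) (trans (rearrange′ d a j) (cong (suc j *_) (sym n≡ad)))

        decide : ∃[ t ] (w ≈ root t) ⊎ (∀ {t} → t < d → Z.geo w (root t) d ≈ []) → ∃[ t ] (w ≈ root t)
        decide (inj₁ found) = found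
        decide (inj₂ vanish) =
          ⊥-elim (·-≉0 n d-1 (^-≉0 n w≉0 d-1) (Z.trans (Z.sym (total d-1 ℕ.≤-refl)) (Z.Σ-zero d vanish)))

      ratio : ∀ a d → n ≡ a * d → (∀ {k} → k ∼ 1 [ d ] → σ k v ≈ v) → (∀ {k} → k ∼ 1 [ d ] → σ k w ≈ w) →
              Rel v w 2 → ∃[ t ] (w ≈ X (a * t) ⊛ v)
      ratio a d n≡ad fix-v fix-w rel-2 = root-of-unity a d n≡ad (equal-d-th-powers d fix-v fix-w rel-2)

-- From equal triple products to one phase per order, and from compatible phases to a translation.

module Deck where

  open import Data.Nat as ℕ using (ℕ; zero; suc; NonZero; _<_; _+_; _*_)
  import Data.Nat.Properties as ℕ
  open import Data.Nat.Divisibility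
  open import Data.Nat.GCD using (gcd; gcd[m,n]∣n)
  open import Data.Nat.Coprimality using (Coprime)
  open import Data.List.Base using (List; []; _∷_)
  open import Data.List.Membership.Propositional using (_∈_)
  open import Data.List.Relation.Unary.Any using (here; there)
  open import Relation.Binary.PropositionalEquality hiding (resp; setoid)
  open Arith
  open RingTheory
  open GroupRing hiding (module A)
  open Cyclotomic hiding (module Z; module ZD; _≋_)
  open Phases

  module SameDeck (n : ℕ) .{{n≢0 : NonZero n}} (n-odd : ¬ 2 ∣ n) (f g : Element)
    (triple : ∀ a b c → n ∣ a + b + c → _≋_ n (σ a f ⊛ σ b f ⊛ σ c f) (σ a g ⊛ σ b g ⊛ σ c g))
    (F₀≈G₀ : _≈ₑ_ n (σ 0 f) (σ 0 g)) (F₀≉0 : ¬ _≈ₑ_ n (σ 0 f) [])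
    where

    open Ratio n n-odd
    private
      module Z = Cyclotomic.Z n
      module ZD = Cyclotomic.ZD n

    F G : ℕ → Element
    F k = σ k f
    G k = σ k g

    F-∼ : ∀ {a b} → a ∼ b [ n ] → F a ≈ F b
    F-∼ e = σ-∼ₑ n e f

    G-∼ : ∀ {a b} → a ∼ b [ n ] → G a ≈ G b
    G-∼ e = σ-∼ₑ n e g

    neg : ℕ → ℕ
    neg a = ℕ.pred n * a

    n∣a+neg : ∀ a → n ∣ a + neg a
    n∣a+neg a = subst (λ m → n ∣ m * a) (sym (ℕ.suc-pred n)) (m∣m*n a)

    -- The third frequency is 0, where F and G agree and are nonzero, so that factor cancels.
    pair : ∀ {a b} → n ∣ a + b → F a ⊛ F b ≈ G a ⊛ G b
    pair {a} {b} n∣a+b = ZD.*-cancelˡ F₀≉0 (Z.begin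
      F 0 ⊛ (F a ⊛ F b)      Z.≈⟨ Z.*-comm (F 0) (F a ⊛ F b) ⟩
      F a ⊛ F b ⊛ F 0        Z.≈⟨ ≈⇒≈ₑ n (triple a b 0 (subst (n ∣_) (sym (ℕ.+-identityʳ (a + b))) n∣a+b)) ⟩
      G a ⊛ G b ⊛ G 0        Z.≈⟨ Z.*-congˡ {G a ⊛ G b} F₀≈G₀ ⟨
      G a ⊛ G b ⊛ F 0        Z.≈⟨ Z.*-comm (G a ⊛ G b) (F 0) ⟩
      F 0 ⊛ (G a ⊛ G b)      Z.∎)

    conj-≉0 : ∀ h {k a} → Coprime k n → ¬ σ a h ≈ [] → ¬ σ (k * a) h ≈ []
    conj-≉0 h {k} {a} co ≉0 e = σ-≉0 n co ≉0 (Z.trans (σ-∘ₑ n k a h) e)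

    conj-≈0 : ∀ h {k a} → Coprime k n → σ a h ≈ [] → σ (k * a) h ≈ []
    conj-≈0 h {k} {a} co e = Z.begin
      σ (k * a) h      Z.≈⟨ σ-∘ₑ n k a h ⟨
      σ k (σ a h)        Z.≈⟨ σ-≈ₑ n co e ⟩
      σ k []             Z.≈⟨ Z.reflexive (σ-[] k) ⟩
      []                 Z.∎

    -- `F (neg a)` is the conjugate of `F a` under the unit -1, so both are nonzero, and their
    -- product equals that of the values of G.
    F≉0⇒G≉0 : ∀ {a} → ¬ F a ≈ [] → ¬ G a ≈ []
    F≉0⇒G≉0 {a} F≉0 G≈0 = ZD.*-≉0 F≉0 (conj-≉0 f (coprime-pred n) F≉0) (Z.begin
      F a ⊛ F (neg a)    Z.≈⟨ pair (n∣a+neg a) ⟩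
      G a ⊛ G (neg a)    Z.≈⟨ Z.*-congʳ {G (neg a)} G≈0 ⟩
      [] ⊛ G (neg a)     Z.≈⟨ Z.zeroˡ (G (neg a)) ⟩
      []                 Z.∎)

    F≈0⇒G≈0 : ∀ {a} → F a ≈ [] → G a ≈ []
    F≈0⇒G≈0 {a} F≈0 = decide (_≈ₑ?_ n (G a) [])
      where
      decide : Dec (G a ≈ []) → G a ≈ []
      decide (yes G≈0) = G≈0
      decide (no G≉0) = ⊥-elim (ZD.*-≉0 G≉0 (conj-≉0 g (coprime-pred n) G≉0) (Z.begin
        G a ⊛ G (neg a)    Z.≈⟨ pair (n∣a+neg a) ⟨
        F a ⊛ F (neg a)    Z.≈⟨ Z.*-congʳ {F (neg a)} F≈0 ⟩
        [] ⊛ F (neg a)     Z.≈⟨ Z.zeroˡ (F (neg a)) ⟩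
        []                 Z.∎))

    -- G/F is a partial homomorphism on the support of F, stated without division.
    multiplicative : ∀ a b → F a ⊛ F b ⊛ G (a + b) ≈ G a ⊛ G b ⊛ F (a + b)
    multiplicative a b = decide (_≈ₑ?_ n (F c) [])
      where
      c = a + b
      c′ = neg c
      decide : Dec (F c ≈ []) → F a ⊛ F b ⊛ G c ≈ G a ⊛ G b ⊛ F c
      decide (yes F≈0) = Z.begin
        F a ⊛ F b ⊛ G c    Z.≈⟨ Z.*-congˡ {F a ⊛ F b} (F≈0⇒G≈0 F≈0) ⟩
        F a ⊛ F b ⊛ []     Z.≈⟨ Z.trans (Z.zeroʳ (F a ⊛ F b)) (Z.sym (Z.zeroʳ (G a ⊛ G b))) ⟩
        G a ⊛ G b ⊛ []     Z.≈⟨ Z.*-congˡ {G a ⊛ G b} F≈0 ⟨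
        G a ⊛ G b ⊛ F c    Z.∎
      -- The cancelled factor F c F(-c) equals G c G(-c), while a, b and -c form a triple with sum 0
      -- modulo n.
      decide (no F≉0) = ZD.*-cancelˡ (ZD.*-≉0 F≉0 (conj-≉0 f (coprime-pred n) F≉0)) (Z.begin
        (F c ⊛ F c′) ⊛ (F a ⊛ F b ⊛ G c)      Z.≈⟨ rearrange₁ (F c) (F c′) (F a) (F b) (G c) ⟩
        (F a ⊛ F b ⊛ F c′) ⊛ (F c ⊛ G c)      Z.≈⟨ Z.*-congʳ {F c ⊛ G c} (≈⇒≈ₑ n (triple a b c′ (n∣a+neg c))) ⟩
        (G a ⊛ G b ⊛ G c′) ⊛ (F c ⊛ G c)      Z.≈⟨ rearrange₂ (G a) (G b) (G c′) (F c) (G c) ⟩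
        (G c ⊛ G c′) ⊛ (G a ⊛ G b ⊛ F c)      Z.≈⟨ Z.*-congʳ {G a ⊛ G b ⊛ F c} (pair (n∣a+neg c)) ⟨
        (F c ⊛ F c′) ⊛ (G a ⊛ G b ⊛ F c)      Z.∎)
        where
        rearrange₁ : ∀ fc fc′ fa fb gc → (fc ⊛ fc′) ⊛ (fa ⊛ fb ⊛ gc) ≈ (fa ⊛ fb ⊛ fc′) ⊛ (fc ⊛ gc)
        rearrange₁ = Z.solve 5 (λ fc fc′ fa fb gc → (fc Z.:* fc′) Z.:* (fa Z.:* fb Z.:* gc) Z.:=
                                                    (fa Z.:* fb Z.:* fc′) Z.:* (fc Z.:* gc)) Z.refl
        rearrange₂ : ∀ ga gb gc′ fc gc → (ga ⊛ gb ⊛ gc′) ⊛ (fc ⊛ gc) ≈ (gc ⊛ gc′) ⊛ (ga ⊛ gb ⊛ fc)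
        rearrange₂ = Z.solve 5 (λ ga gb gc′ fc gc → (ga Z.:* gb Z.:* gc′) Z.:* (fc Z.:* gc) Z.:=
                                                    (gc Z.:* gc′) Z.:* (ga Z.:* gb Z.:* fc)) Z.refl

    -- All multiples of a are covered, including those of smaller order. This permits comparing the
    -- phases of two orders at a common multiple of their frequencies.
    Phase : ℕ → ℕ → Set
    Phase a t = ∀ m → G (m * a) ≈ X (m * a * t) ⊛ F (m * a)

    phase : ∀ a d → n ≡ a * d → ¬ F a ≈ [] → ∃[ t ] Phase a t
    phase a d n≡ad F≉0 = t , everywhere
      where
      fixed : ∀ h {k} → k ∼ 1 [ d ] → σ k (σ a h) ≈ σ a h
      fixed h {k} k∼1 = Z.trans (σ-∘ₑ n k a h) (σ-∼ₑ n (subst₂ (_∼_[ n ]) (ℕ.*-comm a k) (ℕ.*-identityʳ a)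
        (subst (a * k ∼ a * 1 [_]) (sym n≡ad) (∼-scale a k∼1))) h)
      double : ∀ h → σ (a + a) h ≈ σ 2 (σ a h)
      double h = Z.trans (Z.reflexive (cong (λ k → σ (a + k) h) (sym (ℕ.+-identityʳ a)))) (Z.sym (σ-∘ₑ n 2 a h))
      square : ∀ x → x ⊛ x ≈ x Z.^ 2
      square x = Z.*-congˡ {x} (Z.sym (Z.*-identityʳ x))
      rel-2 : Rel (F a) (G a) 2
      rel-2 = Z.begin
        F a Z.^ 2 ⊛ σ 2 (G a)         Z.≈⟨ Z.*-cong (square (F a)) (double g) ⟨
        F a ⊛ F a ⊛ G (a + a)       Z.≈⟨ multiplicative a a ⟩
        G a ⊛ G a ⊛ F (a + a)       Z.≈⟨ Z.*-cong (square (G a)) (double f) ⟩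
        G a Z.^ 2 ⊛ σ 2 (F a)         Z.∎
      found = ratio F≉0 (F≉0⇒G≉0 F≉0) a d n≡ad (fixed f) (fixed g) rel-2
      t = proj₁ found
      at-unit : ∀ {u} → Coprime u n → G (u * a) ≈ X (u * a * t) ⊛ F (u * a)
      at-unit {u} co = Z.begin
        G (u * a)                               Z.≈⟨ σ-∘ₑ n u a g ⟨
        σ u (G a)                                 Z.≈⟨ σ-≈ₑ n co (proj₂ found) ⟩
        σ u (X (a * t) ⊛ F a)                   Z.≈⟨ σ-*ₑ n u (X (a * t)) (F a) ⟩
        σ u (X (a * t)) ⊛ σ u (F a)             Z.≈⟨ Z.*-cong (≈⇒≈ₑ n (σ-X n u (a * t))) (σ-∘ₑ n u a f) ⟩
        X (u * (a * t)) ⊛ F (u * a)         Z.≈⟨ Z.reflexive (cong (λ e → X e ⊛ F (u * a)) (sym (ℕ.*-assoc u a t))) ⟩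
        X (u * a * t) ⊛ F (u * a)           Z.∎
      everywhere : Phase a t
      everywhere m = ZD.*-cancelˡ (ZD.*-≉0 (conj-≉0 f co-b F≉0) (conj-≉0 f co-c F≉0)) (Z.begin
        (F b ⊛ F c) ⊛ G (m * a)                       Z.≈⟨ Z.*-congˡ {F b ⊛ F c} (G-∼ b+c∼ma) ⟨
        (F b ⊛ F c) ⊛ G (b + c)                       Z.≈⟨ multiplicative b c ⟩
        (G b ⊛ G c) ⊛ F (b + c)                       Z.≈⟨ Z.*-cong (Z.*-cong (at-unit co-b) (at-unit co-c)) (F-∼ b+c∼ma) ⟩
        ((X (b * t) ⊛ F b) ⊛ (X (c * t) ⊛ F c)) ⊛ F (m * a)
                                                        Z.≈⟨ rearrange (X (b * t)) (F b) (X (c * t)) (F c) (F (m * a)) ⟩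
        (F b ⊛ F c) ⊛ ((X (b * t) ⊛ X (c * t)) ⊛ F (m * a))
                                                        Z.≈⟨ Z.*-congˡ {F b ⊛ F c} (Z.*-congʳ {F (m * a)} exponents) ⟩
        (F b ⊛ F c) ⊛ (X (m * a * t) ⊛ F (m * a)) Z.∎)
        where
        units = sum-of-units n n-odd m
        b = proj₁ units * a
        c = proj₁ (proj₂ units) * a
        co-b : Coprime (proj₁ units) n
        co-b = proj₁ (proj₂ (proj₂ units))
        co-c : Coprime (proj₁ (proj₂ units)) n
        co-c = proj₁ (proj₂ (proj₂ (proj₂ units)))
        b+c∼ma : b + c ∼ m * a [ n ]
        b+c∼ma = subst (_∼ m * a [ n ]) (ℕ.*-distribʳ-+ a (proj₁ units) (proj₁ (proj₂ units)))
          (∼-*ʳ a (proj₂ (proj₂ (proj₂ (proj₂ units)))))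
        exponents : X (b * t) ⊛ X (c * t) ≈ X (m * a * t)
        exponents = Z.trans (≈⇒≈ₑ n (Z-sym-X (b * t) (c * t)))
          (X-congₑ n (subst (_∼ m * a * t [ n ]) (ℕ.*-distribʳ-+ t b c) (∼-*ʳ t b+c∼ma)))
          where
          Z-sym-X : ∀ i j → _≋_ n (X i ⊛ X j) (X (i + j))
          Z-sym-X i j = GroupRing.A.sym n (X-+ n i j)
        rearrange : ∀ x fb y fc fm → ((x ⊛ fb) ⊛ (y ⊛ fc)) ⊛ fm ≈ (fb ⊛ fc) ⊛ ((x ⊛ y) ⊛ fm)
        rearrange = Z.solve 5 (λ x fb y fc fm → ((x Z.:* fb) Z.:* (y Z.:* fc)) Z.:* fm Z.:=
                                                (fb Z.:* fc) Z.:* ((x Z.:* y) Z.:* fm)) Z.refl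

    class-∼ : ∀ {a d u m} → n ≡ a * d → u ∼ m [ d ] → u * a ∼ m * a [ n ]
    class-∼ {a} {d} {u} {m} n≡ad u∼m = subst₂ (_∼_[ n ]) (ℕ.*-comm a u) (ℕ.*-comm a m)
      (subst (a * u ∼ a * m [_]) (sym n≡ad) (∼-scale a u∼m))

    -- The multiplier m is prime only to the order d, but a unit modulo n in the same class modulo d
    -- gives the same frequency, and units act by automorphisms.
    class-≉0 : ∀ {a d m} → n ≡ a * d → ¬ F a ≈ [] → Coprime m d → ¬ F (m * a) ≈ []
    class-≉0 {a} {d} {m} n≡ad F≉0 co e = conj-≉0 f co-u F≉0 (Z.trans (F-∼ (class-∼ n≡ad u∼m)) e)
      where
      u∼m = proj₁ (proj₂ (coprime-lift n co))
      co-u : Coprime (proj₁ (coprime-lift n co)) n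
      co-u = proj₂ (proj₂ (coprime-lift n co))

    class-≈0 : ∀ {a d m} → n ≡ a * d → F a ≈ [] → Coprime m d → F (m * a) ≈ []
    class-≈0 {a} {d} {m} n≡ad F≈0 co = Z.trans (Z.sym (F-∼ (class-∼ n≡ad u∼m))) (conj-≈0 f co-u F≈0)
      where
      u∼m = proj₁ (proj₂ (coprime-lift n co))
      co-u : Coprime (proj₁ (coprime-lift n co)) n
      co-u = proj₂ (proj₂ (coprime-lift n co))

    -- Both phases express the ratio of `G b` to `F b` as a power of ζ, and distinct exponents
    -- modulo n give distinct powers.
    phases-agree : ∀ {a t a′ t′ m m′ b} → Phase a t → Phase a′ t′ → m * a ≡ b → m′ * a′ ≡ b → ¬ F b ≈ [] →
                   b * t ∼ b * t′ [ n ]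
    phases-agree {a} {t} {a′} {t′} {m} {m′} {b} P P′ refl e F≉0 = X-injective n (ZD.*-cancelˡ F≉0 (Z.begin
      F b ⊛ X (b * t)        Z.≈⟨ Z.*-comm (F b) (X (b * t)) ⟩
      X (b * t) ⊛ F b        Z.≈⟨ P m ⟨
      G b                      Z.≈⟨ subst (λ x → G x ≈ X (x * t′) ⊛ F x) e (P′ m′) ⟩
      X (b * t′) ⊛ F b       Z.≈⟨ Z.*-comm (X (b * t′)) (F b) ⟩
      F b ⊛ X (b * t′)       Z.∎))

    Valid : ℕ × ℕ → Set
    Valid (d , t) = ∃[ a ] (n ≡ a * d × ¬ F a ≈ [] × Phase a t)

    Compatible : Set
    Compatible = ∀ {a d t a′ d′ t′} → n ≡ a * d → n ≡ a′ * d′ → ¬ F a ≈ [] → ¬ F a′ ≈ [] →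
                 Phase a t → Phase a′ t′ → t ∼ t′ [ gcd d d′ ]

    private
      -- An order d is represented by the divisor a = n / d. Membership in the support is decidable,
      -- so the phases can be collected into the finite list that `chinese-remainder` takes.
      phase-list : ∀ B → ∃[ l ] ((∀ {x} → x ∈ l → Valid x) ×
                     (∀ {a d} → a < B → n ≡ a * d → ¬ F a ≈ [] → ∃[ t ] (d , t) ∈ l))
      phase-list zero = [] , (λ ()) , λ ()
      phase-list (suc B) = extend (phase-list B) (B ∣? n) (_≈ₑ?_ n (F B) [])
        where
        Covered : ℕ → List (ℕ × ℕ) → Set
        Covered B l = ∀ {a d} → a < B → n ≡ a * d → ¬ F a ≈ [] → ∃[ t ] (d , t) ∈ l
        extend : ∃[ l ] ((∀ {x} → x ∈ l → Valid x) × Covered B l) → Dec (B ∣ n) → Dec (F B ≈ []) →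
                 ∃[ l ] ((∀ {x} → x ∈ l → Valid x) × Covered (suc B) l)
        extend (l , valid , covered) (no B∤n) _ = l , (λ {x} → valid {x}) , cover
          where
          cover : Covered (suc B) l
          cover {a} {d} a<sB n≡ad F≉0 = decide (a ℕ.≟ B)
            where
            decide : Dec (a ≡ B) → ∃[ t ] (d , t) ∈ l
            decide (yes refl) = ⊥-elim (B∤n (divides d (trans n≡ad (ℕ.*-comm a d))))
            decide (no a≢B) = covered (ℕ.≤∧≢⇒< (ℕ.≤-pred a<sB) a≢B) n≡ad F≉0
        extend (l , valid , covered) (yes _) (yes F≈0) = l , (λ {x} → valid {x}) , cover
          where
          cover : Covered (suc B) l
          cover {a} {d} a<sB n≡ad F≉0 = decide (a ℕ.≟ B)
            where
            decide : Dec (a ≡ B) → ∃[ t ] (d , t) ∈ l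
            decide (yes refl) = ⊥-elim (F≉0 F≈0)
            decide (no a≢B) = covered (ℕ.≤∧≢⇒< (ℕ.≤-pred a<sB) a≢B) n≡ad F≉0
        extend (l , valid , covered) (yes (divides d₀ n≡d₀B)) (no FB≉0) = (d₀ , t₀) ∷ l , valid′ , cover
          where
          n≡Bd₀ : n ≡ B * d₀
          n≡Bd₀ = trans n≡d₀B (ℕ.*-comm d₀ B)
          t₀ = proj₁ (phase B d₀ n≡Bd₀ FB≉0)
          valid′ : ∀ {x} → x ∈ (d₀ , t₀) ∷ l → Valid x
          valid′ (here refl) = B , n≡Bd₀ , FB≉0 , proj₂ (phase B d₀ n≡Bd₀ FB≉0)
          valid′ (there x∈l) = valid x∈l
          cover : Covered (suc B) ((d₀ , t₀) ∷ l)
          cover {a} {d} a<sB n≡ad F≉0 = decide (a ℕ.≟ B)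
            where
            instance
              B≢0 : NonZero B
              B≢0 = ℕ.m*n≢0⇒m≢0 B {{subst NonZero n≡Bd₀ (ℕ.≢-nonZero (ℕ.≢-nonZero⁻¹ n))}}
            later : ∃[ t ] (d , t) ∈ l → ∃[ t ] (d , t) ∈ (d₀ , t₀) ∷ l
            later (t , t∈l) = t , there t∈l
            decide : Dec (a ≡ B) → ∃[ t ] (d , t) ∈ (d₀ , t₀) ∷ l
            decide (yes refl) = t₀ , here (cong (_, t₀) (ℕ.*-cancelˡ-≡ d d₀ B (trans (sym n≡ad) n≡Bd₀)))
            decide (no a≢B) = later (covered (ℕ.≤∧≢⇒< (ℕ.≤-pred a<sB) a≢B) n≡ad F≉0)

    -- The common solution of the congruences is right at every divisor of n, and every frequency is
    -- a unit times a divisor, so the automorphisms carry the identity to all frequencies.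
    global-phase : Compatible → ∃[ t ] (∀ k → G k ≈ X (k * t) ⊛ F k)
    global-phase compatible = t , everywhere
      where
      nonZero-order : ∀ a {d} → n ≡ a * d → NonZero d
      nonZero-order a n≡ad = ℕ.m*n≢0⇒n≢0 a {{subst NonZero n≡ad (ℕ.≢-nonZero (ℕ.≢-nonZero⁻¹ n))}}
      phases = phase-list (suc n)
      l = proj₁ phases
      valid : ∀ {x} → x ∈ l → Valid x
      valid = proj₁ (proj₂ phases)
      pairwise : ∀ {x y} → Valid x → Valid y → proj₂ x ∼ proj₂ y [ gcd (proj₁ x) (proj₁ y) ]
      pairwise (_ , n≡ad , F≉0 , P) (_ , n≡ad′ , F≉0′ , P′) = compatible n≡ad n≡ad′ F≉0 F≉0′ P P′
      solution = chinese-remainder l (λ x∈l → nonZero-order (proj₁ (valid x∈l)) (proj₁ (proj₂ (valid x∈l)))) (λ x∈l y∈l → pairwise (valid x∈l) (valid y∈l))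
      t = proj₁ solution
      at-divisor : ∀ {a d} → n ≡ a * d → Dec (F a ≈ []) → G a ≈ X (a * t) ⊛ F a
      at-divisor {a} {d} n≡ad (yes F≈0) = Z.begin
        G a                      Z.≈⟨ F≈0⇒G≈0 F≈0 ⟩
        []                       Z.≈⟨ Z.zeroʳ (X (a * t)) ⟨
        X (a * t) ⊛ []         Z.≈⟨ Z.*-congˡ {X (a * t)} F≈0 ⟨
        X (a * t) ⊛ F a        Z.∎
      at-divisor {a} {d} n≡ad (no F≉0) = Z.begin
        G a                          Z.≈⟨ Z.reflexive (cong G (sym (ℕ.*-identityˡ a))) ⟩
        G (1 * a)                  Z.≈⟨ subst (λ x → Phase x s) a′≡a (proj₂ (proj₂ (proj₂ (valid (proj₂ listed))))) 1 ⟩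
        X (1 * a * s) ⊛ F (1 * a)  Z.≈⟨ Z.reflexive (cong (λ x → X (x * s) ⊛ F x) (ℕ.*-identityˡ a)) ⟩
        X (a * s) ⊛ F a            Z.≈⟨ Z.*-congʳ {F a} (X-congₑ n as∼at) ⟩
        X (a * t) ⊛ F a            Z.∎
        where
        listed = proj₂ (proj₂ phases) (ℕ.s≤s (∣⇒≤ (divides d (trans n≡ad (ℕ.*-comm a d))))) n≡ad F≉0
        s = proj₁ listed
        a′ = proj₁ (valid (proj₂ listed))
        a′≡a : a′ ≡ a
        a′≡a = ℕ.*-cancelʳ-≡ a′ a d {{nonZero-order a n≡ad}} (trans (sym (proj₁ (proj₂ (valid (proj₂ listed))))) n≡ad)
        as∼at : a * s ∼ a * t [ n ]
        as∼at = subst (a * s ∼ a * t [_]) (sym n≡ad) (∼-scale a (∼-sym (proj₂ solution (proj₂ listed))))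
      everywhere : ∀ k → G k ≈ X (k * t) ⊛ F k
      everywhere k = Z.begin
        G k                               Z.≈⟨ G-∼ k∼ua ⟩
        G (u * a)                       Z.≈⟨ σ-∘ₑ n u a g ⟨
        σ u (G a)                         Z.≈⟨ σ-≈ₑ n co (at-divisor {a} {quotient a∣n} (m∣n⇒n≡m*quotient a∣n) (_≈ₑ?_ n (F a) [])) ⟩
        σ u (X (a * t) ⊛ F a)           Z.≈⟨ σ-*ₑ n u (X (a * t)) (F a) ⟩
        σ u (X (a * t)) ⊛ σ u (F a)     Z.≈⟨ Z.*-cong (≈⇒≈ₑ n (σ-X n u (a * t))) (σ-∘ₑ n u a f) ⟩
        X (u * (a * t)) ⊛ F (u * a) Z.≈⟨ Z.*-cong (X-congₑ n exponent) (F-∼ (∼-sym k∼ua)) ⟩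
        X (k * t) ⊛ F k                 Z.∎
        where
        a = gcd k n
        a∣n = gcd[m,n]∣n k n
        unit = gcd-unit-multiple k n
        u = proj₁ unit
        co : Coprime u n
        co = proj₁ (proj₂ unit)
        k∼ua : k ∼ u * a [ n ]
        k∼ua = subst (k ∼_[ n ]) (ℕ.*-comm a u) (proj₂ (proj₂ unit))
        exponent : u * (a * t) ∼ k * t [ n ]
        exponent = subst (_∼ k * t [ n ]) (ℕ.*-assoc u a t) (∼-*ʳ t (∼-sym k∼ua))

    -- The difference of g and the translate of f has no nonzero Fourier coefficient, so inversion
    -- applies.
    translation : Compatible → ∃[ t ] _≋_ n g (X t ⊛ f)
    translation compatible = t , A.x∙y⁻¹≈ε⇒x≈y g (X t ⊛ f) (fourier-injective n vanish)
      where
      module A = GroupRing.A n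
      t = proj₁ (global-phase compatible)
      vanish : ∀ k → σ k (g ⊕ negate (X t ⊛ f)) ≈ []
      vanish k = Z.begin
        σ k (g ⊕ negate (X t ⊛ f))        Z.≈⟨ ≈⇒≈ₑ n (A.trans (σ-+ n k g (negate (X t ⊛ f))) (A.+-congˡ {G k} (σ-negate n k (X t ⊛ f)))) ⟩
        G k ⊕ negate (σ k (X t ⊛ f))      Z.≈⟨ Z.+-congˡ {G k} (Z.-‿cong (Z.trans (σ-*ₑ n k (X t) f) (Z.*-congʳ {F k} (≈⇒≈ₑ n (σ-X n k t))))) ⟩
        G k ⊕ negate (X (k * t) ⊛ F k)  Z.≈⟨ Z.+-congˡ {G k} (Z.-‿cong (proj₂ (global-phase compatible) k)) ⟨
        G k ⊕ negate (G k)                Z.≈⟨ Z.-‿inverseʳ (G k) ⟩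
        []                                Z.∎

-- Tables of zeros and ones that are sums of a row function and a column function.

module Table where

  open import Data.Nat as ℕ using (ℕ; zero; suc; _≤_; _<_; s≤s; z≤n)
  import Data.Nat.Properties as ℕ
  open import Data.Nat.Divisibility using (_∣_; divides; ∣⇒≤)
  open import Data.Nat.Coprimality using (Coprime; coprime-divisor)
  open import Data.Integer as ℤ using (ℤ; +_; 0ℤ; 1ℤ; ∣_∣)
  import Data.Integer.Properties as ℤ
  import Data.Integer.Tactic.RingSolver as ℤ-Solver
  open import Relation.Binary.PropositionalEquality
  open RingTheory

  open CommutativeRingLemmas ℤ.+-*-commutativeRing using (Σ<; Σ-cong; Σ-*ˡ; Σ-swap; +-cancelˡ; +-cancelʳ)

  ZeroOne : ℤ → Set
  ZeroOne x = x ≡ 0ℤ ⊎ x ≡ 1ℤ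

  -- Vanishing mixed differences on unit cells: the local form of φ(i,j) = u(i) + v(j).
  Additive : (ℕ → ℕ → ℤ) → Set
  Additive φ = ∀ i j → φ i j ℤ.+ φ (suc i) (suc j) ≡ φ (suc i) j ℤ.+ φ i (suc j)

  record Count (ψ : ℕ → ℤ) (q : ℕ) : Set where
    field
      count    : ℕ
      total    : Σ< q ψ ≡ + count
      bounded  : count ≤ q
      positive : ∀ {i} → i < q → ψ i ≡ 1ℤ → 0 < count
      proper   : ∀ {i} → i < q → ψ i ≡ 0ℤ → count < q

  count-zeroOne : ∀ {ψ} → (∀ i → ZeroOne (ψ i)) → ∀ q → Count ψ q
  count-zeroOne h zero = record { count = 0 ; total = refl ; bounded = z≤n ; positive = λ () ; proper = λ () }
  count-zeroOne {ψ} h (suc q) = extend (count-zeroOne h q) (h q)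
    where
    extend : Count ψ q → ZeroOne (ψ q) → Count ψ (suc q)
    extend c (inj₁ ψq≡0) = record
      { count = count ; total = trans (cong₂ ℤ._+_ total ψq≡0) (ℤ.+-identityʳ (+ count)) ; bounded = ℕ.m≤n⇒m≤1+n bounded
      ; positive = λ {i} i<sq ψi≡1 → pos i<sq ψi≡1 (i ℕ.≟ q) ; proper = λ _ _ → s≤s bounded }
      where
      open Count c
      pos : ∀ {i} → i < suc q → ψ i ≡ 1ℤ → Dec (i ≡ q) → 0 < count
      pos i<sq ψi≡1 (yes refl) with () ← trans (sym ψi≡1) ψq≡0
      pos i<sq ψi≡1 (no i≢q) = positive (ℕ.≤∧≢⇒< (ℕ.≤-pred i<sq) i≢q) ψi≡1
    extend c (inj₂ ψq≡1) = record
      { count = suc count ; total = trans (cong₂ ℤ._+_ total ψq≡1) (cong +_ (ℕ.+-comm count 1)) ; bounded = s≤s bounded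
      ; positive = λ _ _ → s≤s z≤n ; proper = λ {i} i<sq ψi≡0 → prop i<sq ψi≡0 (i ℕ.≟ q) }
      where
      open Count c
      prop : ∀ {i} → i < suc q → ψ i ≡ 0ℤ → Dec (i ≡ q) → suc count < suc q
      prop i<sq ψi≡0 (yes refl) with () ← trans (sym ψi≡0) ψq≡1
      prop i<sq ψi≡0 (no i≢q) = s≤s (proper (ℕ.≤∧≢⇒< (ℕ.≤-pred i<sq) i≢q) ψi≡0)

  module _ (φ : ℕ → ℕ → ℤ) (zeroOne : ∀ i j → ZeroOne (φ i j)) (additive : Additive φ) where

    private
      row-step : ∀ i j → φ (suc i) j ℤ.+ φ i 0 ≡ φ i j ℤ.+ φ (suc i) 0
      row-step i zero    = ℤ.+-comm (φ (suc i) 0) (φ i 0)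
      row-step i (suc j) = +-cancelˡ (φ i j) _ _ (begin
        φ i j ℤ.+ (φ (suc i) (suc j) ℤ.+ φ i 0)        ≡⟨ ℤ.+-assoc (φ i j) _ _ ⟨
        φ i j ℤ.+ φ (suc i) (suc j) ℤ.+ φ i 0          ≡⟨ cong (ℤ._+ φ i 0) (additive i j) ⟩
        φ (suc i) j ℤ.+ φ i (suc j) ℤ.+ φ i 0          ≡⟨ lemma₁ (φ (suc i) j) (φ i (suc j)) (φ i 0) ⟩
        (φ (suc i) j ℤ.+ φ i 0) ℤ.+ φ i (suc j)        ≡⟨ cong (ℤ._+ φ i (suc j)) (row-step i j) ⟩
        (φ i j ℤ.+ φ (suc i) 0) ℤ.+ φ i (suc j)        ≡⟨ lemma₂ (φ i j) (φ (suc i) 0) (φ i (suc j)) ⟩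
        φ i j ℤ.+ (φ i (suc j) ℤ.+ φ (suc i) 0)        ∎)
        where
        open ≡-Reasoning
        lemma₁ : ∀ a b c → a ℤ.+ b ℤ.+ c ≡ a ℤ.+ c ℤ.+ b
        lemma₁ = ℤ-Solver.solve-∀
        lemma₂ : ∀ a b c → a ℤ.+ b ℤ.+ c ≡ a ℤ.+ (c ℤ.+ b)
        lemma₂ = ℤ-Solver.solve-∀

      -- The mixed difference over the rectangle from (0,0) to (i,j) is the sum of those over its
      -- unit cells.
      rectangle : ∀ i j → φ i j ℤ.+ φ 0 0 ≡ φ i 0 ℤ.+ φ 0 j
      rectangle zero    j = ℤ.+-comm (φ 0 j) (φ 0 0)
      rectangle (suc i) j = +-cancelˡ (φ i 0) _ _ (begin
        φ i 0 ℤ.+ (φ (suc i) j ℤ.+ φ 0 0)        ≡⟨ lemma (φ i 0) (φ (suc i) j) (φ 0 0) ⟩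
        (φ (suc i) j ℤ.+ φ i 0) ℤ.+ φ 0 0        ≡⟨ cong (ℤ._+ φ 0 0) (row-step i j) ⟩
        (φ i j ℤ.+ φ (suc i) 0) ℤ.+ φ 0 0        ≡⟨ lemma′ (φ i j) (φ (suc i) 0) (φ 0 0) ⟩
        (φ i j ℤ.+ φ 0 0) ℤ.+ φ (suc i) 0        ≡⟨ cong (ℤ._+ φ (suc i) 0) (rectangle i j) ⟩
        (φ i 0 ℤ.+ φ 0 j) ℤ.+ φ (suc i) 0        ≡⟨ lemma″ (φ i 0) (φ 0 j) (φ (suc i) 0) ⟩
        φ i 0 ℤ.+ (φ (suc i) 0 ℤ.+ φ 0 j)        ∎)
        where
        open ≡-Reasoning
        lemma : ∀ a b c → a ℤ.+ (b ℤ.+ c) ≡ b ℤ.+ a ℤ.+ c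
        lemma = ℤ-Solver.solve-∀
        lemma′ : ∀ a b c → a ℤ.+ b ℤ.+ c ≡ a ℤ.+ c ℤ.+ b
        lemma′ = ℤ-Solver.solve-∀
        lemma″ : ∀ a b c → a ℤ.+ b ℤ.+ c ≡ a ℤ.+ (c ℤ.+ b)
        lemma″ = ℤ-Solver.solve-∀

      -- If b and c both differed from a, then d = b + c - a would be 2 or -1.
      corner : ∀ {a b c d} → ZeroOne a → ZeroOne b → ZeroOne c → ZeroOne d → d ℤ.+ a ≡ b ℤ.+ c → b ≢ a → c ≡ a
      corner (inj₁ refl) (inj₁ refl) _ _ _ b≢a = ⊥-elim (b≢a refl)
      corner (inj₂ refl) (inj₂ refl) _ _ _ b≢a = ⊥-elim (b≢a refl)
      corner (inj₁ refl) (inj₂ refl) (inj₁ refl) _ _ _ = refl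
      corner (inj₁ refl) (inj₂ refl) (inj₂ refl) (inj₁ refl) () _
      corner (inj₁ refl) (inj₂ refl) (inj₂ refl) (inj₂ refl) () _
      corner (inj₂ refl) (inj₁ refl) (inj₂ refl) _ _ _ = refl
      corner (inj₂ refl) (inj₁ refl) (inj₁ refl) (inj₁ refl) () _
      corner (inj₂ refl) (inj₁ refl) (inj₁ refl) (inj₂ refl) () _

    -- A 0/1 table φ(i,j) = u(i) + v(j) that varies with i is independent of j.
    row-sums : φ 1 0 ≢ φ 0 0 → ∀ q r → Σ< q (λ i → Σ< r (φ i)) ≡ + r ℤ.* Σ< q (λ i → φ i 0)
    row-sums varies q r = trans (Σ-cong q λ {i} _ → trans (Σ-cong r λ {j} _ → constant i j) (Σ-constant r (φ i 0)))
                                (sym (Σ-*ˡ q (+ r) (λ i → φ i 0)))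
      where
      constant : ∀ i j → φ i j ≡ φ i 0
      constant i j = +-cancelʳ (φ 0 0) (φ i j) (φ i 0) (trans (rectangle i j)
        (cong (λ z → φ i 0 ℤ.+ z) (corner (zeroOne 0 0) (zeroOne 1 0) (zeroOne 0 j) (zeroOne 1 j) (rectangle 1 j) varies)))
      Σ-constant : ∀ r x → Σ< r (λ _ → x) ≡ + r ℤ.* x
      Σ-constant zero    x = refl
      Σ-constant (suc r) x = trans (cong (ℤ._+ x) (Σ-constant r x)) (trans (lemma (+ r) x) (cong (ℤ._* x) (cong +_ (ℕ.+-comm r 1))))
        where
        lemma : ∀ r x → r ℤ.* x ℤ.+ x ≡ (r ℤ.+ 1ℤ) ℤ.* x
        lemma = ℤ-Solver.solve-∀

    -- The entries at 0 and 1 are a zero and a one in some order, so the number of ones is neither 0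
    -- nor q; both positions exist because q ≥ 2.
    varying-count : φ 1 0 ≢ φ 0 0 → ∀ {q} → 2 ≤ q → ∃[ k ] (Σ< q (λ i → φ i 0) ≡ + k × 0 < k × k < q)
    varying-count varies {q} 2≤q = count , total , by-values (zeroOne 0 0) (zeroOne 1 0)
      where
      open Count (count-zeroOne (λ i → zeroOne i 0) q)
      0<q : 0 < q
      0<q = ℕ.<-≤-trans (s≤s z≤n) 2≤q
      by-values : ZeroOne (φ 0 0) → ZeroOne (φ 1 0) → 0 < count × count < q
      by-values (inj₁ a) (inj₁ b) = ⊥-elim (varies (trans b (sym a)))
      by-values (inj₂ a) (inj₂ b) = ⊥-elim (varies (trans b (sym a)))
      by-values (inj₁ a) (inj₂ b) = positive 2≤q b , proper 0<q a
      by-values (inj₂ a) (inj₁ b) = positive 0<q a , proper 2≤q b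

  -- The first table sums to r k with 0 < k < q, the second to a multiple of q.
  no-equal-sums : ∀ {q r} → Coprime q r → 2 ≤ q → ∀ φ φ′ →
    (∀ i j → ZeroOne (φ i j)) → (∀ i j → ZeroOne (φ′ i j)) → Additive φ → Additive φ′ →
    φ 1 0 ≢ φ 0 0 → φ′ 0 1 ≢ φ′ 0 0 →
    Σ< q (λ i → Σ< r (φ i)) ≢ Σ< q (λ i → Σ< r (φ′ i))
  no-equal-sums {q} {r} co 2≤q φ φ′ z z′ add add′ varies varies′ equal =
    ℕ.<⇒≱ k<q (∣⇒≤ {{ℕ.>-nonZero 0<k}} (coprime-divisor co q∣rk))
    where
    counted = varying-count φ z add varies 2≤q
    k = proj₁ counted
    0<k = proj₁ (proj₂ (proj₂ counted))
    k<q = proj₂ (proj₂ (proj₂ counted))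
    L = Σ< r (λ j → φ′ 0 j)
    rk≡qL : + r ℤ.* + k ≡ + q ℤ.* L
    rk≡qL = begin
      + r ℤ.* + k                       ≡⟨ cong (+ r ℤ.*_) (proj₁ (proj₂ counted)) ⟨
      + r ℤ.* Σ< q (λ i → φ i 0)        ≡⟨ row-sums φ z add varies q r ⟨
      Σ< q (λ i → Σ< r (φ i))           ≡⟨ equal ⟩
      Σ< q (λ i → Σ< r (φ′ i))          ≡⟨ Σ-swap q r φ′ ⟩
      -- The second table varies with its other index, so `row-sums` applies to its transpose.
      Σ< r (λ j → Σ< q (λ i → φ′ i j))  ≡⟨ row-sums (λ j i → φ′ i j) (λ j i → z′ i j) (λ j i → trans (add′ i j) (ℤ.+-comm (φ′ (suc i) j) (φ′ i (suc j)))) varies′ r q ⟩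
      + q ℤ.* L                         ∎
      where open ≡-Reasoning
    q∣rk : q ∣ r ℕ.* k
    q∣rk = divides ∣ L ∣ (begin
      r ℕ.* k                  ≡⟨ ℤ.abs-* (+ r) (+ k) ⟨
      ∣ + r ℤ.* + k ∣          ≡⟨ cong ∣_∣ rk≡qL ⟩
      ∣ + q ℤ.* L ∣            ≡⟨ ℤ.abs-* (+ q) L ⟩
      q ℕ.* ∣ L ∣              ≡⟨ ℕ.*-comm q ∣ L ∣ ⟩
      ∣ L ∣ ℕ.* q              ∎)
      where open ≡-Reasoning

-- Compatibility of the phases of two orders.

module Clash where

  open import Data.Nat as ℕ using (ℕ; zero; suc; NonZero; _≤_; _+_; _*_; _^_)
  import Data.Nat.Properties as ℕ
  open import Data.Nat.Divisibility
  open import Data.Nat.GCD using (gcd; gcd[m,n]∣m; gcd[m,n]∣n; gcd[m,n]≢0; c*gcd[m,n]≡gcd[cm,cn])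
  open import Data.Nat.Coprimality as Coprime using (Coprime; coprime-divisor; gcd≡1⇒coprime)
  open import Data.Nat.Primality
  import Data.Nat.Tactic.RingSolver as ℕ-Solver
  open import Data.Integer as ℤ using (ℤ; +_; 0ℤ)
  import Data.Integer.Properties as ℤ
  import Data.Integer.Tactic.RingSolver as ℤ-Solver
  open import Data.Nat.ListAction using (product)
  open import Data.List.Base using ([]; length)
  open import Data.List.Relation.Unary.All using (All)
  open import Relation.Binary.PropositionalEquality hiding (resp; setoid)
  open Arith
  open RingTheory
  open GroupRing hiding (module A)
  open Cyclotomic hiding (module Z; module ZD; _≋_)
  open Phases
  open Deck
  open Table

  ∼-cancel-coprime : ∀ {c i j d} → Coprime d c → c * i ∼ c * j [ d ] → i ∼ j [ d ]
  ∼-cancel-coprime {c} {i} {j} {d} co e =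
    ∣dist⇒∼ (coprime-divisor co (subst (d ∣_) (sym (ℕ.*-distribˡ-∣-∣ c i j)) (∼⇒∣dist e)))

  prime-coprime : ∀ {p k} → Prime p → ¬ p ∣ k → Coprime p k
  prime-coprime p-prime p∤k {x} (x∣p , x∣k) = by-cases (prime⇒irreducible p-prime x∣p)
    where
    by-cases : x ≡ 1 ⊎ x ≡ _ → x ≡ 1
    by-cases (inj₁ x≡1) = x≡1
    by-cases (inj₂ refl) = ⊥-elim (p∤k x∣k)

  primes-equal : ∀ {p q} → Prime p → Prime q → p ∣ q → p ≡ q
  primes-equal p-prime q-prime p∣q = by-cases (prime⇒irreducible q-prime p∣q)
    where
    by-cases : _ ≡ 1 ⊎ _ ≡ _ → _
    by-cases (inj₁ refl) = ⊥-elim (¬prime[1] p-prime)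
    by-cases (inj₂ p≡q) = p≡q

  prime∣^ : ∀ {x p} → Prime x → Prime p → ∀ k → x ∣ p ^ k → x ≡ p
  prime∣^ x-prime p-prime zero x∣1 = ⊥-elim (¬prime[1] (subst Prime (∣1⇒≡1 x∣1) x-prime))
  prime∣^ x-prime p-prime (suc k) x∣ = by-cases (euclidsLemma _ _ x-prime x∣)
    where
    by-cases : _ ⊎ _ → _
    by-cases (inj₁ x∣p) = primes-equal x-prime p-prime x∣p
    by-cases (inj₂ x∣p^k) = prime∣^ x-prime p-prime k x∣p^k

  module Compatibility (n : ℕ) .{{n≢0 : NonZero n}} (n-odd : ¬ 2 ∣ n) (f g : Element)
    (triple : ∀ a b c → n ∣ a + b + c → _≋_ n (σ a f ⊛ σ b f ⊛ σ c f) (σ a g ⊛ σ b g ⊛ σ c g))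
    (F₀≈G₀ : _≈ₑ_ n (σ 0 f) (σ 0 g)) (F₀≉0 : ¬ _≈ₑ_ n (σ 0 f) [])
    where

    open Ratio n n-odd using (_≈_)
    open SameDeck n n-odd f g triple F₀≈G₀ F₀≉0
    private
      module Z = Cyclotomic.Z n
      module ZD = Cyclotomic.ZD n
      module A = GroupRing.A n

    F≈0? : ∀ a → Dec (F a ≈ [])
    F≈0? a = _≈ₑ?_ n (F a) []

    n-nonZero : NonZero n
    n-nonZero = ℕ.≢-nonZero (ℕ.≢-nonZero⁻¹ n)

    -- The frequency q r m has order c = gcd d d′; it is the multiple of a and a′ that would link their phases.
    record Clash (a d a′ d′ : ℕ) : Set where
      field
        q r m : ℕ
        d≡cq : d ≡ gcd d d′ * q
        d′≡cr : d′ ≡ gcd d d′ * r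
        q⊥r : Coprime q r
        c≢1 : gcd d d′ ≢ 1
        q≢1 : q ≢ 1
        r≢1 : r ≢ 1
        n≡cqrm : n ≡ gcd d d′ * q * r * m
        a≡rm : a ≡ r * m
        a′≡qm : a′ ≡ q * m
        F≈0 : F (q * r * m) ≈ []

    -- With d = c q and d′ = c r the equation a q = a′ r and the coprimality of q and r give a = r m
    -- and a′ = q m. So b = q r m is a common multiple of a and a′, of order exactly c; a nonzero
    -- `F b` compares the phases modulo c.
    agree-or-clash : ∀ {a d t a′ d′ t′} → n ≡ a * d → n ≡ a′ * d′ → ¬ F a ≈ [] → ¬ F a′ ≈ [] →
                     Phase a t → Phase a′ t′ → t ∼ t′ [ gcd d d′ ] ⊎ Clash a d a′ d′
    agree-or-clash {a} {d} {t} {a′} {d′} {t′} n≡ad n≡a′d′ F≉0 F≉0′ P P′ =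
      by-quotients (gcd[m,n]∣m d d′) (gcd[m,n]∣n d d′)
      where
      c = gcd d d′
      instance
        d≢0 : NonZero d
        d≢0 = ℕ.m*n≢0⇒n≢0 a {{subst NonZero n≡ad n-nonZero}}
        c≢0 : NonZero c
        c≢0 = ℕ.≢-nonZero (gcd[m,n]≢0 d d′ (inj₁ (ℕ.≢-nonZero⁻¹ d)))
      by-quotients : c ∣ d → c ∣ d′ → t ∼ t′ [ c ] ⊎ Clash a d a′ d′
      by-quotients (divides q d≡qc) (divides r d′≡rc) = by-common r∣a
        where
        d≡cq : d ≡ c * q
        d≡cq = trans d≡qc (ℕ.*-comm q c)
        d′≡cr : d′ ≡ c * r
        d′≡cr = trans d′≡rc (ℕ.*-comm r c)
        q⊥r : Coprime q r
        q⊥r = gcd≡1⇒coprime (ℕ.*-cancelˡ-≡ _ _ c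
          (trans (c*gcd[m,n]≡gcd[cm,cn] c q r) (trans (cong₂ gcd (sym d≡cq) (sym d′≡cr)) (sym (ℕ.*-identityʳ c)))))
        aq≡a′r : a * q ≡ a′ * r
        aq≡a′r = ℕ.*-cancelʳ-≡ (a * q) (a′ * r) c
          (trans (ℕ.*-assoc a q c) (trans (cong (a *_) (sym d≡qc)) (trans (sym n≡ad)
          (trans n≡a′d′ (trans (cong (a′ *_) d′≡rc) (sym (ℕ.*-assoc a′ r c)))))))
        r∣a : r ∣ a
        r∣a = coprime-divisor (Coprime.sym q⊥r) (divides a′ (trans (ℕ.*-comm q a) aq≡a′r))
        instance
          r≢0 : NonZero r
          r≢0 = ℕ.m*n≢0⇒m≢0 r {{subst NonZero d′≡rc (ℕ.m*n≢0⇒n≢0 a′ {{subst NonZero n≡a′d′ n-nonZero}})}}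
        by-common : r ∣ a → t ∼ t′ [ c ] ⊎ Clash a d a′ d′
        by-common (divides m a≡mr) = by-dec (F≈0? b)
          where
          b = q * r * m
          a≡rm : a ≡ r * m
          a≡rm = trans a≡mr (ℕ.*-comm m r)
          rearrange₁ : ∀ m r q → m * r * q ≡ q * m * r
          rearrange₁ = ℕ-Solver.solve-∀
          a′≡qm : a′ ≡ q * m
          a′≡qm = ℕ.*-cancelʳ-≡ a′ (q * m) r (trans (sym aq≡a′r) (trans (cong (_* q) a≡mr) (rearrange₁ m r q)))
          rearrange₂ : ∀ m r q c → m * r * (q * c) ≡ c * q * r * m
          rearrange₂ = ℕ-Solver.solve-∀
          n≡cqrm : n ≡ c * q * r * m
          n≡cqrm = trans n≡ad (trans (cong₂ ℕ._*_ a≡mr d≡qc) (rearrange₂ m r q c))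
          rearrange₃ : ∀ c q r m → c * q * r * m ≡ q * r * m * c
          rearrange₃ = ℕ-Solver.solve-∀
          n≡bc : n ≡ b * c
          n≡bc = trans n≡cqrm (rearrange₃ c q r m)
          instance
            b≢0 : NonZero b
            b≢0 = ℕ.m*n≢0⇒m≢0 b {{subst NonZero n≡bc n-nonZero}}
          qa≡b : q * a ≡ b
          qa≡b = trans (cong (q *_) a≡rm) (sym (ℕ.*-assoc q r m))
          rearrange₄ : ∀ r q m → r * (q * m) ≡ q * r * m
          rearrange₄ = ℕ-Solver.solve-∀
          ra′≡b : r * a′ ≡ b
          ra′≡b = trans (cong (r *_) a′≡qm) (rearrange₄ r q m)
          by-dec : Dec (F b ≈ []) → t ∼ t′ [ c ] ⊎ Clash a d a′ d′
          by-dec (no Fb≉0) = inj₁ (∼-cancel-* b (subst (b * t ∼ b * t′ [_]) n≡bc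
            (phases-agree {m = q} {m′ = r} P P′ qa≡b ra′≡b Fb≉0)))
          by-dec (yes Fb≈0) = inj₂ record
            { q = q ; r = r ; m = m ; d≡cq = d≡cq ; d′≡cr = d′≡cr ; q⊥r = q⊥r
            -- In each degenerate case b is a frequency known to lie in the support: n, that is 0,
            -- for c = 1; a for q = 1; a′ for r = 1.
            ; c≢1 = λ c≡1 → F₀≉0 (Z.trans (Z.sym (F-∼ {b} {0} (∣⇒∼0
                (subst (n ∣_) (trans n≡bc (trans (cong (b *_) c≡1) (ℕ.*-identityʳ b))) ∣-refl)))) Fb≈0)
            ; q≢1 = λ q≡1 → F≉0 (subst (λ x → F x ≈ [])
                (trans (sym qa≡b) (trans (cong (_* a) q≡1) (ℕ.*-identityˡ a))) Fb≈0)
            ; r≢1 = λ r≡1 → F≉0′ (subst (λ x → F x ≈ [])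
                (trans (sym ra′≡b) (trans (cong (_* a′) r≡1) (ℕ.*-identityˡ a′))) Fb≈0)
            ; n≡cqrm = n≡cqrm ; a≡rm = a≡rm ; a′≡qm = a′≡qm ; F≈0 = Fb≈0 }

    compatible-by : (∀ {a d t a′ d′ t′} → ¬ F a ≈ [] → ¬ F a′ ≈ [] → Phase a t → Phase a′ t′ → Clash a d a′ d′ →
                     t ∼ t′ [ gcd d d′ ]) → Compatible
    compatible-by resolve {a} {d} {t} {a′} {d′} {t′} n≡ad n≡a′d′ F≉0 F≉0′ P P′ =
      by-cases (agree-or-clash n≡ad n≡a′d′ F≉0 F≉0′ P P′)
      where
      by-cases : t ∼ t′ [ gcd d d′ ] ⊎ Clash a d a′ d′ → t ∼ t′ [ gcd d d′ ]
      by-cases (inj₁ agree) = agree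
      by-cases (inj₂ clash) = resolve F≉0 F≉0′ P P′ clash

    -- A clash would yield coprime q and r, both different from 1 and both dividing a power of p;
    -- but p divides each of them.
    compatible-prime-power : ∀ {p k} → Prime p → n ≡ p ^ k → Compatible
    compatible-prime-power {p} {k} p-prime n≡p^k = compatible-by λ _ _ _ _ clash → ⊥-elim (impossible clash)
      where
      impossible : ∀ {a d a′ d′} → ¬ Clash a d a′ d′
      impossible {d = d} {d′ = d′} clash = coprime⇒no-common-prime q⊥r p-prime (divided q q≢1 q∣n) (divided r r≢1 r∣n)
        where
        open Clash clash
        c = gcd d d′
        divided : ∀ x → x ≢ 1 → x ∣ n → p ∣ x
        divided x x≢1 x∣n = by-prime (∃-prime-divisor x x≢1)
          where
          by-prime : ∃[ y ] (Prime y × y ∣ x) → p ∣ x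
          by-prime (y , y-prime , y∣x) =
            subst (_∣ x) (prime∣^ y-prime p-prime k (subst (y ∣_) n≡p^k (∣-trans y∣x x∣n))) y∣x
        rearrange : ∀ c q r m → c * q * r * m ≡ c * r * m * q
        rearrange = ℕ-Solver.solve-∀
        rearrange′ : ∀ c q r m → c * q * r * m ≡ c * q * m * r
        rearrange′ = ℕ-Solver.solve-∀
        q∣n : q ∣ n
        q∣n = divides (c * r * m) (trans n≡cqrm (rearrange c q r m))
        r∣n : r ∣ n
        r∣n = divides (c * q * m) (trans n≡cqrm (rearrange′ c q r m))

    -- Here p is the gcd of the orders p q and p r, whose frequencies are r and q; it may coincide
    -- with q or with r. That f takes only the values 0 and 1 decides the case in which no third
    -- order links the phases.
    module ThreePrimes (zeroOne : ∀ m → ZeroOne (coef n m f))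
      {p q r : ℕ} (p-prime : Prime p) (q-prime : Prime q) (r-prime : Prime r) (q≢r : q ≢ r)
      (n≡pqr : n ≡ p * q * r) (Fqr≈0 : F (q * r) ≈ []) (Fr≉0 : ¬ F r ≈ []) (Fq≉0 : ¬ F q ≈ [])
      where

      private
        instance
          p≢0 : NonZero p
          p≢0 = prime⇒nonZero p-prime
          q≢0 : NonZero q
          q≢0 = prime⇒nonZero q-prime
          r≢0 : NonZero r
          r≢0 = prime⇒nonZero r-prime

        n≡rpq : n ≡ r * (p * q)
        n≡rpq = trans n≡pqr (ℕ.*-comm (p * q) r)
        n≡qpr : n ≡ q * (p * r)
        n≡qpr = trans n≡pqr (lemma p q r)
          where
          lemma : ∀ p q r → p * q * r ≡ q * (p * r)
          lemma = ℕ-Solver.solve-∀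
        n≡pqr′ : n ≡ p * (q * r)
        n≡pqr′ = trans n≡pqr (ℕ.*-assoc p q r)
        n≡qrp : n ≡ (q * r) * p
        n≡qrp = trans n≡pqr′ (ℕ.*-comm p (q * r))

        q⊥r : Coprime q r
        q⊥r = prime-coprime q-prime λ q∣r → q≢r (primes-equal q-prime r-prime q∣r)

        -- Generators of the subgroups of order q and r in ℤ/n. As q and r are coprime, the points x
        -- + i h + j k with i < q and j < r run once through the coset of x modulo the subgroup of
        -- order q r.
        h k : ℕ
        h = p * r
        k = p * q

      -- Multiplication by S h moves the coefficient at m + h to m.
      S : ℕ → Element
      S h = X (neg h)

      coef-difference : ∀ m h a → coef n m (1-X n (neg h) ⊛ a) ≡ coef n m a ℤ.+ (ℤ.- coef n (m + h) a)
      coef-difference m h a = trans (coef-1-X n m (neg h) a)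
        (cong (λ z → coef n m a ℤ.+ (ℤ.- z)) (coef-∼ n (∼-+ (∼-refl {m}) negneg) a))
        where
        negneg : neg (neg h) ∼ h [ n ]
        negneg = ∼-+-cancelˡ (neg h) (∼-trans (∣⇒∼0 (n∣a+neg (neg h)))
          (∼-sym (subst (_∼ 0 [ n ]) (ℕ.+-comm h (neg h)) (∣⇒∼0 (n∣a+neg h)))))

      n∣neg⇒n∣ : ∀ x h → n ∣ x * neg h → n ∣ x * h
      n∣neg⇒n∣ x h n∣ = ∣m+n∣m⇒∣n (subst (n ∣_) (ℕ.+-comm (x * h) (x * neg h))
        (subst (n ∣_) (ℕ.*-distribˡ-+ x h (neg h)) (∣n⇒∣m*n x (n∣a+neg h)))) n∣

      n∣⇒n∣neg : ∀ x h → n ∣ x * h → n ∣ x * neg h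
      n∣⇒n∣neg x h n∣ = subst (n ∣_) (lemma (ℕ.pred n) x h) (∣n⇒∣m*n (ℕ.pred n) n∣)
        where
        lemma : ∀ r x h → r * (x * h) ≡ x * (r * h)
        lemma = ℕ-Solver.solve-∀

      σ-difference : ∀ x h a → σ x (1-X n (neg h) ⊛ a) ≈ 1-X n (x * neg h) ⊛ σ x a
      σ-difference x h a = Z.trans (σ-*ₑ n x (1-X n (neg h)) a) (Z.*-congʳ {σ x a} (≈⇒≈ₑ n (σ-1-X n x (neg h))))

      orbit-sum : ℕ → ℕ → Element
      orbit-sum h q = A.geo (X 0) (S h) q

      coef-orbit-sum : ∀ m h q a → coef n m (orbit-sum h q ⊛ a) ≡ ℤR.Σ< q (λ i → coef n (m + i * h) a)
      coef-orbit-sum m h q a = begin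
        coef n m (orbit-sum h q ⊛ a)                            ≡⟨ coef-cong n m (A.*-congʳ {a} (A.geo-as-Σ (S h) q)) ⟩
        coef n m (A.Σ< q (S h A.^_) ⊛ a)                        ≡⟨ coef-cong n m (A.Σ-*ʳ q a (S h A.^_)) ⟩
        coef n m (A.Σ< q (λ i → S h A.^ i ⊛ a))                 ≡⟨ coef-Σ q ⟩
        ℤR.Σ< q (λ i → coef n m (S h A.^ i ⊛ a))                ≡⟨ ℤR.Σ-cong q (λ {i} _ → term i) ⟩
        ℤR.Σ< q (λ i → coef n (m + i * h) a)                ∎
        where
        open ≡-Reasoning
        coef-Σ : ∀ q → coef n m (A.Σ< q (λ i → S h A.^ i ⊛ a)) ≡ ℤR.Σ< q (λ i → coef n m (S h A.^ i ⊛ a))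
        coef-Σ zero    = refl
        coef-Σ (suc q) = trans (∫-⊕ (A.Σ< q (λ i → S h A.^ i ⊛ a)) (S h A.^ q ⊛ a) (δ n m))
          (cong (ℤ._+ coef n m (S h A.^ q ⊛ a)) (coef-Σ q))
        term : ∀ i → coef n m (S h A.^ i ⊛ a) ≡ coef n (m + i * h) a
        term i = trans (coef-cong n m (A.*-congʳ {a} (X-^ n (neg h) i)))
          (trans (coef-∼ n (∼-sym back) (X (i * neg h) ⊛ a)) (coef-shift n (m + i * h) (i * neg h) a))
          where
          rearrange : ∀ x y m → y + (m + x) ≡ (x + y) + m
          rearrange = ℕ-Solver.solve-∀
          back : i * neg h + (m + i * h) ∼ m [ n ]
          back = ∼-trans (∼-reflexive (rearrange (i * h) (i * neg h) m)) (∼-+ (∣⇒∼0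
            (subst (n ∣_) (ℕ.*-distribˡ-+ i h (neg h)) (∣n⇒∣m*n i (n∣a+neg h)))) (∼-refl {m}))

      -- At a frequency x nontrivial on h the orbit sum is a full geometric series of a nontrivial
      -- root of unity: it telescopes after multiplication by a regular factor.
      σ-orbit-sum : ∀ x h q → n ∣ q * h → ¬ n ∣ x * h → σ x (orbit-sum h q) ≈ []
      σ-orbit-sum x h q n∣qh n∤xh = 1-X-regular n {x * neg h} (λ n∣ → n∤xh (n∣neg⇒n∣ x h n∣)) (Z.begin
        1-X n (x * neg h) ⊛ σ x (orbit-sum h q)      Z.≈⟨ σ-difference x h (orbit-sum h q) ⟨
        σ x (1-X n (neg h) ⊛ orbit-sum h q)            Z.≈⟨ ≈⇒≈ₑ n (σ-cong n x telescoped) ⟩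
        σ x []                                         Z.≈⟨ Z.reflexive (σ-[] x) ⟩
        []                                             Z.∎)
        where
        telescoped : _≋_ n (1-X n (neg h) ⊛ orbit-sum h q) []
        telescoped = A.trans (A.geo-1 (S h) q) (A.trans (A.+-congˡ {X 0} (A.-‿cong (X-^ n (neg h) q)))
          (1-X-zero n (n∣⇒n∣neg q h n∣qh)))

      -- The case in which no order links the phases, to be refuted. If p is q or r, then the
      -- frequency p is itself divisible by q or r and may lie in the support; only for p different
      -- from both must it be excluded.
      module _ (F1≈0 : F 1 ≈ []) (Fp≈0 : p ≡ q ⊎ p ≡ r ⊎ F p ≈ []) where

        -- If x is divisible by neither q nor r, then gcd x n divides p, so x is a unit multiple of
        -- 1 or of p.
        support : ∀ x → F x ≈ [] ⊎ (r ∣ x ⊎ q ∣ x)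
        support x = decide (r ∣? x) (q ∣? x)
          where
          a = gcd x n
          a∣x = gcd[m,n]∣m x n
          a∣n = gcd[m,n]∣n x n
          unit = gcd-unit-multiple x n
          u = proj₁ unit
          co : Coprime u n
          co = proj₁ (proj₂ unit)
          decide : Dec (r ∣ x) → Dec (q ∣ x) → F x ≈ [] ⊎ (r ∣ x ⊎ q ∣ x)
          decide (yes r∣x) _ = inj₂ (inj₁ r∣x)
          decide (no _) (yes q∣x) = inj₂ (inj₂ q∣x)
          decide (no r∤x) (no q∤x) = inj₁ (Z.trans (F-∼ (subst (x ∼_[ n ]) (ℕ.*-comm a u) (proj₂ (proj₂ unit))))
              (conj-≈0 f co (by-divisor (prime⇒irreducible p-prime a∣p))))
            where
            a⊥ : ∀ {y} → Prime y → ¬ y ∣ x → Coprime a y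
            a⊥ y-prime y∤x = Coprime.sym (prime-coprime y-prime (λ y∣a → y∤x (∣-trans y∣a a∣x)))
            a∣p : a ∣ p
            a∣p = coprime-divisor (a⊥ q-prime q∤x) (coprime-divisor (a⊥ r-prime r∤x)
              (subst (a ∣_) (trans n≡rpq (cong (r *_) (ℕ.*-comm p q))) a∣n))
            by-divisor : a ≡ 1 ⊎ a ≡ p → F a ≈ []
            by-divisor (inj₁ a≡1) = subst (λ y → F y ≈ []) (sym a≡1) F1≈0
            by-divisor (inj₂ a≡p) = by-p Fp≈0
              where
              by-p : p ≡ q ⊎ p ≡ r ⊎ F p ≈ [] → F a ≈ []
              by-p (inj₁ p≡q) = ⊥-elim (q∤x (subst (_∣ x) (trans a≡p p≡q) a∣x))
              by-p (inj₂ (inj₁ p≡r)) = ⊥-elim (r∤x (subst (_∣ x) (trans a≡p p≡r) a∣x))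
              by-p (inj₂ (inj₂ e)) = subst (λ y → F y ≈ []) (sym a≡p) e

        n∣r*k : ∀ {x} → r ∣ x → n ∣ x * k
        n∣r*k {x} r∣x = subst (_∣ x * k) (sym n≡rpq) (*-monoˡ-∣ (p * q) r∣x)

        n∣q*h : ∀ {x} → q ∣ x → n ∣ x * h
        n∣q*h {x} q∣x = subst (_∣ x * h) (sym n≡qpr) (*-monoˡ-∣ (p * r) q∣x)

        n∣xh⇒q∣x : ∀ {x} → n ∣ x * h → q ∣ x
        n∣xh⇒q∣x {x} n∣ = *-cancelʳ-∣ h {{ℕ.m*n≢0 p r}} (subst (_∣ x * h) n≡qpr n∣)

        n∣xk⇒r∣x : ∀ {x} → n ∣ x * k → r ∣ x
        n∣xk⇒r∣x {x} n∣ = *-cancelʳ-∣ k {{ℕ.m*n≢0 p q}} (subst (_∣ x * k) n≡rpq n∣)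

        -- The difference along k kills the frequencies divisible by r, the difference along h those
        -- divisible by q, and by `support` F vanishes at all others. This is the splitting u(y) +
        -- v(z) on the cosets.
        mixed-difference : _≋_ n (1-X n (neg h) ⊛ (1-X n (neg k) ⊛ f)) []
        mixed-difference = fourier-injective n λ x → Z.trans (Z.trans (σ-difference x h (1-X n (neg k) ⊛ f))
            (Z.*-congˡ {1-X n (x * neg h)} (σ-difference x k f))) (vanish x (support x))
          where
          vanish : ∀ x → F x ≈ [] ⊎ (r ∣ x ⊎ q ∣ x) → 1-X n (x * neg h) ⊛ (1-X n (x * neg k) ⊛ F x) ≈ []
          vanish x (inj₁ F≈0) = Z.trans (Z.*-congˡ {1-X n (x * neg h)} (Z.trans (Z.*-congˡ {1-X n (x * neg k)} F≈0) (Z.zeroʳ _))) (Z.zeroʳ _)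
          vanish x (inj₂ (inj₁ r∣x)) = Z.trans (Z.*-congˡ {1-X n (x * neg h)}
            (Z.trans (Z.*-congʳ {F x} (≈⇒≈ₑ n (1-X-zero n (n∣⇒n∣neg x k (n∣r*k r∣x))))) (Z.zeroˡ (F x)))) (Z.zeroʳ _)
          vanish x (inj₂ (inj₂ q∣x)) = Z.trans (Z.*-congʳ {1-X n (x * neg k) ⊛ F x}
            (≈⇒≈ₑ n (1-X-zero n (n∣⇒n∣neg x h (n∣q*h q∣x))))) (Z.zeroˡ _)

        block-sum : Element
        block-sum = orbit-sum h q ⊛ (orbit-sum k r ⊛ f)

        -- Summation over the cosets of the subgroup of order q r keeps only the frequencies
        -- divisible by q r. Those of order p are absent from the support because F(q r) = 0, which
        -- leaves frequency 0, a constant.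
        block-sum-invariant : _≋_ n (1-X n (neg 1) ⊛ block-sum) []
        block-sum-invariant = fourier-injective n λ x → Z.trans (σ-difference x 1 block-sum) (vanish x (q ∣? x) (r ∣? x))
          where
          D : ℕ → Element
          D x = 1-X n (x * neg 1)
          split : ∀ x → σ x block-sum ≈ σ x (orbit-sum h q) ⊛ (σ x (orbit-sum k r) ⊛ F x)
          split x = Z.trans (σ-*ₑ n x (orbit-sum h q) (orbit-sum k r ⊛ f))
            (Z.*-congˡ {σ x (orbit-sum h q)} (σ-*ₑ n x (orbit-sum k r) f))
          at-multiple : ∀ m → Dec (p ∣ m) → D (m * (q * r)) ⊛ σ (m * (q * r)) block-sum ≈ []
          at-multiple m (yes p∣m) = Z.trans (Z.*-congʳ {σ (m * (q * r)) block-sum}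
            (≈⇒≈ₑ n (1-X-zero n (n∣⇒n∣neg (m * (q * r)) 1 (∣m⇒∣m*n 1 n∣mqr))))) (Z.zeroˡ _)
            where
            n∣mqr : n ∣ m * (q * r)
            n∣mqr = subst (_∣ m * (q * r)) (sym n≡pqr′) (*-monoˡ-∣ (q * r) p∣m)
          at-multiple m (no p∤m) = Z.trans (Z.*-congˡ {D x} (Z.trans (split x)
              (Z.trans (Z.*-congˡ {σ x (orbit-sum h q)} (Z.trans (Z.*-congˡ {σ x (orbit-sum k r)} Fx≈0) (Z.zeroʳ _))) (Z.zeroʳ _)))) (Z.zeroʳ (D x))
            where
            x = m * (q * r)
            Fx≈0 : F x ≈ []
            Fx≈0 = class-≈0 {q * r} {p} {m} n≡qrp Fqr≈0 (Coprime.sym (prime-coprime p-prime p∤m))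
          vanish : ∀ x → Dec (q ∣ x) → Dec (r ∣ x) → D x ⊛ σ x block-sum ≈ []
          vanish x (no q∤x) _ = Z.trans (Z.*-congˡ {D x} (Z.trans (split x) (Z.trans (Z.*-congʳ {σ x (orbit-sum k r) ⊛ F x}
            (σ-orbit-sum x h q (n∣q*h ∣-refl) (λ n∣ → q∤x (n∣xh⇒q∣x n∣)))) (Z.zeroˡ _)))) (Z.zeroʳ (D x))
          vanish x (yes _) (no r∤x) = Z.trans (Z.*-congˡ {D x} (Z.trans (split x) (Z.trans (Z.*-congˡ {σ x (orbit-sum h q)}
            (Z.trans (Z.*-congʳ {F x} (σ-orbit-sum x k r (n∣r*k ∣-refl) (λ n∣ → r∤x (n∣xk⇒r∣x n∣)))) (Z.zeroˡ (F x)))) (Z.zeroʳ _)))) (Z.zeroʳ (D x))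
          vanish x (yes (divides y x≡yq)) (yes r∣x) = by-quotient
            (coprime-divisor (Coprime.sym q⊥r) (subst (r ∣_) (trans x≡yq (ℕ.*-comm y q)) r∣x))
            where
            by-quotient : r ∣ y → D x ⊛ σ x block-sum ≈ []
            by-quotient (divides m y≡mr) = subst (λ x → D x ⊛ σ x block-sum ≈ []) (sym x≡) (at-multiple m (p ∣? m))
              where
              lemma : ∀ m r q → m * r * q ≡ m * (q * r)
              lemma = ℕ-Solver.solve-∀
              x≡ : x ≡ m * (q * r)
              x≡ = trans x≡yq (trans (cong (_* q) y≡mr) (lemma m r q))

        table : ℕ → ℕ → ℕ → ℤ
        table x i j = coef n (x + i * h + j * k) f

        table-zeroOne : ∀ x i j → ZeroOne (table x i j)
        table-zeroOne x i j = zeroOne (x + i * h + j * k)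

        private
          zero-difference : ∀ {a b} → a ℤ.+ (ℤ.- b) ≡ 0ℤ → a ≡ b
          zero-difference {a} {b} = ℤ.i-j≡0⇒i≡j a b

        table-additive : ∀ x → Additive (table x)
        table-additive x i j = begin
          coef n m f ℤ.+ table x (suc i) (suc j)                      ≡⟨ cong (λ y → coef n m f ℤ.+ coef n y f) (lemma₁ x i j h k) ⟩
          coef n m f ℤ.+ coef n (m + h + k) f                     ≡⟨ square (coef n m f) (coef n (m + k) f) (coef n (m + h) f) (coef n (m + h + k) f) vanishing ⟩
          coef n (m + h) f ℤ.+ coef n (m + k) f                   ≡⟨ cong₂ (λ y z → coef n y f ℤ.+ coef n z f) (lemma₂ x i j h k) (lemma₃ x i j h k) ⟩
          table x (suc i) j ℤ.+ table x i (suc j)                     ∎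
          where
          open ≡-Reasoning
          m = x + i * h + j * k
          lemma₁ : ∀ x i j h k → x + suc i * h + suc j * k ≡ x + i * h + j * k + h + k
          lemma₁ = ℕ-Solver.solve-∀
          lemma₂ : ∀ x i j h k → x + i * h + j * k + h ≡ x + suc i * h + j * k
          lemma₂ = ℕ-Solver.solve-∀
          lemma₃ : ∀ x i j h k → x + i * h + j * k + k ≡ x + i * h + suc j * k
          lemma₃ = ℕ-Solver.solve-∀
          square : ∀ a b c d → (a ℤ.+ (ℤ.- b)) ℤ.+ (ℤ.- (c ℤ.+ (ℤ.- d))) ≡ 0ℤ → a ℤ.+ d ≡ c ℤ.+ b
          square a b c d e = zero-difference (trans (shuffle a b c d) e)
            where
            shuffle : ∀ a b c d → a ℤ.+ d ℤ.+ (ℤ.- (c ℤ.+ b)) ≡ (a ℤ.+ (ℤ.- b)) ℤ.+ (ℤ.- (c ℤ.+ (ℤ.- d)))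
            shuffle = ℤ-Solver.solve-∀
          vanishing : (coef n m f ℤ.+ (ℤ.- coef n (m + k) f)) ℤ.+ (ℤ.- (coef n (m + h) f ℤ.+ (ℤ.- coef n (m + h + k) f))) ≡ 0ℤ
          vanishing = trans (sym (cong₂ (λ y z → y ℤ.+ (ℤ.- z)) (coef-difference m k f) (coef-difference (m + h) k f)))
            (trans (sym (coef-difference m h (1-X n (neg k) ⊛ f))) (coef-cong n m mixed-difference))

        table-sum : ∀ x → ℤR.Σ< q (λ i → ℤR.Σ< r (table x i)) ≡ coef n x block-sum
        table-sum x = sym (trans (coef-orbit-sum x h q (orbit-sum k r ⊛ f))
          (ℤR.Σ-cong q λ {i} _ → coef-orbit-sum (x + i * h) k r f))

        block-sum-constant : ∀ x → coef n x block-sum ≡ coef n 0 block-sum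
        block-sum-constant zero    = refl
        block-sum-constant (suc x) = trans (cong (λ y → coef n y block-sum) (ℕ.+-comm 1 x))
          (trans (sym (zero-difference (trans (sym (coef-difference x 1 block-sum)) (coef-cong n x block-sum-invariant))))
            (block-sum-constant x))

        -- If y were a period of f, then (1 - ζ^(-by)) F b would be zero although the first factor
        -- is regular.
        varies : ∀ {b} y → ¬ F b ≈ [] → ¬ n ∣ b * y → ∃[ x ] coef n x f ≢ coef n (x + y) f
        varies {b} y F≉0 n∤ = by-cases (zero-or-coef n (1-X n (neg y) ⊛ f))
          where
          by-cases : _≋_ n (1-X n (neg y) ⊛ f) [] ⊎ ∃[ x ] coef n x (1-X n (neg y) ⊛ f) ≢ 0ℤ →
                     ∃[ x ] coef n x f ≢ coef n (x + y) f
          by-cases (inj₂ (x , ≢0)) = x , λ e → ≢0 (trans (coef-difference x y f) (ℤ.i≡j⇒i-j≡0 e))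
          by-cases (inj₁ invariant) = ⊥-elim (F≉0 (1-X-regular n {b * neg y} (λ n∣ → n∤ (n∣neg⇒n∣ b y n∣))
            (Z.trans (Z.sym (σ-difference b y f)) (Z.trans (≈⇒≈ₑ n (σ-cong n b invariant)) (Z.reflexive (σ-[] b))))))

        contradiction : ⊥
        contradiction = no-equal-sums q⊥r (prime≥2 q-prime) (table x) (table x′) (table-zeroOne x) (table-zeroOne x′)
          (table-additive x) (table-additive x′)
          (λ e → proj₂ first (sym (trans (cong (λ y → coef n y f) (at₁ x h)) (trans e (cong (λ y → coef n y f) (at₀ x))))))
          (λ e → proj₂ second (sym (trans (cong (λ y → coef n y f) (at₂ x′ k)) (trans e (cong (λ y → coef n y f) (at₀ x′))))))
          (trans (table-sum x) (trans (block-sum-constant x) (sym (trans (table-sum x′) (block-sum-constant x′)))))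
          where
          -- The frequency r detects the shift h, since n ∣ r h would force q ∣ r; likewise the
          -- frequency q detects k. The two base points may lie in different cosets, which is why
          -- constant coset sums are needed.
          first = varies {r} h Fr≉0 (λ n∣ → q≢r (primes-equal q-prime r-prime (n∣xh⇒q∣x n∣)))
          second = varies {q} k Fq≉0 (λ n∣ → q≢r (sym (primes-equal r-prime q-prime (n∣xk⇒r∣x n∣))))
          x = proj₁ first
          x′ = proj₁ second
          at₀ : ∀ x → x + 0 + 0 ≡ x
          at₀ = ℕ-Solver.solve-∀
          at₁ : ∀ x h → x + h ≡ x + (h + 0) + 0
          at₁ = ℕ-Solver.solve-∀
          at₂ : ∀ x k → x + k ≡ x + 0 + (k + 0)
          at₂ = ℕ-Solver.solve-∀

      module _ {t t′} (P : Phase r t) (P′ : Phase q t′) where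

        agree-through-1 : ¬ F 1 ≈ [] → t ∼ t′ [ p ]
        agree-through-1 F1≉0 = ∼-trans (∼-sym (∼-weaken (m∣m*n q) t₁∼t)) (∼-weaken (m∣m*n r) t₁∼t′)
          where
          found = phase 1 n (sym (ℕ.*-identityˡ n)) F1≉0
          t₁ = proj₁ found
          t₁∼t : t₁ ∼ t [ p * q ]
          t₁∼t = ∼-cancel-* r (subst (r * t₁ ∼ r * t [_]) n≡rpq
            (phases-agree {m = r} {m′ = 1} (proj₂ found) P (ℕ.*-identityʳ r) (ℕ.*-identityˡ r) Fr≉0))
          t₁∼t′ : t₁ ∼ t′ [ p * r ]
          t₁∼t′ = ∼-cancel-* q (subst (q * t₁ ∼ q * t′ [_]) n≡qpr
            (phases-agree {m = q} {m′ = 1} (proj₂ found) P′ (ℕ.*-identityʳ q) (ℕ.*-identityˡ q) Fq≉0))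

        -- r m₁ + q m₂ ≡ p m₃ (mod n) with m₁, m₂, m₃ units for the respective orders p q, p r and q r.
        agree-through-p : p ≢ q → p ≢ r → ¬ F p ≈ [] → t ∼ t′ [ p ]
        agree-through-p p≢q p≢r Fp≉0 = ∼-cancel-coprime p⊥i (∼-+-cancelʳ (j * t′) (∼-trans sum∼0 (∼-sym sum′∼0)))
          where
          -- With n - 1 acting as -1, the relation is r (q + p r) - q (r + p q) = p (r² - q²). The
          -- terms p r and p q keep m₁ and m₂ prime to q and r respectively.
          m₁ = q + p * r
          m₂ = ℕ.pred n * (r + p * q)
          m₃ = r * r + ℕ.pred n * (q * q)
          i = m₁ * r
          j = m₂ * q
          distinct : ∀ {x y} → Prime x → Prime y → x ≢ y → ¬ x ∣ y
          distinct x-prime y-prime x≢y x∣y = x≢y (primes-equal x-prime y-prime x∣y)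
          p∤q = distinct p-prime q-prime p≢q
          p∤r = distinct p-prime r-prime p≢r
          q∤p = distinct q-prime p-prime (λ e → p≢q (sym e))
          r∤p = distinct r-prime p-prime (λ e → p≢r (sym e))
          q∤r = distinct q-prime r-prime q≢r
          r∤q = distinct r-prime q-prime (λ e → q≢r (sym e))
          prime∤* : ∀ {x y z} → Prime x → ¬ x ∣ y → ¬ x ∣ z → ¬ x ∣ y * z
          prime∤* {x} {y} {z} x-prime x∤y x∤z x∣yz = by-cases (euclidsLemma y z x-prime x∣yz)
            where
            by-cases : x ∣ y ⊎ x ∣ z → ⊥
            by-cases (inj₁ x∣y) = x∤y x∣y
            by-cases (inj₂ x∣z) = x∤z x∣z
          ∤+ˡ : ∀ {x y z} → x ∣ z → ¬ x ∣ y → ¬ x ∣ y + z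
          ∤+ˡ {x} {y} {z} x∣z x∤y x∣ = x∤y (∣m+n∣m⇒∣n (subst (x ∣_) (ℕ.+-comm y z) x∣) x∣z)
          ∤+ʳ : ∀ {x y z} → x ∣ y → ¬ x ∣ z → ¬ x ∣ y + z
          ∤+ʳ x∣y x∤z x∣ = x∤z (∣m+n∣m⇒∣n x∣ x∣y)
          ∤pred : ∀ {x} → Prime x → x ∣ n → ¬ x ∣ ℕ.pred n
          ∤pred x-prime x∣n x∣pred = coprime⇒no-common-prime (coprime-pred n) x-prime x∣pred x∣n
          p∣n = divides (q * r) n≡qrp′
            where
            n≡qrp′ : n ≡ q * r * p
            n≡qrp′ = n≡qrp
          q∣n : q ∣ n
          q∣n = subst (q ∣_) (sym n≡qpr) (m∣m*n (p * r))
          r∣n : r ∣ n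
          r∣n = subst (r ∣_) (sym n≡rpq) (m∣m*n (p * q))
          coprime-two : ∀ {m x y} → Prime x → Prime y → ¬ x ∣ m → ¬ y ∣ m → Coprime m (x * y)
          coprime-two {m} {x} {y} x-prime y-prime x∤m y∤m {e} (e∣m , e∣xy) = by-dec (e ℕ.≟ 1)
            where
            by-dec : Dec (e ≡ 1) → e ≡ 1
            by-dec (yes e≡1) = e≡1
            by-dec (no e≢1) = ⊥-elim (by-prime (∃-prime-divisor e e≢1))
              where
              by-prime : ¬ (∃[ z ] (Prime z × z ∣ e))
              by-prime (z , z-prime , z∣e) = by-cases (euclidsLemma x y z-prime (∣-trans z∣e e∣xy))
                where
                z∣m = ∣-trans z∣e e∣m
                by-cases : ¬ (z ∣ x ⊎ z ∣ y)
                by-cases (inj₁ z∣x) = x∤m (subst (_∣ m) (primes-equal z-prime x-prime z∣x) z∣m)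
                by-cases (inj₂ z∣y) = y∤m (subst (_∣ m) (primes-equal z-prime y-prime z∣y) z∣m)
          p∤m₁ : ¬ p ∣ m₁
          p∤m₁ = ∤+ˡ (m∣m*n r) p∤q
          Fi≉0 : ¬ F i ≈ []
          Fi≉0 = class-≉0 {r} {p * q} {m₁} n≡rpq Fr≉0 (coprime-two p-prime q-prime p∤m₁
            (∤+ʳ ∣-refl (prime∤* q-prime q∤p q∤r)))
          Fj≉0 : ¬ F j ≈ []
          Fj≉0 = class-≉0 {q} {p * r} {m₂} n≡qpr Fq≉0 (coprime-two p-prime r-prime
            (prime∤* p-prime (∤pred p-prime p∣n) (∤+ˡ (m∣m*n q) p∤r))
            (prime∤* r-prime (∤pred r-prime r∣n) (∤+ʳ ∣-refl (prime∤* r-prime r∤p r∤q))))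
          Fpm₃≉0 : ¬ F (m₃ * p) ≈ []
          Fpm₃≉0 = class-≉0 {p} {q * r} {m₃} n≡pqr′ Fp≉0 (coprime-two q-prime r-prime
            (∤+ˡ (∣n⇒∣m*n (ℕ.pred n) (m∣m*n q)) (prime∤* q-prime q∤r q∤r))
            (∤+ʳ (m∣m*n r) (prime∤* r-prime (∤pred r-prime r∣n) (prime∤* r-prime r∤q r∤q))))
          rearrange : ∀ p q r N → (q + p * r) * r + (N * (r + p * q)) * q ≡
                                  (r * r + N * (q * q)) * p + q * r * suc N
          rearrange = ℕ-Solver.solve-∀
          i+j≡ : i + j ≡ m₃ * p + q * r * n
          i+j≡ = trans (rearrange p q r (ℕ.pred n)) (cong (λ x → m₃ * p + q * r * x) (ℕ.suc-pred n))
          i+j∼ : i + j ∼ m₃ * p [ n ]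
          i+j∼ = subst (_∼ m₃ * p [ n ]) (sym i+j≡) (∼+d (q * r))
          found = phase p (q * r) n≡pqr′ Fp≉0
          s = proj₁ found
          phases-sum : i * t + j * t′ ∼ m₃ * p * s [ n ]
          phases-sum = ∼-sym (X-injective n (ZD.*-cancelˡ (ZD.*-≉0 (ZD.*-≉0 Fi≉0 Fj≉0) Fpm₃≉0) (Z.begin
            (F i ⊛ F j ⊛ F b) ⊛ X (b * s)                       Z.≈⟨ lemma₁ (F i ⊛ F j) (F b) (X (b * s)) ⟩
            F i ⊛ F j ⊛ (X (b * s) ⊛ F b)                       Z.≈⟨ Z.*-congˡ {F i ⊛ F j} (Z.trans (Z.sym (proj₂ found m₃)) (Z.sym (G-∼ i+j∼))) ⟩
            F i ⊛ F j ⊛ G (i + j)                               Z.≈⟨ multiplicative i j ⟩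
            G i ⊛ G j ⊛ F (i + j)                               Z.≈⟨ Z.*-cong (Z.*-cong (P m₁) (P′ m₂)) (F-∼ i+j∼) ⟩
            (X (i * t) ⊛ F i) ⊛ (X (j * t′) ⊛ F j) ⊛ F b      Z.≈⟨ lemma₂ (X (i * t)) (F i) (X (j * t′)) (F j) (F b) ⟩
            (F i ⊛ F j ⊛ F b) ⊛ (X (i * t) ⊛ X (j * t′))      Z.≈⟨ Z.*-congˡ {F i ⊛ F j ⊛ F b} (≈⇒≈ₑ n (X-+ n (i * t) (j * t′))) ⟨
            (F i ⊛ F j ⊛ F b) ⊛ X (i * t + j * t′)          Z.∎)))
            where
            b = m₃ * p
            lemma₁ : ∀ y b x → (y ⊛ b) ⊛ x ≈ y ⊛ (x ⊛ b)
            lemma₁ = Z.solve 3 (λ y b x → (y Z.:* b) Z.:* x Z.:= y Z.:* (x Z.:* b)) Z.refl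
            lemma₂ : ∀ x i y j b → (x ⊛ i) ⊛ (y ⊛ j) ⊛ b ≈ (i ⊛ j ⊛ b) ⊛ (x ⊛ y)
            lemma₂ = Z.solve 5 (λ x i y j b → (x Z.:* i) Z.:* (y Z.:* j) Z.:* b Z.:= (i Z.:* j Z.:* b) Z.:* (x Z.:* y)) Z.refl
          -- Modulo p the phase s drops out, its frequency m₃ p being a multiple of p, and so does i
          -- + j. What remains is i t ∼ i t′ with i prime to p.
          sum∼0 : i * t + j * t′ ∼ 0 [ p ]
          sum∼0 = ∼-trans (∼-weaken p∣n phases-sum) (∣⇒∼0 (∣m⇒∣m*n s (n∣m*n m₃)))
          sum′∼0 : i * t′ + j * t′ ∼ 0 [ p ]
          sum′∼0 = subst (_∼ 0 [ p ]) (ℕ.*-distribʳ-+ t′ i j)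
            (∼-*ʳ t′ (∼-trans (∼-weaken p∣n i+j∼) (∣⇒∼0 (n∣m*n m₃))))
          p⊥i : Coprime p i
          p⊥i = prime-coprime p-prime (prime∤* p-prime p∤m₁ p∤r)

        agree : t ∼ t′ [ p ]
        agree = at-1 (F≈0? 1)
          where
          at-p : F 1 ≈ [] → Dec (p ≡ q) → Dec (p ≡ r) → Dec (F p ≈ []) → t ∼ t′ [ p ]
          at-p F1≈0 (yes p≡q) _ _ = ⊥-elim (contradiction F1≈0 (inj₁ p≡q))
          at-p F1≈0 _ (yes p≡r) _ = ⊥-elim (contradiction F1≈0 (inj₂ (inj₁ p≡r)))
          at-p F1≈0 _ _ (yes Fp≈0) = ⊥-elim (contradiction F1≈0 (inj₂ (inj₂ Fp≈0)))
          at-p F1≈0 (no p≢q) (no p≢r) (no Fp≉0) = agree-through-p p≢q p≢r Fp≉0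
          at-1 : Dec (F 1 ≈ []) → t ∼ t′ [ p ]
          at-1 (no F1≉0) = agree-through-1 F1≉0
          at-1 (yes F1≈0) = at-p F1≈0 (p ℕ.≟ q) (p ℕ.≟ r) (F≈0? p)

    compatible-three-primes : (∀ m → ZeroOne (coef n m f)) → ∀ {ps} → All Prime ps → length ps ≤ 3 → n ≡ product ps → Compatible
    compatible-three-primes zeroOne {ps} ps-prime len n≡∏ = compatible-by resolve
      where
      resolve : ∀ {a d t a′ d′ t′} → ¬ F a ≈ [] → ¬ F a′ ≈ [] → Phase a t → Phase a′ t′ → Clash a d a′ d′ → t ∼ t′ [ gcd d d′ ]
      resolve {a} {d} {t} {a′} {d′} {t′} F≉0 F≉0′ P P′ clash =
        ThreePrimes.agree zeroOne (proj₁ primes) (proj₁ (proj₂ primes)) (proj₁ (proj₂ (proj₂ primes)))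
          (λ q≡r → q≢1 (q⊥r (∣-refl , subst (q ∣_) q≡r ∣-refl)))
          (trans n≡cqrm (by-m (c * q * r)))
          (subst (λ x → F x ≈ []) (by-m (q * r)) F≈0)
          (λ e → F≉0 (subst (λ x → F x ≈ []) (sym (trans a≡rm (by-m r))) e))
          (λ e → F≉0′ (subst (λ x → F x ≈ []) (sym (trans a′≡qm (by-m q))) e))
          (subst (λ x → Phase x t) (trans a≡rm (by-m r)) P)
          (subst (λ x → Phase x t′) (trans a′≡qm (by-m q)) P′)
        where
        open Clash clash
        c = gcd d d′
        -- The three nontrivial factors of the clash use up all primes of n, so m = 1 and the
        -- frequencies a, a′ are r, q.
        primes = three-prime-factors ps-prime len c q r m (trans (sym n≡cqrm) n≡∏) c≢1 q≢1 r≢1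
        by-m : ∀ x → x * m ≡ x
        by-m x = trans (cong (x *_) (proj₂ (proj₂ (proj₂ primes)))) (ℕ.*-identityʳ x)

-- Generating elements of subsets, their triple products, and the theorem.

open import Data.Nat as ℕ using (ℕ; zero; suc; NonZero; _≤_; _<_; _+_; _*_; _^_)
import Data.Nat.Properties as ℕ
open import Data.Nat.Divisibility
open import Data.Nat.DivMod using (m%n<n; m<n⇒m%n≡m)
open import Data.Nat.ListAction using (product)
open import Data.Nat.Primality
open import Data.Integer as ℤ using (ℤ; +_; 1ℤ)
import Data.Integer.Properties as ℤ
import Data.Integer.Tactic.RingSolver as ℤ-Solver
import Data.Nat.Tactic.RingSolver as ℕ-Solver
open import Data.Bool using (true; false)
open import Data.Fin using (Fin; toℕ; fromℕ<)
open import Data.Fin.Properties using (toℕ<n; toℕ-fromℕ<; fromℕ<-cong; toℕ-injective)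
open import Data.List.Base using ([]; _∷_; length)
open import Data.List.Relation.Unary.All as All using (All; []; _∷_)
open import Function using (_∘_)
open import Relation.Binary.Definitions using (tri<; tri≈; tri>)
open import Relation.Binary.PropositionalEquality hiding (resp; setoid)
open Arith
open RingTheory
open GroupRing hiding (module A)
open Cyclotomic hiding (module Z; module ZD; _≋_)
open Phases
open Deck
open Table
open Clash

open ℤR using (Σ<; Σ-cong; Σ-*ˡ; Σ-*ʳ; Σ-swap; Σ-suc)

fromFunction : ℕ → (ℕ → ℤ) → Element
fromFunction zero    e = []
fromFunction (suc m) e = (e m , m) ∷ fromFunction m e

∫-fromFunction : ∀ m e h → ∫ (fromFunction m e) h ≡ Σ< m (λ i → e i ℤ.* h i)
∫-fromFunction zero    e h = refl
∫-fromFunction (suc m) e h =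
  trans (ℤ.+-comm (e m ℤ.* h m) _) (cong (ℤ._+ e m ℤ.* h m) (∫-fromFunction m e h))

sumFin-Σ : ∀ m (F : Fin m → ℕ) (G : ℕ → ℤ) → (∀ x → + F x ≡ G (toℕ x)) → + sumFin F ≡ Σ< m G
sumFin-Σ zero    F G h = refl
sumFin-Σ (suc m) F G h = trans (cong₂ ℤ._+_ (h Fin.zero) (sumFin-Σ m (F ∘ Fin.suc) (G ∘ suc) (h ∘ Fin.suc))) (Σ-suc m G)

cube-injective : ∀ k l → k * k * k ≡ l * l * l → k ≡ l
cube-injective k l eq = by-order (ℕ.<-cmp k l)
  where
  cube-< : ∀ {k l} → k < l → k * k * k < l * l * l
  cube-< k<l = ℕ.*-mono-< (ℕ.*-mono-< k<l k<l) k<l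
  by-order : _ → k ≡ l
  by-order (tri< k<l _ _) = ⊥-elim (ℕ.<⇒≢ (cube-< k<l) eq)
  by-order (tri≈ _ k≡l _) = k≡l
  by-order (tri> _ _ l<k) = ⊥-elim (ℕ.<⇒≢ (cube-< l<k) (sym eq))

χ-injective : ∀ {a b} → + χ a ≡ + χ b → a ≡ b
χ-injective {false} {false} _ = refl
χ-injective {true}  {true}  _ = refl

χ-zeroOne : ∀ b → ZeroOne (+ χ b)
χ-zeroOne false = inj₁ refl
χ-zeroOne true  = inj₂ refl

module _ (n : ℕ) .{{n≢0 : NonZero n}} where

  residue : ℕ → Fin n
  residue i = fromℕ< (m%n<n i n)

  residue-cong : ∀ {i j} → i ∼ j [ n ] → residue i ≡ residue j
  residue-cong i∼j = fromℕ<-cong _ _ (∼⇒%≡ n i∼j) _ _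

  residue-toℕ : ∀ x → residue (toℕ x) ≡ x
  residue-toℕ x = toℕ-injective (trans (toℕ-fromℕ< _) (m<n⇒m%n≡m (toℕ<n x)))

  toℕ-residue : ∀ i → toℕ (residue i) ∼ i [ n ]
  toℕ-residue i = subst (_∼ i [ n ]) (sym (toℕ-fromℕ< _)) (∼-sym (residue-∼ i n))

  indicator : Subsetₙ n → ℕ → ℤ
  indicator S i = + χ (S (residue i))

  indicator-periodic : ∀ S → Periodic n (indicator S)
  indicator-periodic S = periodic λ i∼j → cong (λ x → + χ (S x)) (residue-cong i∼j)

  indicator-toℕ : ∀ S x → indicator S (toℕ x) ≡ + χ (S x)
  indicator-toℕ S x = cong (λ y → + χ (S y)) (residue-toℕ x)

  generating : Subsetₙ n → Element
  generating S = fromFunction n (indicator S)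

  coef-generating : ∀ S m → coef n m (generating S) ≡ indicator S m
  coef-generating S m = begin
    coef n m (generating S)                            ≡⟨ ∫-fromFunction n (indicator S) (δ n m) ⟩
    Σ< n (λ i → indicator S i ℤ.* δ n m i)             ≡⟨ Σ-cong n (λ {i} _ → trans (ℤ.*-comm (indicator S i) (δ n m i))
                                                           (cong (ℤ._* indicator S i) (δ-iff n {m} {i} {i} {m} ∼-sym ∼-sym))) ⟩
    Σ< n (λ i → δ n i m ℤ.* indicator S i)             ≡⟨ sift n (indicator-periodic S) m ⟨
    indicator S m                                      ∎
    where open ≡-Reasoning

  -- A shift by one exchanges the term at i for the one at i + n, which is equal by periodicity.
  Σ-rotate : ∀ {P} → Periodic n P → ∀ i → Σ< n P ≡ Σ< n (λ j → P (i + j))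
  Σ-rotate p zero = refl
  Σ-rotate {P} p (suc i) = trans (Σ-rotate p i) (sym (ℤR.+-cancelˡ (P (i + 0)) _ _ (begin
    P (i + 0) ℤ.+ Σ< n (λ j → P (suc i + j))     ≡⟨ cong (λ z → P (i + 0) ℤ.+ z) (Σ-cong n (λ {j} _ → cong P (sym (ℕ.+-suc i j)))) ⟩
    P (i + 0) ℤ.+ Σ< n (λ j → P (i + suc j))     ≡⟨ Σ-suc n (λ j → P (i + j)) ⟩
    Σ< n (λ j → P (i + j)) ℤ.+ P (i + n)         ≡⟨ cong (λ z → Σ< n (λ j → P (i + j)) ℤ.+ z) (Periodic.resp p (∼-+ (∼-refl {i}) (∣⇒∼0 ∣-refl))) ⟩
    Σ< n (λ j → P (i + j)) ℤ.+ P (i + 0)         ≡⟨ ℤ.+-comm _ (P (i + 0)) ⟩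
    P (i + 0) ℤ.+ Σ< n (λ j → P (i + j))         ∎)))
    where open ≡-Reasoning

  module _ (S : Subsetₙ n) where

    private
      e : ℕ → ℤ
      e = indicator S
      f : Element
      f = generating S

    correlation : ℕ → ℕ → ℤ
    correlation j k = Σ< n (λ i → e i ℤ.* e (i + j) ℤ.* e (i + k))

    deck3-correlation : ∀ x₁ x₂ → + deck3 S x₁ x₂ ≡ correlation (toℕ x₁) (toℕ x₂)
    deck3-correlation x₁ x₂ = sumFin-Σ n _ _ λ x → begin
      + (χ (S x) * χ (S (x +ₙ x₁)) * χ (S (x +ₙ x₂)))              ≡⟨ ℤ.pos-* (χ (S x) * χ (S (x +ₙ x₁))) (χ (S (x +ₙ x₂))) ⟩
      + (χ (S x) * χ (S (x +ₙ x₁))) ℤ.* + χ (S (x +ₙ x₂))            ≡⟨ cong (ℤ._* + χ (S (x +ₙ x₂))) (ℤ.pos-* (χ (S x)) (χ (S (x +ₙ x₁)))) ⟩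
      + χ (S x) ℤ.* + χ (S (x +ₙ x₁)) ℤ.* + χ (S (x +ₙ x₂))            ≡⟨ cong (λ z → z ℤ.* + χ (S (x +ₙ x₁)) ℤ.* + χ (S (x +ₙ x₂))) (indicator-toℕ S x) ⟨
      e (toℕ x) ℤ.* e (toℕ x + toℕ x₁) ℤ.* e (toℕ x + toℕ x₂)      ∎
      where open ≡-Reasoning

    ∫-σf : ∀ k h → ∫ (σ k f) h ≡ Σ< n (λ i → e i ℤ.* h (k * i))
    ∫-σf k h = trans (∫-σ k f h) (∫-fromFunction n e (λ i → h (k * i)))

    Σ-shifted : ∀ {K} → Periodic n K → ∀ i → Σ< n (λ j → e j ℤ.* K j) ≡ Σ< n (λ j → e (i + j) ℤ.* K (i + j))
    Σ-shifted {K} p = Σ-rotate {λ j → e j ℤ.* K j}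
      (periodic λ a∼b → cong₂ ℤ._*_ (Periodic.resp (indicator-periodic S) a∼b) (Periodic.resp p a∼b))

    -- Shifting the last two summation variables by the first turns the exponent into (a + b + c) i
    -- + b j + c k, whose first part vanishes modulo n. The test function is then free of i, and
    -- summing over i produces the 3-deck.
    triple-integral : ∀ a b c → n ∣ a + b + c → ∀ {h} → Periodic n h →
      ∫ (σ a f ⊛ σ b f ⊛ σ c f) h ≡ Σ< n (λ j → Σ< n (λ k → correlation j k ℤ.* h (b * j + c * k)))
    triple-integral a b c n∣ {h} p = begin
      ∫ (σ a f ⊛ σ b f ⊛ σ c f) h
        ≡⟨ ∫-⊛ (σ a f ⊛ σ b f) (σ c f) h ⟩
      ∫ (σ a f ⊛ σ b f) (λ y → ∫ (σ c f) (λ z → h (y + z)))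
        ≡⟨ ∫-⊛ (σ a f) (σ b f) _ ⟩
      ∫ (σ a f) (λ x → ∫ (σ b f) (λ y → ∫ (σ c f) (λ z → h (x + y + z))))
        ≡⟨ ∫-σf a _ ⟩
      Σ< n (λ i → e i ℤ.* ∫ (σ b f) (λ y → ∫ (σ c f) (λ z → h (a * i + y + z))))
        ≡⟨ Σ-cong n (λ {i} _ → cong (e i ℤ.*_) (inner i)) ⟩
      Σ< n (λ i → e i ℤ.* Σ< n (λ j → e (i + j) ℤ.* Σ< n (λ k → e (i + k) ℤ.* H j k)))
        ≡⟨ Σ-cong n (λ {i} _ → trans (Σ-*ˡ n (e i) _) (Σ-cong n (λ {j} _ → flatten i j))) ⟩
      Σ< n (λ i → Σ< n (λ j → Σ< n (λ k → e i ℤ.* e (i + j) ℤ.* e (i + k) ℤ.* H j k)))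
        ≡⟨ Σ-swap n n _ ⟩
      Σ< n (λ j → Σ< n (λ i → Σ< n (λ k → e i ℤ.* e (i + j) ℤ.* e (i + k) ℤ.* H j k)))
        ≡⟨ Σ-cong n (λ {j} _ → Σ-swap n n _) ⟩
      Σ< n (λ j → Σ< n (λ k → Σ< n (λ i → e i ℤ.* e (i + j) ℤ.* e (i + k) ℤ.* H j k)))
        ≡⟨ Σ-cong n (λ {j} _ → Σ-cong n (λ {k} _ → Σ-*ʳ n (H j k) (λ i → e i ℤ.* e (i + j) ℤ.* e (i + k)))) ⟨
      Σ< n (λ j → Σ< n (λ k → correlation j k ℤ.* H j k)) ∎
      where
      open ≡-Reasoning
      H : ℕ → ℕ → ℤ
      H j k = h (b * j + c * k)
      periodic-k : ∀ x → Periodic n (λ k → h (x + c * k))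
      periodic-k x = periodic λ k∼k′ → Periodic.resp p (∼-+ (∼-refl {x}) (∼-*ˡ c k∼k′))
      inner-k : ∀ i x → ∫ (σ c f) (λ z → h (x + z)) ≡ Σ< n (λ k → e (i + k) ℤ.* h (x + c * (i + k)))
      inner-k i x = trans (∫-σf c (λ z → h (x + z))) (Σ-shifted (periodic-k x) i)
      periodic-j : ∀ i x → Periodic n (λ j → Σ< n (λ k → e (i + k) ℤ.* h (x + b * j + c * (i + k))))
      periodic-j i x = periodic λ j∼j′ → Σ-cong n λ {k} _ → cong (e (i + k) ℤ.*_)
        (Periodic.resp p (∼-+ (∼-+ (∼-refl {x}) (∼-*ˡ b j∼j′)) (∼-refl {c * (i + k)})))
      exponent : ∀ a b c i j k → a * i + b * (i + j) + c * (i + k) ≡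
                 (a + b + c) * i + (b * j + c * k)
      exponent = ℕ-Solver.solve-∀
      exponent-∼ : ∀ i j k → a * i + b * (i + j) + c * (i + k) ∼ b * j + c * k [ n ]
      exponent-∼ i j k = ∼-trans (∼-reflexive (exponent a b c i j k))
        (∼-+ (∣⇒∼0 (∣m⇒∣m*n i n∣)) (∼-refl {b * j + c * k}))
      inner : ∀ i → ∫ (σ b f) (λ y → ∫ (σ c f) (λ z → h (a * i + y + z))) ≡
              Σ< n (λ j → e (i + j) ℤ.* Σ< n (λ k → e (i + k) ℤ.* H j k))
      inner i = begin
        ∫ (σ b f) (λ y → ∫ (σ c f) (λ z → h (a * i + y + z)))
          ≡⟨ ∫-cong (σ b f) (λ y → inner-k i (a * i + y)) ⟩
        ∫ (σ b f) (λ y → Σ< n (λ k → e (i + k) ℤ.* h (a * i + y + c * (i + k))))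
          ≡⟨ ∫-σf b _ ⟩
        Σ< n (λ j → e j ℤ.* Σ< n (λ k → e (i + k) ℤ.* h (a * i + b * j + c * (i + k))))
          ≡⟨ Σ-shifted (periodic-j i (a * i)) i ⟩
        Σ< n (λ j → e (i + j) ℤ.* Σ< n (λ k → e (i + k) ℤ.* h (a * i + b * (i + j) + c * (i + k))))
          ≡⟨ Σ-cong n (λ {j} _ → cong (e (i + j) ℤ.*_) (Σ-cong n (λ {k} _ →
               cong (e (i + k) ℤ.*_) (Periodic.resp p (exponent-∼ i j k))))) ⟩
        Σ< n (λ j → e (i + j) ℤ.* Σ< n (λ k → e (i + k) ℤ.* H j k)) ∎
      assoc₄ : ∀ x y z w → x ℤ.* (y ℤ.* (z ℤ.* w)) ≡ x ℤ.* y ℤ.* z ℤ.* w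
      assoc₄ = ℤ-Solver.solve-∀
      flatten : ∀ i j → e i ℤ.* (e (i + j) ℤ.* Σ< n (λ k → e (i + k) ℤ.* H j k)) ≡
                Σ< n (λ k → e i ℤ.* e (i + j) ℤ.* e (i + k) ℤ.* H j k)
      flatten i j = trans (cong (e i ℤ.*_) (Σ-*ˡ n (e (i + j)) _)) (trans (Σ-*ˡ n (e i) _)
        (Σ-cong n (λ {k} _ → assoc₄ (e i) (e (i + j)) (e (i + k)) (H j k))))

    total-count : Count e n
    total-count = count-zeroOne (λ i → χ-zeroOne (S (residue i))) n

    size : ℕ
    size = Count.count total-count

    σ0≋size : _≋_ n (σ 0 f) (const (+ size))
    σ0≋size = mk λ {h} _ → trans (∫-σf 0 h) (trans (sym (Σ-*ʳ n (h 0) e))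
      (trans (cong (ℤ._* h 0) (Count.total total-count)) (sym (∫-const (+ size) h))))

    empty : size ≡ 0 → ∀ x → S x ≡ false
    empty size≡0 x = by-value (S x) refl
      where
      by-value : ∀ b → S x ≡ b → S x ≡ false
      by-value false Sx≡ = Sx≡
      by-value true  Sx≡ = ⊥-elim (ℕ.<⇒≢ (Count.positive total-count (toℕ<n x)
        (trans (indicator-toℕ S x) (cong (λ b → + χ b) Sx≡))) (sym size≡0))

  module _ (E F : Subsetₙ n) (same-deck : ∀ x₁ x₂ → deck3 E x₁ x₂ ≡ deck3 F x₁ x₂) where

    private
      module A = GroupRing.A n
      f g : Element
      f = generating E
      g = generating F

    same-correlation : ∀ {j k} → j < n → k < n → correlation E j k ≡ correlation F j k
    same-correlation {j} {k} j<n k<n = begin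
      correlation E j k                             ≡⟨ cong₂ (correlation E) (toℕ-fromℕ< j<n) (toℕ-fromℕ< k<n) ⟨
      correlation E (toℕ (fromℕ< j<n)) (toℕ (fromℕ< k<n))  ≡⟨ deck3-correlation E _ _ ⟨
      + deck3 E (fromℕ< j<n) (fromℕ< k<n)           ≡⟨ cong +_ (same-deck _ _) ⟩
      + deck3 F (fromℕ< j<n) (fromℕ< k<n)           ≡⟨ deck3-correlation F _ _ ⟩
      correlation F (toℕ (fromℕ< j<n)) (toℕ (fromℕ< k<n))  ≡⟨ cong₂ (correlation F) (toℕ-fromℕ< j<n) (toℕ-fromℕ< k<n) ⟩
      correlation F j k                             ∎
      where open ≡-Reasoning

    same-triple : ∀ a b c → n ∣ a + b + c → _≋_ n (σ a f ⊛ σ b f ⊛ σ c f) (σ a g ⊛ σ b g ⊛ σ c g)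
    same-triple a b c n∣ = mk λ {h} p → begin
      ∫ (σ a f ⊛ σ b f ⊛ σ c f) h
        ≡⟨ triple-integral E a b c n∣ p ⟩
      Σ< n (λ j → Σ< n (λ k → correlation E j k ℤ.* h (b * j + c * k)))
        ≡⟨ Σ-cong n (λ {j} j<n → Σ-cong n (λ {k} k<n → cong (ℤ._* h (b * j + c * k)) (same-correlation j<n k<n))) ⟩
      Σ< n (λ j → Σ< n (λ k → correlation F j k ℤ.* h (b * j + c * k)))
        ≡⟨ triple-integral F a b c n∣ p ⟨
      ∫ (σ a g ⊛ σ b g ⊛ σ c g) h ∎
      where open ≡-Reasoning

    -- The frequencies 0, 0, 0 form an admissible triple, and at frequency 0 the generating element
    -- is the size of the set; so the cubes of the sizes agree.
    same-size : size E ≡ size F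
    same-size = cube-injective (size E) (size F) (ℤ.+-injective (trans (pos-cube (size E)) (trans cubes (sym (pos-cube (size F))))))
      where
      pos-cube : ∀ k → + (k * k * k) ≡ + k ℤ.* + k ℤ.* + k
      pos-cube k = trans (ℤ.pos-* (k * k) k) (cong (ℤ._* + k) (ℤ.pos-* k k))
      cube : ∀ {a k} → _≋_ n a (const (+ k)) → _≋_ n (a ⊛ a ⊛ a) (const (+ k ℤ.* + k ℤ.* + k))
      cube {a} {k} e = A.trans (A.*-cong (A.*-cong e e) e)
        (A.trans (A.*-congʳ {const (+ k)} (const-* n (+ k) (+ k))) (const-* n (+ k ℤ.* + k) (+ k)))
      const-injective : ∀ {c d} → _≋_ n (const c) (const d) → c ≡ d
      const-injective {c} {d} e = trans (sym (trans (∫-const c (λ _ → 1ℤ)) (ℤ.*-identityʳ c)))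
        (trans (_≋_.acts e (periodic λ _ → refl)) (trans (∫-const d (λ _ → 1ℤ)) (ℤ.*-identityʳ d)))
      cubes : + size E ℤ.* + size E ℤ.* + size E ≡ + size F ℤ.* + size F ℤ.* + size F
      cubes = const-injective (A.trans (A.sym (cube (σ0≋size E))) (A.trans (same-triple 0 0 0 (n ∣0)) (cube (σ0≋size F))))

    σ0-agree : _≈ₑ_ n (σ 0 f) (σ 0 g)
    σ0-agree = ≈⇒≈ₑ n (A.trans (σ0≋size E) (A.trans (A.reflexive (cong (λ k → const (+ k)) same-size)) (A.sym (σ0≋size F))))

    σ0-nonzero : size E ≢ 0 → ¬ _≈ₑ_ n (σ 0 f) []
    σ0-nonzero size≢0 e = size≢0 (ℤ.+-injective (const≈0 n (Cyclotomic.Z.trans n (≈⇒≈ₑ n (A.sym (σ0≋size E))) e)))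

    translate : ∃[ t ] _≋_ n g (X t ⊛ f) → ∃[ t ] IsTranslate F E t
    translate (t , g≋X^tf) = residue t , λ x → χ-injective (begin
      + χ (F (x +ₙ residue t))            ≡⟨ cong (λ y → + χ (F y)) (residue-cong (∼-trans (∼-+ (∼-refl {toℕ x}) (toℕ-residue t)) (∼-reflexive (ℕ.+-comm (toℕ x) t)))) ⟩
      indicator F (t + toℕ x)           ≡⟨ coef-generating F (t + toℕ x) ⟨
      coef n (t + toℕ x) g              ≡⟨ coef-cong n (t + toℕ x) g≋X^tf ⟩
      coef n (t + toℕ x) (X t ⊛ f)      ≡⟨ coef-shift n (toℕ x) t f ⟩
      coef n (toℕ x) f                    ≡⟨ coef-generating E (toℕ x) ⟩
      indicator E (toℕ x)                 ≡⟨ indicator-toℕ E x ⟩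
      + χ (E x)                           ∎)
      where open ≡-Reasoning

    generating-zeroOne : ∀ m → ZeroOne (coef n m f)
    generating-zeroOne m = subst ZeroOne (sym (coef-generating E m)) (χ-zeroOne (E (residue m)))

    reconstruct : ¬ 2 ∣ n → (∃[ p ] ∃[ k ] (Prime p × n ≡ p ^ k)) ⊎ (∃[ ps ] (All Prime ps × length ps ≤ 3 × n ≡ product ps)) →
                  ∃[ t ] IsTranslate F E t
    reconstruct odd shape = by-size (size E ℕ.≟ 0)
      where
      by-shape : size E ≢ 0 → _ → ∃[ t ] _≋_ n g (X t ⊛ f)
      by-shape size≢0 (inj₁ (p , k , p-prime , n≡)) = translation (compatible-prime-power {p} {k} p-prime n≡)
        where
        open SameDeck n odd f g same-triple σ0-agree (σ0-nonzero size≢0) using (translation)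
        open Compatibility n odd f g same-triple σ0-agree (σ0-nonzero size≢0) using (compatible-prime-power)
      by-shape size≢0 (inj₂ (ps , ps-prime , len , n≡)) = translation (compatible-three-primes generating-zeroOne ps-prime len n≡)
        where
        open SameDeck n odd f g same-triple σ0-agree (σ0-nonzero size≢0) using (translation)
        open Compatibility n odd f g same-triple σ0-agree (σ0-nonzero size≢0) using (compatible-three-primes)
      by-size : Dec (size E ≡ 0) → ∃[ t ] IsTranslate F E t
      -- The empty set is set apart because its Fourier coefficient at 0 cannot be cancelled; here
      -- both sets are empty and the shift 0 serves.
      by-size (yes size≡0) = residue 0 , λ x → trans (empty F (trans (sym same-size) size≡0) _) (sym (empty E size≡0 x))
      by-size (no size≢0) = translate (by-shape size≢0 shape)

odd-product : ∀ {ps} → All OddPrime ps → ¬ 2 ∣ product ps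
odd-product [] 2∣1 with () ← ∣1⇒≡1 2∣1
odd-product {p ∷ ps} ((_ , odd) ∷ rest) 2∣ = by-cases (euclidsLemma p (product ps) prime[2] 2∣)
  where
  by-cases : 2 ∣ p ⊎ 2 ∣ product ps → ⊥
  by-cases (inj₁ 2∣p) = odd 2∣p
  by-cases (inj₂ 2∣∏) = odd-product rest 2∣∏

theorem1 : (n : ℕ) .{{_ : NonZero n}} →
    (OddPrimePower n ⊎ ProductOfAtMost3OddPrimes n) →
    (E F : Subsetₙ n) →
    (∀ x₁ x₂ → deck3 E x₁ x₂ ≡ deck3 F x₁ x₂) →
    ∃[ t ] IsTranslate F E t
theorem1 n (inj₁ (p , k , (p-prime , p-odd) , _ , n≡p^k)) E F same-deck = reconstruct n E F same-deck
  (λ 2∣n → p-odd (subst (2 ∣_) (prime∣^ prime[2] p-prime k (subst (2 ∣_) n≡p^k 2∣n)) ∣-refl))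
  (inj₁ (p , k , p-prime , n≡p^k))
theorem1 n (inj₂ (ps , odd-primes , len , n≡∏)) E F same-deck = reconstruct n E F same-deck
  (λ 2∣n → odd-product odd-primes (subst (2 ∣_) n≡∏ 2∣n))
  (inj₂ (ps , All.map proj₁ odd-primes , len , n≡∏))
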